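{- Let $\mu=x_0i+y_0j+z_0k\in\mathcal H$ with $m=N(\mu)$ squarefree, where exactly two of $x_0,y_0,z_0$ are equal to each other in absolute value. Let $R_\mu(\rho)$ be an ideal of $\mathcal O(\mu)$ with right pseudo generator $\rho$, and write $\mu'=\rho\mu\rho^{ -1}=x_1i+y_1j+z_1k$. Then the ideal class $[R_\mu(\rho)]$ is ambiguous if and only if exactly two of $x_1,y_1,z_1$ are equal to each other in absolute value.
   Context: Quaternions with Hamilton multiplication, $\Re$, $N$, conjugate $\overline q$, $q^{ -1}=\overline q/N(q)$. $\mathcal H$ = Hurwitz integral quaternions $(a+bi+cj+dk)/2$, $a,b,c,d\in\mathbb Z$ of equal parity. With $r=1$ if $m\not\equiv3\pmod4$, $r=2$ otherwise, and $\omega=(r-1+\mu)/r$, $\mathcal O(\mu)=\mathbb Z+\mathbb Z\omega$ is a commutative subring of $\mathcal H$ isomorphic to the maximal order of $\mathbb Q(\sqrt{ -m})$. Every nonzero ideal of $\mathcal O(\mu)$ has $\mathbb Z$-basis $c[a,b+\omega]$ ($c,a>0$); its right pseudo generator is $c\cdot\gcd_r(a,b+\omega)$ (greatest-norm common right divisor in $\mathcal H$, unique up to a unit on the left), and $R_\mu(\rho)=\{\xi\rho:\xi\in\mathcal H,\ \xi\rho\in\mathcal O(\mu)\}$ is the ideal with right pseudo generator $\rho$. Two ideals $\mathfrak a,\mathfrak b$ are equivalent if $\alpha\mathfrak a=\beta\mathfrak b$ for some nonzero $\alpha,\beta\in\mathcal O(\mu)$; the class $[\mathfrak a]$ is ambiguous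 if $[\mathfrak a]=[\overline{\mathfrak a}]$, where $\overline{\mathfrak a}=\{\overline x:x\in\mathfrak a\}$. -}

module Defs where

open import Data.Nat as ℕ using (ℕ; zero; suc)
open import Data.Nat.Divisibility as ℕD using ()
open import Data.Nat.DivMod using (_%_)
open import Data.Integer as ℤ using (ℤ; +_)
open import Data.Integer.Divisibility as ℤD using ()
open import Data.Rational as ℚ using (ℚ; 0ℚ; 1ℚ; _+_; _*_; -_; _-_; _/_; 1/_; ∣_∣; _≤_)
open import Data.Rational.Properties using (_≟_)
open import Data.Product using (Σ; ∃; _×_; _,_)
open import Data.Sum using (_⊎_)
open import Relation.Nullary using (¬_; yes; no)
open import Relation.Binary.PropositionalEquality using (_≡_; _≢_)
open import Function.Bundles using (_⇔_)

record Quat : Set where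
  constructor quat
  field
    re im-i im-j im-k : ℚ
open Quat public

_·_ : Quat → Quat → Quat
quat a1 b1 c1 d1 · quat a2 b2 c2 d2 =
  quat (a1 * a2 - b1 * b2 - c1 * c2 - d1 * d2)
       (a1 * b2 + b1 * a2 + c1 * d2 - d1 * c2)
       (a1 * c2 - b1 * d2 + c1 * a2 + d1 * b2)
       (a1 * d2 + b1 * c2 - c1 * b2 + d1 * a2)
infixl 7 _·_

_⊕_ : Quat → Quat → Quat
quat a1 b1 c1 d1 ⊕ quat a2 b2 c2 d2 = quat (a1 + a2) (b1 + b2) (c1 + c2) (d1 + d2)
infixl 6 _⊕_

scal : ℚ → Quat
scal x = quat x 0ℚ 0ℚ 0ℚ

ℤq : ℤ → Quat
ℤq n = scal (n / 1)

0q : Quat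
0q = scal 0ℚ

conj : Quat → Quat
conj (quat a b c d) = quat a (- b) (- c) (- d)

N : Quat → ℚ
N (quat a b c d) = a * a + b * b + c * c + d * d

-- total reciprocal on ℚ (value at 0 irrelevant; only used for N ρ ≠ 0)
recip : ℚ → ℚ
recip p with p ≟ 0ℚ
... | yes _ = 0ℚ
... | no p≢0 = 1/ p
  where instance _ = ℚ.≢-nonZero p≢0

inv : Quat → Quat
inv q = scal (recip (N q)) · conj q

SameParity : ℤ → ℤ → Set
SameParity x y = (+ 2) ℤD.∣ (x ℤ.- y)

IsHurwitz : Quat → Set
IsHurwitz q = Σ ℤ λ a → Σ ℤ λ b → Σ ℤ λ c → Σ ℤ λ d →
  SameParity a b × SameParity a c × SameParity a d ×
  q ≡ quat (a / 2) (b / 2) (c / 2) (d / 2)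

-- The pure quaternion μ = x0 i + y0 j + z0 k (integer coordinates: a pure
-- Hurwitz quaternion necessarily has integer coordinates)

pureQ : ℤ → ℤ → ℤ → Quat
pureQ x y z = quat 0ℚ (x / 1) (y / 1) (z / 1)

normℕ : ℤ → ℤ → ℤ → ℕ
normℕ x y z = ℤ.∣ x ℤ.* x ℤ.+ y ℤ.* y ℤ.+ z ℤ.* z ∣

SquareFree : ℕ → Set
SquareFree m = ∀ (p : ℕ) → (p ℕ.* p) ℕD.∣ m → p ≡ 1

ω : ℤ → ℤ → ℤ → Quat
ω x y z with normℕ x y z % 4
... | 3 = scal ((+ 1) / 2) · (scal 1ℚ ⊕ pureQ x y z)
... | _ = pureQ x y z

InO : ℤ → ℤ → ℤ → Quat → Set
InO x y z q = Σ ℤ λ s → Σ ℤ λ t → q ≡ ℤq s ⊕ ℤq t · ω x y z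

Subset : Set₁
Subset = Quat → Set

Lattice : ℤ → ℤ → ℤ → ℕ → ℕ → ℤ → Subset
Lattice x y z c a b q = Σ ℤ λ s → Σ ℤ λ t →
  q ≡ ℤq (+ c) · (ℤq (s ℤ.* + a) ⊕ ℤq t · (ℤq b ⊕ ω x y z))

-- a subset of O(μ) closed under multiplication by O(μ) (the lattice is
-- automatically an additive group)
IsIdealOf : ℤ → ℤ → ℤ → Subset → Set
IsIdealOf x y z I = ∀ o q → InO x y z o → I q → I (o · q)

_∣ᵣ_ : Quat → Quat → Set
δ ∣ᵣ α = Σ Quat λ u → IsHurwitz u × α ≡ u · δ

CommonRightDivisor : Quat → Quat → Quat → Set
CommonRightDivisor δ α β = IsHurwitz δ × δ ∣ᵣ α × δ ∣ᵣ β

IsGcdᵣ : Quat → Quat → Quat → Set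
IsGcdᵣ δ α β = CommonRightDivisor δ α β ×
  (∀ δ' → CommonRightDivisor δ' α β → N δ' ≤ N δ)

IsRightPseudoGen : ℤ → ℤ → ℤ → ℕ → ℕ → ℤ → Quat → Set
IsRightPseudoGen x y z c a b ρ = Σ Quat λ δ →
  IsGcdᵣ δ (ℤq (+ a)) (ℤq b ⊕ ω x y z) × ρ ≡ ℤq (+ c) · δ

Rμ : ℤ → ℤ → ℤ → Quat → Subset
Rμ x y z ρ q = Σ Quat λ ξ → IsHurwitz ξ × q ≡ ξ · ρ × InO x y z q

conjSet : Subset → Subset
conjSet I q = I (conj q)

scaleSet : Quat → Subset → Subset
scaleSet α I q = Σ Quat λ y → I y × q ≡ α · y

IdealEquiv : ℤ → ℤ → ℤ → Subset → Subset → Set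
IdealEquiv x y z I J = Σ Quat λ α → Σ Quat λ β →
  InO x y z α × InO x y z β × α ≢ 0q × β ≢ 0q ×
  (∀ q → scaleSet α I q ⇔ scaleSet β J q)

Ambiguous : ℤ → ℤ → ℤ → Subset → Set
Ambiguous x y z I = IdealEquiv x y z I (conjSet I)

ExactlyTwoEqual : {A : Set} → A → A → A → Set
ExactlyTwoEqual u v w =
  (u ≡ v × v ≢ w) ⊎ (v ≡ w × w ≢ u) ⊎ (u ≡ w × u ≢ v)

{-# OPTIONS --safe #-}
module Submission where

-- Write H for the Hurwitz order, R = Hρ ∩ 𝒪(μ) and μ' = ρμρ⁻¹. Since two coordinates of μ
-- agree up to sign, some τ among ±i±j, ±j±k, ±i±k is orthogonal to μ, so τμτ⁻¹ = −μ and
-- T(q) = τ⁻¹qτ restricts to complex conjugation on ℚ(μ). As τ generates the two-sided ideal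
-- H(1+i), T is an automorphism of H, hence the conjugate of R is H·T(ρ) ∩ 𝒪(μ).
--
-- If αR = βR̄, then, H being a left principal ideal ring, ρ lies in the left ideal generated
-- by R, and ρα = εT(ρ)β for a unit ε of H. Then η = ετ has norm 2 and ημ' = −μ'η, so η is pure
-- and orthogonal to μ'; being of the form ±i±j, ±j±k or ±i±k it forces two coordinates of μ'
-- to agree up to sign. All three cannot agree, as m = 3r² with m squarefree gives m = 3 and
-- then |x₀| = |y₀| = |z₀|.
--
-- Conversely such an η orthogonal to μ' makes ρ⁻¹ηρτ⁻¹ an element of ℚ(μ) carrying R to R̄,
-- because H ∩ ℚ(μ) = 𝒪(μ) and ητ⁻¹ is a unit of H.

open import Defs
open import Data.Nat using (ℕ; _>_)
open import Data.Integer using (ℤ)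
open import Data.Rational using (∣_∣)
open import Function.Bundles using (_⇔_)
open import Data.Empty using (⊥; ⊥-elim)
open import Data.Fin using (#_)
open import Data.Integer using (+_; -[1+_])
import Data.Integer as ℤ
import Data.Integer.DivMod as ℤDM
import Data.Integer.Divisibility.Signed as ℤS
import Data.Integer.Properties as ℤP
open import Data.Integer.Tactic.RingSolver using (solve-∀)
open import Data.Nat using (zero; suc)
import Data.Nat as ℕ
import Data.Nat.Coprimality as Cop
import Data.Nat.Divisibility as ℕD
import Data.Nat.DivMod as ℕDM
open import Data.Nat.Induction using (<-wellFounded)
import Data.Nat.Properties as ℕP
import Data.Nat.Tactic.RingSolver as ℕR
open import Data.Product using (Σ; _×_; _,_; proj₁; proj₂)
open import Data.Rational using (ℚ; mkℚ; 0ℚ; 1ℚ; ½; _+_; _*_; -_; _-_; _/_)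
import Data.Rational as ℚ
open import Data.Rational.Properties using (_≟_)
import Data.Rational.Properties as ℚP
import Data.Rational.Unnormalised as ℚᵘ
open import Data.Sum using (_⊎_; inj₁; inj₂)
open import Data.Vec using (Vec; []; _∷_)
open import Function.Bundles using (mk⇔; Equivalence)
open import Induction.WellFounded using (Acc; acc)
open import Relation.Binary.PropositionalEquality
open import Relation.Nullary using (yes; no)
open import Relation.Nullary.Decidable using (dec⇒maybe; from-no)
import Tactic.RingSolver.Core.AlmostCommutativeRing as ACR
open import Tactic.RingSolver.NonReflective (ACR.fromCommutativeRing ℚP.+-*-commutativeRing (λ x → dec⇒maybe (0ℚ ≟ x))) as S using (Expr; Κ; Ι; solve)
open ≡-Reasoning

-- Equivalence multiplies an ideal from the left, whereas ρ stands at the right end of its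
-- multiples. A factor α can meet ρ only after crossing an element of R, which is possible because
-- everything that commutes with μ lies in one commutative field. Membership in 𝒪(μ) is therefore
-- handled as "Hurwitz and commuting with μ", and ideals are compared through left multiples of ρα
-- and T(ρ)β.
--
-- That R generates Hρ is not part of the definition of ρ: the gcd is given only as a common right
-- divisor of greatest norm, so a Euclidean algorithm in H has to turn it into a left combination of
-- the generators of the ideal.
--
-- Norm 2 is what keeps all inverses harmless. A pure τ of norm 2 has τ² = -2, hence τ⁻¹ = -τ/2, and
-- since (1+i)² = 2i, a product of two elements of the ideal of 1+i is divisible by 2. This absorbs
-- the factor ½ both in τ⁻¹qτ and in ητ⁻¹.

-- Symbolic quaternions, so that a quaternion identity is decided by the commutative
-- ring solver applied to its four coordinates.
record QExpr (n : ℕ) : Set where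
  constructor qe
  field eᵣ eᵢ eⱼ eₖ : Expr ℚ n
open QExpr

module _ {n : ℕ} where
  infix 4 _≐_
  infixl 6 _+ᵉ_ _-ᵉ_ _⊕ᵉ_
  infixl 7 _*ᵉ_ _·ᵉ_
  _≐_ : Expr ℚ n → Expr ℚ n → Expr ℚ n × Expr ℚ n
  _≐_ = _,_

  _+ᵉ_ _*ᵉ_ _-ᵉ_ : Expr ℚ n → Expr ℚ n → Expr ℚ n
  _+ᵉ_ = S._⊕_
  _*ᵉ_ = S._⊗_
  x -ᵉ y = x S.⊕ (S.⊝ y)

  _·ᵉ_ _⊕ᵉ_ : QExpr n → QExpr n → QExpr n
  qe a1 b1 c1 d1 ·ᵉ qe a2 b2 c2 d2 =
    qe (a1 *ᵉ a2 -ᵉ b1 *ᵉ b2 -ᵉ c1 *ᵉ c2 -ᵉ d1 *ᵉ d2)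
       (a1 *ᵉ b2 +ᵉ b1 *ᵉ a2 +ᵉ c1 *ᵉ d2 -ᵉ d1 *ᵉ c2)
       (a1 *ᵉ c2 -ᵉ b1 *ᵉ d2 +ᵉ c1 *ᵉ a2 +ᵉ d1 *ᵉ b2)
       (a1 *ᵉ d2 +ᵉ b1 *ᵉ c2 -ᵉ c1 *ᵉ b2 +ᵉ d1 *ᵉ a2)
  qe a1 b1 c1 d1 ⊕ᵉ qe a2 b2 c2 d2 = qe (a1 +ᵉ a2) (b1 +ᵉ b2) (c1 +ᵉ c2) (d1 +ᵉ d2)

  conjᵉ : QExpr n → QExpr n
  conjᵉ (qe a b c d) = qe a (S.⊝ b) (S.⊝ c) (S.⊝ d)

  scalᵉ : Expr ℚ n → QExpr n
  scalᵉ a = qe a (Κ 0ℚ) (Κ 0ℚ) (Κ 0ℚ)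

  negᵉ : QExpr n → QExpr n
  negᵉ p = scalᵉ (Κ (- 1ℚ)) ·ᵉ p

  hwᵉ : (a b c d : Expr ℚ n) → QExpr n
  hwᵉ a b c d = qe (Κ ½ *ᵉ a) (Κ ½ *ᵉ a +ᵉ b) (Κ ½ *ᵉ a +ᵉ c) (Κ ½ *ᵉ a +ᵉ d)

  𝕚ᵉ θᵉ : QExpr n
  𝕚ᵉ = qe (Κ 0ℚ) (Κ 1ℚ) (Κ 0ℚ) (Κ 0ℚ)
  θᵉ = qe (Κ 1ℚ) (Κ 1ℚ) (Κ 0ℚ) (Κ 0ℚ)

  Nᵉ : QExpr n → Expr ℚ n
  Nᵉ (qe a b c d) = a *ᵉ a +ᵉ b *ᵉ b +ᵉ c *ᵉ c +ᵉ d *ᵉ d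

quat≡ : ∀ {a b c d a' b' c' d'} → a ≡ a' → b ≡ b' → c ≡ c' → d ≡ d' → quat a b c d ≡ quat a' b' c' d'
quat≡ refl refl refl refl = refl

⟦_⟧q ⟦_⇓⟧q : ∀ {n} → QExpr n → Vec ℚ n → Quat
⟦ qe a b c d ⟧q ρ = quat (S.Ops.⟦ a ⟧ ρ) (S.Ops.⟦ b ⟧ ρ) (S.Ops.⟦ c ⟧ ρ) (S.Ops.⟦ d ⟧ ρ)
⟦ qe a b c d ⇓⟧q ρ = quat (S.Ops.⟦ a ⇓⟧ ρ) (S.Ops.⟦ b ⇓⟧ ρ) (S.Ops.⟦ c ⇓⟧ ρ) (S.Ops.⟦ d ⇓⟧ ρ)

proveQ : ∀ {n} (ρ : Vec ℚ n) (P Q : QExpr n) → ⟦ P ⇓⟧q ρ ≡ ⟦ Q ⇓⟧q ρ → ⟦ P ⟧q ρ ≡ ⟦ Q ⟧q ρ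
proveQ ρ P Q e = quat≡ (l eᵣ (cong re e)) (l eᵢ (cong im-i e)) (l eⱼ (cong im-j e)) (l eₖ (cong im-k e))
  where
  l : (π : QExpr _ → Expr ℚ _) → S.Ops.⟦ π P ⇓⟧ ρ ≡ S.Ops.⟦ π Q ⇓⟧ ρ → S.Ops.⟦ π P ⟧ ρ ≡ S.Ops.⟦ π Q ⟧ ρ
  l π = S.Ops.prove ρ (π P) (π Q)

-- Three generic quaternions over twelve rational variables, evaluated by `env`. Identities in fewer
-- quaternions pad the environment with `0q`; scalars are stored as single coordinates of a slot.
v₁ v₂ v₃ : QExpr 12
v₁ = qe (Ι (# 0)) (Ι (# 1)) (Ι (# 2)) (Ι (# 3))
v₂ = qe (Ι (# 4)) (Ι (# 5)) (Ι (# 6)) (Ι (# 7))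
v₃ = qe (Ι (# 8)) (Ι (# 9)) (Ι (# 10)) (Ι (# 11))

env : Quat → Quat → Quat → Vec ℚ 12
env (quat a b c d) (quat e f g h) (quat s t u v) = a ∷ b ∷ c ∷ d ∷ e ∷ f ∷ g ∷ h ∷ s ∷ t ∷ u ∷ v ∷ []

-- Quaternion algebra

1q : Quat
1q = scal 1ℚ

neg : Quat → Quat
neg q = scal (- 1ℚ) · q

·-assoc : ∀ p q r → p · q · r ≡ p · (q · r)
·-assoc p q r = proveQ (env p q r) (v₁ ·ᵉ v₂ ·ᵉ v₃) (v₁ ·ᵉ (v₂ ·ᵉ v₃)) refl

·-distribˡ : ∀ p q r → p · (q ⊕ r) ≡ p · q ⊕ p · r
·-distribˡ p q r = proveQ (env p q r) (v₁ ·ᵉ (v₂ ⊕ᵉ v₃)) (v₁ ·ᵉ v₂ ⊕ᵉ v₁ ·ᵉ v₃) refl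

·-distribʳ : ∀ p q r → (q ⊕ r) · p ≡ q · p ⊕ r · p
·-distribʳ p q r = proveQ (env p q r) ((v₂ ⊕ᵉ v₃) ·ᵉ v₁) (v₂ ·ᵉ v₁ ⊕ᵉ v₃ ·ᵉ v₁) refl

·-identityˡ : ∀ p → 1q · p ≡ p
·-identityˡ p = proveQ (env p 0q 0q) (scalᵉ (Κ 1ℚ) ·ᵉ v₁) v₁ refl

·-identityʳ : ∀ p → p · 1q ≡ p
·-identityʳ p = proveQ (env p 0q 0q) (v₁ ·ᵉ scalᵉ (Κ 1ℚ)) v₁ refl

scal-central : ∀ s p → scal s · p ≡ p · scal s
scal-central s p = proveQ (env p (scal s) 0q) (scalᵉ (eᵣ v₂) ·ᵉ v₁) (v₁ ·ᵉ scalᵉ (eᵣ v₂)) refl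

scal-* : ∀ s t → scal (s * t) ≡ scal s · scal t
scal-* s t = proveQ (env (scal s) (scal t) 0q) (scalᵉ (eᵣ v₁ *ᵉ eᵣ v₂)) (scalᵉ (eᵣ v₁) ·ᵉ scalᵉ (eᵣ v₂)) refl

conj-· : ∀ p q → conj (p · q) ≡ conj q · conj p
conj-· p q = proveQ (env p q 0q) (conjᵉ (v₁ ·ᵉ v₂)) (conjᵉ v₂ ·ᵉ conjᵉ v₁) refl

conj-involutive : ∀ p → conj (conj p) ≡ p
conj-involutive p = proveQ (env p 0q 0q) (conjᵉ (conjᵉ v₁)) v₁ refl

p·conj[p]≡N : ∀ p → p · conj p ≡ scal (N p)
p·conj[p]≡N p = proveQ (env p 0q 0q) (v₁ ·ᵉ conjᵉ v₁) (scalᵉ (Nᵉ v₁)) refl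

conj[p]·p≡N : ∀ p → conj p · p ≡ scal (N p)
conj[p]·p≡N p = proveQ (env p 0q 0q) (conjᵉ v₁ ·ᵉ v₁) (scalᵉ (Nᵉ v₁)) refl

N-· : ∀ p q → N (p · q) ≡ N p * N q
N-· p q = S.Ops.prove (env p q 0q) (Nᵉ (v₁ ·ᵉ v₂)) (Nᵉ v₁ *ᵉ Nᵉ v₂) refl

N-conj : ∀ p → N (conj p) ≡ N p
N-conj p = S.Ops.prove (env p 0q 0q) (Nᵉ (conjᵉ v₁)) (Nᵉ v₁) refl

N-scal : ∀ s → N (scal s) ≡ s * s
N-scal s = S.Ops.prove (env (scal s) 0q 0q) (Nᵉ (scalᵉ (eᵣ v₁))) (eᵣ v₁ *ᵉ eᵣ v₁) refl

re-·-comm : ∀ p q → re (p · q) ≡ re (q · p)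
re-·-comm p q = S.Ops.prove (env p q 0q) (eᵣ (v₁ ·ᵉ v₂)) (eᵣ (v₂ ·ᵉ v₁)) refl

*-recip : ∀ {s} → s ≢ 0ℚ → recip s * s ≡ 1ℚ
*-recip {s} s≢0 with s ≟ 0ℚ
... | yes s≡0 = ⊥-elim (s≢0 s≡0)
... | no s≢0' = ℚP.*-inverseˡ s {{ℚ.≢-nonZero s≢0'}}

scal-recip-cancel : ∀ {s} → s ≢ 0ℚ → ∀ q → scal (recip s) · (scal s · q) ≡ q
scal-recip-cancel {s} s≢0 q = begin
  scal (recip s) · (scal s · q) ≡⟨ ·-assoc (scal (recip s)) (scal s) q ⟨
  scal (recip s) · scal s · q   ≡⟨ cong (_· q) (scal-* (recip s) s) ⟨
  scal (recip s * s) · q        ≡⟨ cong (λ t → scal t · q) (*-recip s≢0) ⟩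
  1q · q                        ≡⟨ ·-identityˡ q ⟩
  q                             ∎

scal-cancelˡ : ∀ {s} → s ≢ 0ℚ → ∀ {p q} → scal s · p ≡ scal s · q → p ≡ q
scal-cancelˡ {s} s≢0 {p} {q} e = begin
  p                             ≡⟨ scal-recip-cancel s≢0 p ⟨
  scal (recip s) · (scal s · p) ≡⟨ cong (scal (recip s) ·_) e ⟩
  scal (recip s) · (scal s · q) ≡⟨ scal-recip-cancel s≢0 q ⟩
  q                             ∎

-- Multiplication by `conj r` turns the right factor into the central scalar `N r`.
·-cancelʳ : ∀ {r} → N r ≢ 0ℚ → ∀ {p q} → p · r ≡ q · r → p ≡ q
·-cancelʳ {r} r≢0 {p} {q} e = scal-cancelˡ r≢0 (begin
  scal (N r) · p      ≡⟨ l p ⟩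
  p · r · conj r      ≡⟨ cong (_· conj r) e ⟩
  q · r · conj r      ≡⟨ l q ⟨
  scal (N r) · q      ∎)
  where
  l : ∀ p → scal (N r) · p ≡ p · r · conj r
  l p = begin
    scal (N r) · p      ≡⟨ scal-central (N r) p ⟩
    p · scal (N r)      ≡⟨ cong (p ·_) (p·conj[p]≡N r) ⟨
    p · (r · conj r)    ≡⟨ ·-assoc p r (conj r) ⟨
    p · r · conj r      ∎

inv-· : ∀ {q} → N q ≢ 0ℚ → inv q · q ≡ 1q
inv-· {q} q≢0 = begin
  scal (recip (N q)) · conj q · q     ≡⟨ ·-assoc (scal (recip (N q))) (conj q) q ⟩
  scal (recip (N q)) · (conj q · q)   ≡⟨ cong (scal (recip (N q)) ·_) (conj[p]·p≡N q) ⟩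
  scal (recip (N q)) · scal (N q)     ≡⟨ scal-* (recip (N q)) (N q) ⟨
  scal (recip (N q) * N q)            ≡⟨ cong scal (*-recip q≢0) ⟩
  1q                                  ∎

*-nonzero : ∀ {s t} → s ≢ 0ℚ → t ≢ 0ℚ → s * t ≢ 0ℚ
*-nonzero {s} {t} s≢0 t≢0 e = t≢0 (begin
  t                 ≡⟨ ℚP.*-identityˡ t ⟨
  1ℚ * t            ≡⟨ cong (_* t) (*-recip s≢0) ⟨
  recip s * s * t   ≡⟨ ℚP.*-assoc (recip s) s t ⟩
  recip s * (s * t) ≡⟨ cong (recip s *_) e ⟩
  recip s * 0ℚ      ≡⟨ ℚP.*-zeroʳ (recip s) ⟩
  0ℚ                ∎)

square-nonneg : ∀ s → 0ℚ ℚ.≤ s * s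
square-nonneg s with ℚP.≤-total 0ℚ s
... | inj₁ 0≤s = ℚP.nonNegative⁻¹ (s * s) {{ℚP.nonNeg*nonNeg⇒nonNeg s {{nn}} s {{nn}}}}
  where nn = ℚ.nonNegative 0≤s
... | inj₂ s≤0 = ℚP.nonNegative⁻¹ (s * s) {{ℚP.nonPos*nonPos⇒nonPos s {{nn}} s {{nn}}}}
  where nn = ℚ.nonPositive s≤0

+-nonneg : ∀ {s t} → 0ℚ ℚ.≤ s → 0ℚ ℚ.≤ t → 0ℚ ℚ.≤ s + t
+-nonneg {s} {t} 0≤s 0≤t = ℚP.+-mono-≤ {0ℚ} {s} {0ℚ} {t} 0≤s 0≤t

+-nonneg-zero : ∀ {s t} → 0ℚ ℚ.≤ s → 0ℚ ℚ.≤ t → s + t ≡ 0ℚ → s ≡ 0ℚ × t ≡ 0ℚ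
+-nonneg-zero {s} {t} 0≤s 0≤t e =
    ℚP.≤-antisym (subst (s ℚ.≤_) e (subst (ℚ._≤ s + t) (ℚP.+-identityʳ s) (ℚP.+-monoʳ-≤ s 0≤t))) 0≤s
  , ℚP.≤-antisym (subst (t ℚ.≤_) e (subst (ℚ._≤ s + t) (ℚP.+-identityˡ t) (ℚP.+-monoˡ-≤ t 0≤s))) 0≤t

square-zero : ∀ {s} → s * s ≡ 0ℚ → s ≡ 0ℚ
square-zero {s} e with s ≟ 0ℚ
... | yes s≡0 = s≡0
... | no s≢0 = ⊥-elim (*-nonzero s≢0 s≢0 e)

N≡0⇒≡0 : ∀ q → N q ≡ 0ℚ → q ≡ 0q
N≡0⇒≡0 (quat a b c d) e =
  let (e₃ , d≡0) = +-nonneg-zero (+-nonneg (+-nonneg (square-nonneg a) (square-nonneg b)) (square-nonneg c))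
        (square-nonneg d) e
      (e₂ , c≡0) = +-nonneg-zero (+-nonneg (square-nonneg a) (square-nonneg b)) (square-nonneg c) e₃
      (a≡0 , b≡0) = +-nonneg-zero (square-nonneg a) (square-nonneg b) e₂
  in quat≡ (square-zero a≡0) (square-zero b≡0) (square-zero c≡0) (square-zero d≡0)

N-nonzero : ∀ {q} → q ≢ 0q → N q ≢ 0ℚ
N-nonzero {q} q≢0 e = q≢0 (N≡0⇒≡0 q e)

-- Hurwitz quaternions

ι : ℤ → ℚ
ι n = n / 1

-- For a variable `n`, the fraction `n / 1` is stuck on its normalisation by a gcd; in the explicit
-- form the operations and the order of ℚ unfold.
ι≡mkℚ : ∀ n → ι n ≡ mkℚ n 0 (Cop.sym (Cop.1-coprimeTo _))
ι≡mkℚ n = ℚP.↥p/↧p≡p (mkℚ n 0 (Cop.sym (Cop.1-coprimeTo _)))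

ι-injective : ∀ {m n} → ι m ≡ ι n → m ≡ n
ι-injective {m} {n} e = proj₁ (ℚP.mkℚ-injective (trans (sym (ι≡mkℚ m)) (trans e (ι≡mkℚ n))))

ι-+ : ∀ m n → ι (m ℤ.+ n) ≡ ι m + ι n
ι-+ m n = trans (cong ι (sym (cong₂ ℤ._+_ (ℤP.*-identityʳ m) (ℤP.*-identityʳ n))))
                (sym (cong₂ _+_ (ι≡mkℚ m) (ι≡mkℚ n)))

ι-* : ∀ m n → ι (m ℤ.* n) ≡ ι m * ι n
ι-* m n = sym (cong₂ _*_ (ι≡mkℚ m) (ι≡mkℚ n))

ι-neg : ∀ n → ι (ℤ.- n) ≡ - ι n
ι-neg n = begin
  ι (ℤ.- n)                     ≡⟨ ℚP.+-identityʳ (ι (ℤ.- n)) ⟨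
  ι (ℤ.- n) + 0ℚ                ≡⟨ cong (λ t → ι (ℤ.- n) + t) (ℚP.+-inverseʳ (ι n)) ⟨
  ι (ℤ.- n) + (ι n - ι n)       ≡⟨ ℚP.+-assoc (ι (ℤ.- n)) (ι n) (- ι n) ⟨
  ι (ℤ.- n) + ι n - ι n         ≡⟨ cong (_- ι n) (ι-+ (ℤ.- n) n) ⟨
  ι (ℤ.- n ℤ.+ n) - ι n         ≡⟨ cong (λ k → ι k - ι n) (ℤP.+-inverseˡ n) ⟩
  0ℚ - ι n                      ≡⟨ ℚP.+-identityˡ (- ι n) ⟩
  - ι n                         ∎

/2≡½* : ∀ n → n / 2 ≡ ½ * ι n
/2≡½* n = sym (trans (cong (½ *_) (ι≡mkℚ n)) (cong (_/ 2) (ℤP.*-identityˡ n)))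

ι-cancel-≤ : ∀ {m n} → ι m ℚ.≤ ι n → m ℤ.≤ n
ι-cancel-≤ {m} {n} le = subst₂ ℤ._≤_ (ℤP.*-identityʳ m) (ℤP.*-identityʳ n)
  (ℚP.drop-*≤* (subst₂ ℚ._≤_ (ι≡mkℚ m) (ι≡mkℚ n) le))

-- Coordinates with respect to the ℤ-basis (1+i+j+k)/2, i, j, k.
hw : ℤ → ℤ → ℤ → ℤ → Quat
hw a b c d = quat (½ * ι a) (½ * ι a + ι b) (½ * ι a + ι c) (½ * ι a + ι d)

Hw : Quat → Set
Hw q = Σ ℤ λ a → Σ ℤ λ b → Σ ℤ λ c → Σ ℤ λ d → q ≡ hw a b c d

-- If a - b = 2k then b/2 = a/2 - k, so equal parity amounts to integral coordinates in the basis of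
-- `hw`. These coordinates are free of side conditions, which makes closure properties linear
-- computations.
Hurwitz⇒Hw : ∀ {q} → IsHurwitz q → Hw q
Hurwitz⇒Hw {q} (a , b , c , d , ab , ac , ad , q≡) with ℤS.∣ᵤ⇒∣ ab | ℤS.∣ᵤ⇒∣ ac | ℤS.∣ᵤ⇒∣ ad
... | ℤS.divides k ab' | ℤS.divides l ac' | ℤS.divides m ad' =
  a , ℤ.- k , ℤ.- l , ℤ.- m , trans q≡ (quat≡ (/2≡½* a) (half b k ab') (half c l ac') (half d m ad'))
  where
  half : ∀ b k → a ℤ.- b ≡ k ℤ.* + 2 → b / 2 ≡ ½ * ι a + ι (ℤ.- k)
  half b k e = begin
    b / 2                              ≡⟨ /2≡½* b ⟩
    ½ * ι b                            ≡⟨ cong (λ t → ½ * ι t) b≡ ⟩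
    ½ * ι (a ℤ.+ (ℤ.- k) ℤ.* + 2)
      ≡⟨ cong (½ *_) (trans (ι-+ a (ℤ.- k ℤ.* + 2)) (cong (λ t → ι a + t) (ι-* (ℤ.- k) (+ 2)))) ⟩
    ½ * (ι a + ι (ℤ.- k) * ι (+ 2))
      ≡⟨ solve 2 (λ x y → Κ ½ *ᵉ (x +ᵉ y *ᵉ Κ (ι (+ 2))) ≐ Κ ½ *ᵉ x +ᵉ y) refl (ι a) (ι (ℤ.- k)) ⟩
    ½ * ι a + ι (ℤ.- k)                ∎
    where
    b≡ : b ≡ a ℤ.+ (ℤ.- k) ℤ.* + 2
    b≡ = trans (lem a b) (cong (λ t → a ℤ.+ t) (trans (cong ℤ.-_ e) (ℤP.neg-distribˡ-* k (+ 2))))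
      where
      lem : ∀ a b → b ≡ a ℤ.+ ℤ.- (a ℤ.- b)
      lem = solve-∀

Hw⇒Hurwitz : ∀ {q} → Hw q → IsHurwitz q
Hw⇒Hurwitz {q} (a , b , c , d , q≡) =
  a , a ℤ.+ b ℤ.* + 2 , a ℤ.+ c ℤ.* + 2 , a ℤ.+ d ℤ.* + 2 , par b , par c , par d ,
  trans q≡ (quat≡ (sym (/2≡½* a)) (half b) (half c) (half d))
  where
  lem : ∀ a k → a ℤ.- (a ℤ.+ k ℤ.* + 2) ≡ ℤ.- k ℤ.* + 2
  lem = solve-∀
  par : ∀ k → SameParity a (a ℤ.+ k ℤ.* + 2)
  par k = ℤS.∣⇒∣ᵤ (ℤS.divides (ℤ.- k) (lem a k))
  half : ∀ k → ½ * ι a + ι k ≡ (a ℤ.+ k ℤ.* + 2) / 2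
  half k = begin
    ½ * ι a + ι k
      ≡⟨ solve 2 (λ x y → Κ ½ *ᵉ (x +ᵉ y *ᵉ Κ (ι (+ 2))) ≐ Κ ½ *ᵉ x +ᵉ y) refl (ι a) (ι k) ⟨
    ½ * (ι a + ι k * ι (+ 2))
      ≡⟨ cong (½ *_) (trans (ι-+ a (k ℤ.* + 2)) (cong (λ t → ι a + t) (ι-* k (+ 2)))) ⟨
    ½ * ι (a ℤ.+ k ℤ.* + 2)            ≡⟨ /2≡½* (a ℤ.+ k ℤ.* + 2) ⟨
    (a ℤ.+ k ℤ.* + 2) / 2              ∎

Hw-⊕ : ∀ {p q} → Hw p → Hw q → Hw (p ⊕ q)
Hw-⊕ {p} {q} (a , b , c , d , p≡) (a' , b' , c' , d' , q≡) =
  a ℤ.+ a' , b ℤ.+ b' , c ℤ.+ c' , d ℤ.+ d' ,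
  trans (cong₂ _⊕_ p≡ q≡) (quat≡ real (imag b b') (imag c c') (imag d d'))
  where
  real : ½ * ι a + ½ * ι a' ≡ ½ * ι (a ℤ.+ a')
  real = trans (sym (ℚP.*-distribˡ-+ ½ (ι a) (ι a'))) (cong (½ *_) (sym (ι-+ a a')))
  imag : ∀ b b' → ½ * ι a + ι b + (½ * ι a' + ι b') ≡ ½ * ι (a ℤ.+ a') + ι (b ℤ.+ b')
  imag b b' = trans
    (solve 4 (λ x x' y y' → Κ ½ *ᵉ x +ᵉ y +ᵉ (Κ ½ *ᵉ x' +ᵉ y') ≐ Κ ½ *ᵉ (x +ᵉ x') +ᵉ (y +ᵉ y')) refl (ι a)
      (ι a') (ι b) (ι b'))
    (sym (cong₂ (λ s t → ½ * s + t) (ι-+ a a') (ι-+ b b')))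

Hw-scale : ∀ n {p} → Hw p → Hw (ℤq n · p)
Hw-scale n {p} (a , b , c , d , p≡) =
  n ℤ.* a , n ℤ.* b , n ℤ.* c , n ℤ.* d ,
  trans (cong (ℤq n ·_) p≡) (trans
    (proveQ (ι n ∷ ι a ∷ ι b ∷ ι c ∷ ι d ∷ [])
      (scalᵉ s ·ᵉ hwᵉ (Ι (# 1)) (Ι (# 2)) (Ι (# 3)) (Ι (# 4)))
      (hwᵉ (s *ᵉ Ι (# 1)) (s *ᵉ Ι (# 2)) (s *ᵉ Ι (# 3)) (s *ᵉ Ι (# 4))) refl)
    (sym (quat≡ (cong (½ *_) (ι-* n a)) (imag b) (imag c) (imag d))))
  where
  s : Expr ℚ 5
  s = Ι (# 0)
  imag : ∀ b → ½ * ι (n ℤ.* a) + ι (n ℤ.* b) ≡ ½ * (ι n * ι a) + ι n * ι b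
  imag b = cong₂ (λ s t → ½ * s + t) (ι-* n a) (ι-* n b)

Hw-scal : ∀ n → Hw (ℤq n)
-- The coordinates come from 1 = 2·(1+i+j+k)/2 - i - j - k.
Hw-scal n = subst Hw (·-identityʳ (ℤq n)) (Hw-scale n {1q} (+ 2 , ℤ.- + 1 , ℤ.- + 1 , ℤ.- + 1 , refl))

Hw-neg : ∀ {p} → Hw p → Hw (neg p)
Hw-neg = Hw-scale (ℤ.- + 1)

ℍ 𝕚 𝕛 𝕜 : Quat
ℍ = quat ½ ½ ½ ½
𝕚 = quat 0ℚ 1ℚ 0ℚ 0ℚ
𝕛 = quat 0ℚ 0ℚ 1ℚ 0ℚ
𝕜 = quat 0ℚ 0ℚ 0ℚ 1ℚ

comb : (a b c d : ℤ) (p q r s : Quat) → Quat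
comb a b c d p q r s = ℤq a · p ⊕ ℤq b · q ⊕ ℤq c · r ⊕ ℤq d · s

hw≡comb : ∀ a b c d → hw a b c d ≡ comb a b c d ℍ 𝕚 𝕛 𝕜
hw≡comb a b c d = proveQ (ι a ∷ ι b ∷ ι c ∷ ι d ∷ [])
  (hwᵉ (Ι (# 0)) (Ι (# 1)) (Ι (# 2)) (Ι (# 3)))
  (scalᵉ (Ι (# 0)) ·ᵉ qe (Κ ½) (Κ ½) (Κ ½) (Κ ½) ⊕ᵉ scalᵉ (Ι (# 1)) ·ᵉ qe (Κ 0ℚ) (Κ 1ℚ) (Κ 0ℚ) (Κ 0ℚ)
    ⊕ᵉ scalᵉ (Ι (# 2)) ·ᵉ qe (Κ 0ℚ) (Κ 0ℚ) (Κ 1ℚ) (Κ 0ℚ) ⊕ᵉ scalᵉ (Ι (# 3)) ·ᵉ qe (Κ 0ℚ) (Κ 0ℚ) (Κ 0ℚ)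
      (Κ 1ℚ)) refl

Hw-comb : ∀ a b c d {p q r s} → Hw p → Hw q → Hw r → Hw s → Hw (comb a b c d p q r s)
Hw-comb a b c d {p} {q} {r} {s} hp hq hr hs =
  Hw-⊕ {ℤq a · p ⊕ ℤq b · q ⊕ ℤq c · r} {ℤq d · s}
    (Hw-⊕ {ℤq a · p ⊕ ℤq b · q} {ℤq c · r}
      (Hw-⊕ {ℤq a · p} {ℤq b · q} (Hw-scale a hp) (Hw-scale b hq)) (Hw-scale c hr)) (Hw-scale d hs)

comb-·ʳ : ∀ a b c d p q r s t → comb a b c d p q r s · t ≡ comb a b c d (p · t) (q · t) (r · t) (s · t)
comb-·ʳ a b c d p q r s t = begin
  (P ⊕ Q ⊕ R ⊕ Z) · t ≡⟨ ·-distribʳ t (P ⊕ Q ⊕ R) Z ⟩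
  (P ⊕ Q ⊕ R) · t ⊕ Z · t ≡⟨ cong (_⊕ Z · t) (·-distribʳ t (P ⊕ Q) R) ⟩
  (P ⊕ Q) · t ⊕ R · t ⊕ Z · t ≡⟨ cong (λ u → u ⊕ R · t ⊕ Z · t) (·-distribʳ t P Q) ⟩
  P · t ⊕ Q · t ⊕ R · t ⊕ Z · t
    ≡⟨ cong₂ _⊕_ (cong₂ _⊕_ (cong₂ _⊕_ (·-assoc (ℤq a) p t) (·-assoc (ℤq b) q t)) (·-assoc (ℤq c) r t))
       (·-assoc (ℤq d) s t) ⟩
  comb a b c d (p · t) (q · t) (r · t) (s · t) ∎
  where
  P = ℤq a · p
  Q = ℤq b · q
  R = ℤq c · r
  Z = ℤq d · s

comb-·ˡ : ∀ a b c d p q r s t → t · comb a b c d p q r s ≡ comb a b c d (t · p) (t · q) (t · r) (t · s)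
comb-·ˡ a b c d p q r s t = begin
  t · (P ⊕ Q ⊕ R ⊕ Z) ≡⟨ ·-distribˡ t (P ⊕ Q ⊕ R) Z ⟩
  t · (P ⊕ Q ⊕ R) ⊕ t · Z ≡⟨ cong (_⊕ t · Z) (·-distribˡ t (P ⊕ Q) R) ⟩
  t · (P ⊕ Q) ⊕ t · R ⊕ t · Z ≡⟨ cong (λ u → u ⊕ t · R ⊕ t · Z) (·-distribˡ t P Q) ⟩
  t · P ⊕ t · Q ⊕ t · R ⊕ t · Z
    ≡⟨ cong₂ _⊕_ (cong₂ _⊕_ (cong₂ _⊕_ (pull a p) (pull b q)) (pull c r)) (pull d s) ⟩
  comb a b c d (t · p) (t · q) (t · r) (t · s) ∎
  where
  P = ℤq a · p
  Q = ℤq b · q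
  R = ℤq c · r
  Z = ℤq d · s
  pull : ∀ n p → t · (ℤq n · p) ≡ ℤq n · (t · p)
  pull n p = begin
    t · (ℤq n · p) ≡⟨ ·-assoc t (ℤq n) p ⟨
    t · ℤq n · p   ≡⟨ cong (_· p) (scal-central (ι n) t) ⟨
    ℤq n · t · p   ≡⟨ ·-assoc (ℤq n) t p ⟩
    ℤq n · (t · p) ∎

-- It suffices to check products of elements of the ℤ-basis (1+i+j+k)/2, i, j, k.
Hw-·-basisˡ : ∀ t {q} → Hw (t · ℍ) → Hw (t · 𝕚) → Hw (t · 𝕛) → Hw (t · 𝕜) → Hw q → Hw (t · q)
Hw-·-basisˡ t h₀ h₁ h₂ h₃ (a , b , c , d , q≡) =
  subst Hw (sym (trans (cong (t ·_) (trans q≡ (hw≡comb a b c d))) (comb-·ˡ a b c d ℍ 𝕚 𝕛 𝕜 t)))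
    (Hw-comb a b c d {t · ℍ} {t · 𝕚} {t · 𝕛} {t · 𝕜} h₀ h₁ h₂ h₃)

Hw-·-basisʳ : ∀ {p} t → Hw (ℍ · t) → Hw (𝕚 · t) → Hw (𝕛 · t) → Hw (𝕜 · t) → Hw p → Hw (p · t)
Hw-·-basisʳ t h₀ h₁ h₂ h₃ (a , b , c , d , p≡) =
  subst Hw (sym (trans (cong (_· t) (trans p≡ (hw≡comb a b c d))) (comb-·ʳ a b c d ℍ 𝕚 𝕛 𝕜 t)))
    (Hw-comb a b c d {ℍ · t} {𝕚 · t} {𝕛 · t} {𝕜 · t} h₀ h₁ h₂ h₃)

-- The sixteen quadruples are the multiplication table of the ℤ-basis: `p` is expanded first with
-- `q` arbitrary, then `q` within each row.
Hw-· : ∀ {p q} → Hw p → Hw q → Hw (p · q)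
Hw-· {p} {q} hp hq = Hw-·-basisʳ {p} q
  (Hw-·-basisˡ ℍ (ℤ.- + 1 , + 1 , + 1 , + 1 , refl) (ℤ.- + 1 , + 1 , + 1 , + 0 , refl)
                 (ℤ.- + 1 , + 0 , + 1 , + 1 , refl) (ℤ.- + 1 , + 1 , + 0 , + 1 , refl) hq)
  (Hw-·-basisˡ 𝕚 (ℤ.- + 1 , + 1 , + 0 , + 1 , refl) (ℤ.- + 2 , + 1 , + 1 , + 1 , refl)
                 (+ 0 , + 0 , + 0 , + 1 , refl) (+ 0 , + 0 , ℤ.- + 1 , + 0 , refl) hq)
  (Hw-·-basisˡ 𝕛 (ℤ.- + 1 , + 1 , + 1 , + 0 , refl) (+ 0 , + 0 , + 0 , ℤ.- + 1 , refl)
                 (ℤ.- + 2 , + 1 , + 1 , + 1 , refl) (+ 0 , + 1 , + 0 , + 0 , refl) hq)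
  (Hw-·-basisˡ 𝕜 (ℤ.- + 1 , + 0 , + 1 , + 1 , refl) (+ 0 , + 0 , + 1 , + 0 , refl)
                 (+ 0 , ℤ.- + 1 , + 0 , + 0 , refl) (ℤ.- + 2 , + 1 , + 1 , + 1 , refl) hq)
  hp

-- The conjugate is the trace minus the element, and the trace of `hw a b c d` is the integer `a`.
Hw-conj : ∀ {q} → Hw q → Hw (conj q)
Hw-conj {q} (a , b , c , d , q≡) = subst Hw (sym (trans (cong conj q≡) e))
  (Hw-⊕ {ℤq a} {neg (hw a b c d)} (Hw-scal a) (Hw-neg {hw a b c d} (a , b , c , d , refl)))
  where
  E : QExpr 4
  E = hwᵉ (Ι (# 0)) (Ι (# 1)) (Ι (# 2)) (Ι (# 3))
  e : conj (hw a b c d) ≡ ℤq a ⊕ neg (hw a b c d)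
  e = proveQ (ι a ∷ ι b ∷ ι c ∷ ι d ∷ []) (conjᵉ E) (scalᵉ (Ι (# 0)) ⊕ᵉ negᵉ E) refl

normForm : ℤ → ℤ → ℤ → ℤ → ℤ
normForm a b c d = a ℤ.* a ℤ.+ b ℤ.* b ℤ.+ c ℤ.* c ℤ.+ d ℤ.* d ℤ.+ a ℤ.* (b ℤ.+ c ℤ.+ d)

-- Integrality comes from the four terms (a/2)², which add up to a².
N-hw : ∀ a b c d → N (hw a b c d) ≡ ι (normForm a b c d)
N-hw a b c d = trans
  (solve 4 (λ a b c d → Nᵉ (hwᵉ a b c d)
     ≐ a *ᵉ a +ᵉ b *ᵉ b +ᵉ c *ᵉ c +ᵉ d *ᵉ d +ᵉ a *ᵉ (b +ᵉ c +ᵉ d)) refl (ι a) (ι b) (ι c) (ι d))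
  (sym push)
  where
  push : ι (normForm a b c d) ≡ ι a * ι a + ι b * ι b + ι c * ι c + ι d * ι d + ι a * (ι b + ι c + ι d)
  push = begin
    ι (normForm a b c d)
      ≡⟨ ι-+ (a ℤ.* a ℤ.+ b ℤ.* b ℤ.+ c ℤ.* c ℤ.+ d ℤ.* d) (a ℤ.* (b ℤ.+ c ℤ.+ d)) ⟩
    ι (a ℤ.* a ℤ.+ b ℤ.* b ℤ.+ c ℤ.* c ℤ.+ d ℤ.* d) + ι (a ℤ.* (b ℤ.+ c ℤ.+ d))
      ≡⟨ cong₂ _+_ (ι-sum (a ℤ.* a) (b ℤ.* b) (c ℤ.* c) (d ℤ.* d))
         (trans (ι-* a (b ℤ.+ c ℤ.+ d)) (cong (ι a *_) (trans (ι-+ (b ℤ.+ c) d) (cong (_+ ι d) (ι-+ b c))))) ⟩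
    ι (a ℤ.* a) + ι (b ℤ.* b) + ι (c ℤ.* c) + ι (d ℤ.* d) + ι a * (ι b + ι c + ι d)
      ≡⟨ cong (_+ ι a * (ι b + ι c + ι d))
         (cong₂ _+_ (cong₂ _+_ (cong₂ _+_ (ι-* a a) (ι-* b b)) (ι-* c c)) (ι-* d d)) ⟩
    ι a * ι a + ι b * ι b + ι c * ι c + ι d * ι d + ι a * (ι b + ι c + ι d) ∎
    where
    ι-sum : ∀ a b c d → ι (a ℤ.+ b ℤ.+ c ℤ.+ d) ≡ ι a + ι b + ι c + ι d
    ι-sum a b c d = trans (ι-+ (a ℤ.+ b ℤ.+ c) d)
      (cong (_+ ι d) (trans (ι-+ (a ℤ.+ b) c) (cong (_+ ι c) (ι-+ a b))))

N-nonneg : ∀ q → 0ℚ ℚ.≤ N q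
N-nonneg (quat a b c d) = +-nonneg
  (+-nonneg (+-nonneg (square-nonneg a) (square-nonneg b)) (square-nonneg c)) (square-nonneg d)

natNorm : ∀ {q} → Hw q → Σ ℕ λ n → N q ≡ ι (+ n)
natNorm {q} (a , b , c , d , q≡) = go (normForm a b c d) (trans (cong N q≡) (N-hw a b c d))
  where
  go : ∀ z → N q ≡ ι z → Σ ℕ λ n → N q ≡ ι (+ n)
  go (+ n) e = n , e
  go -[1+ n ] e with () ← ι-cancel-≤ {+ 0} { -[1+ n ] } (subst (0ℚ ℚ.≤_) e (N-nonneg q))

-- Neither outer factor has to be Hurwitz, only the four sandwiched basis elements. This admits the
-- factor (1+i)/2 in `θ-normal`.
Hw-sandwich : ∀ t s {q} → Hw (t · ℍ · s) → Hw (t · 𝕚 · s) → Hw (t · 𝕛 · s) → Hw (t · 𝕜 · s) → Hw q →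
  Hw (t · q · s)
Hw-sandwich t s {q} h₀ h₁ h₂ h₃ (a , b , c , d , q≡) = subst Hw (sym e)
    (Hw-comb a b c d {t · ℍ · s} {t · 𝕚 · s} {t · 𝕛 · s} {t · 𝕜 · s} h₀ h₁ h₂ h₃)
  where
  e : t · q · s ≡ comb a b c d (t · ℍ · s) (t · 𝕚 · s) (t · 𝕛 · s) (t · 𝕜 · s)
  e = begin
    t · q · s
      ≡⟨ cong (λ q → t · q · s) (trans q≡ (hw≡comb a b c d)) ⟩
    t · comb a b c d ℍ 𝕚 𝕛 𝕜 · s                         ≡⟨ cong (_· s) (comb-·ˡ a b c d ℍ 𝕚 𝕛 𝕜 t) ⟩
    comb a b c d (t · ℍ) (t · 𝕚) (t · 𝕛) (t · 𝕜) · s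
      ≡⟨ comb-·ʳ a b c d (t · ℍ) (t · 𝕚) (t · 𝕛) (t · 𝕜) s ⟩
    comb a b c d (t · ℍ · s) (t · 𝕚 · s) (t · 𝕛 · s) (t · 𝕜 · s) ∎

-- The two-sided ideal generated by 1+i

θ : Quat
θ = quat 1ℚ 1ℚ 0ℚ 0ℚ

-- The left ideal generated by 1+i; it is two-sided and its square is generated by 2.
InP : Quat → Set
InP p = Σ Quat λ ξ → Hw ξ × p ≡ ξ · θ

-- As `N θ` is 2, the witness is θqθ⁻¹. Conjugation by 1+i permutes the units i, j, k up to sign (i
-- to i, j to k, k to -j), so it preserves H.
θ-normal : ∀ {q} → Hw q → Σ Quat λ ξ → Hw ξ × θ · q ≡ ξ · θ
θ-normal {q} hq = scal ½ · θ · q · conj θ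
  , Hw-sandwich (scal ½ · θ) (conj θ) (+ 1 , + 0 , ℤ.- + 1 , + 0 , refl) (+ 0 , + 1 , + 0 , + 0 , refl)
      (+ 0 , + 0 , + 0 , + 1 , refl) (+ 0 , + 0 , ℤ.- + 1 , + 0 , refl) hq
  , proveQ (env q 0q 0q) (θᵉ ·ᵉ v₁) (scalᵉ (Κ ½) ·ᵉ θᵉ ·ᵉ v₁ ·ᵉ conjᵉ θᵉ ·ᵉ θᵉ) refl

InP-·ʳ : ∀ {p q} → InP p → Hw q → InP (p · q)
InP-·ʳ {p} {q} (ξ , hξ , p≡) hq = let (ζ , hζ , θq≡) = θ-normal hq in ξ · ζ , Hw-· hξ hζ , (begin
  p · q         ≡⟨ cong (_· q) p≡ ⟩
  ξ · θ · q     ≡⟨ ·-assoc ξ θ q ⟩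
  ξ · (θ · q)   ≡⟨ cong (ξ ·_) θq≡ ⟩
  ξ · (ζ · θ)   ≡⟨ ·-assoc ξ ζ θ ⟨
  ξ · ζ · θ     ∎)

-- Moving the first θ across ζ brings the two copies of θ together at the right end, where θ² = 2i
-- supplies the factor 2.
InP-half : ∀ {p q} → InP p → InP q → Hw (scal ½ · (p · q))
InP-half {p} {q} (ξ , hξ , p≡) (ζ , hζ , q≡) = let (χ , hχ , θζ≡) = θ-normal hζ in
  subst Hw (sym (e χ θζ≡)) (Hw-· {ξ · χ} {𝕚} (Hw-· hξ hχ) (+ 0 , + 1 , + 0 , + 0 , refl))
  where
  e : ∀ χ → θ · ζ ≡ χ · θ → scal ½ · (p · q) ≡ ξ · χ · 𝕚
  e χ θζ≡ = begin
    scal ½ · (p · q)                ≡⟨ cong₂ (λ p q → scal ½ · (p · q)) p≡ q≡ ⟩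
    scal ½ · (ξ · θ · (ζ · θ))      ≡⟨ cong (scal ½ ·_) (·-assoc ξ θ (ζ · θ)) ⟩
    scal ½ · (ξ · (θ · (ζ · θ)))    ≡⟨ cong (λ t → scal ½ · (ξ · t)) (·-assoc θ ζ θ) ⟨
    scal ½ · (ξ · (θ · ζ · θ))      ≡⟨ cong (λ t → scal ½ · (ξ · (t · θ))) θζ≡ ⟩
    scal ½ · (ξ · (χ · θ · θ))
      ≡⟨ proveQ (env ξ χ 0q) (scalᵉ (Κ ½) ·ᵉ (v₁ ·ᵉ (v₂ ·ᵉ θᵉ ·ᵉ θᵉ))) (v₁ ·ᵉ v₂ ·ᵉ 𝕚ᵉ) refl ⟩
    ξ · χ · 𝕚                       ∎

-- Euclidean division and Bézout identities

-- Division with remainder of least absolute value. The error is recorded by its absolute value `e`,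
-- because only its square enters a norm.
round : ∀ (x : ℤ) (D : ℕ) .{{_ : ℕ.NonZero D}} → Σ ℤ λ k → Σ ℕ λ e →
  (x ℤ.- k ℤ.* + D) ℤ.* (x ℤ.- k ℤ.* + D) ≡ + (e ℕ.* e) × 2 ℕ.* e ℕ.≤ D
round x D = go (ℕP.≤-total (2 ℕ.* r) D)
  where
  r = x ℤDM.%ℕ D
  q = x ℤDM./ℕ D
  x≡ : x ≡ + r ℤ.+ q ℤ.* + D
  x≡ = ℤDM.a≡a%ℕn+[a/ℕn]*n x D
  lem₁ : ∀ r q D → r ℤ.+ q ℤ.* D ℤ.- q ℤ.* D ≡ r
  lem₁ = solve-∀
  lem₂ : ∀ r q s → r ℤ.+ q ℤ.* (r ℤ.+ s) ℤ.- (q ℤ.+ + 1) ℤ.* (r ℤ.+ s) ≡ ℤ.- s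
  lem₂ = solve-∀
  lem₃ : ∀ s → ℤ.- s ℤ.* ℤ.- s ≡ s ℤ.* s
  lem₃ = solve-∀
  r≤D : r ℕ.≤ D
  r≤D = ℕP.<⇒≤ (ℤDM.n%ℕd<d x D)
  go : 2 ℕ.* r ℕ.≤ D ⊎ D ℕ.≤ 2 ℕ.* r → _
  go (inj₁ le) = q , r , trans (cong (λ t → t ℤ.* t) (trans (cong (ℤ._- q ℤ.* + D) x≡) (lem₁ (+ r) q (+ D))))
    (sym (ℤP.pos-* r r)) , le
  -- The remainder is past the middle, so the quotient is raised by one and the error becomes -(D -
  -- r).
  go (inj₂ ge) = q ℤ.+ + 1 , s
    , trans (cong (λ t → t ℤ.* t)
      (trans (cong₂ (λ x D → x ℤ.- (q ℤ.+ + 1) ℤ.* D) (trans x≡ (cong (λ D → + r ℤ.+ q ℤ.* D) D≡)) D≡)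
      (lem₂ (+ r) q (+ s))))
        (trans (lem₃ (+ s)) (sym (ℤP.pos-* s s)))
    , ℕP.+-cancelˡ-≤ (r ℕ.+ r) (2 ℕ.* s) D le
    where
    s = D ℕ.∸ r
    D≡ℕ : r ℕ.+ s ≡ D
    D≡ℕ = ℕP.m+[n∸m]≡n r≤D
    D≡ : + D ≡ + r ℤ.+ + s
    D≡ = sym (trans (sym (ℤP.pos-+ r s)) (cong +_ D≡ℕ))
    lem₄ : ∀ r s → r ℕ.+ r ℕ.+ 2 ℕ.* s ≡ (r ℕ.+ s) ℕ.+ (r ℕ.+ s)
    lem₄ = ℕR.solve-∀
    lem₅ : ∀ r → 2 ℕ.* r ≡ r ℕ.+ r
    lem₅ = ℕR.solve-∀
    le : r ℕ.+ r ℕ.+ 2 ℕ.* s ℕ.≤ r ℕ.+ r ℕ.+ D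
    le = subst (ℕ._≤ r ℕ.+ r ℕ.+ D) (sym (trans (lem₄ r s) (cong₂ ℕ._+_ D≡ℕ D≡ℕ)))
           (ℕP.+-monoˡ-≤ D (subst (D ℕ.≤_) (lem₅ r) ge))

-- After multiplication by 16 the first square is at most D² and the others at most 4D² each: 13D²
-- in all, strictly below 16D² since `D` is nonzero.
rounding-bound : ∀ D .{{_ : ℕ.NonZero D}} {Q e₀ e₁ e₂ e₃} →
  4 ℕ.* Q ≡ e₀ ℕ.* e₀ ℕ.+ e₁ ℕ.* e₁ ℕ.+ e₂ ℕ.* e₂ ℕ.+ e₃ ℕ.* e₃ →
  2 ℕ.* e₀ ℕ.≤ D → e₁ ℕ.≤ D → e₂ ℕ.≤ D → e₃ ℕ.≤ D → Q ℕ.< D ℕ.* D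
rounding-bound D {Q} {e₀} {e₁} {e₂} {e₃} eq le₀ le₁ le₂ le₃ = ℕP.*-cancelˡ-< 16 Q (D ℕ.* D)
  (ℕP.≤-<-trans
    (subst₂ ℕ._≤_
    (sym (trans (ℕP.*-assoc 4 4 Q) (trans (cong (4 ℕ.*_) eq) (lhs e₀ (e₁ ℕ.* e₁) (e₂ ℕ.* e₂) (e₃ ℕ.* e₃)))))
    (rhs (D ℕ.* D)) bound)
    (ℕP.*-monoˡ-< (D ℕ.* D) {{ℕP.m*n≢0 D D}} {13} {16} (ℕ.s≤s (ℕP.m≤m+n 13 2))))
  where
  lhs : ∀ a b c d →
    4 ℕ.* (a ℕ.* a ℕ.+ b ℕ.+ c ℕ.+ d) ≡ 2 ℕ.* a ℕ.* (2 ℕ.* a) ℕ.+ 4 ℕ.* b ℕ.+ 4 ℕ.* c ℕ.+ 4 ℕ.* d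
  lhs = ℕR.solve-∀
  rhs : ∀ a → a ℕ.+ 4 ℕ.* a ℕ.+ 4 ℕ.* a ℕ.+ 4 ℕ.* a ≡ 13 ℕ.* a
  rhs = ℕR.solve-∀
  sq : ∀ {e} → e ℕ.≤ D → 4 ℕ.* (e ℕ.* e) ℕ.≤ 4 ℕ.* (D ℕ.* D)
  sq le = ℕP.*-monoʳ-≤ 4 (ℕP.*-mono-≤ le le)
  bound : 2 ℕ.* e₀ ℕ.* (2 ℕ.* e₀) ℕ.+ 4 ℕ.* (e₁ ℕ.* e₁) ℕ.+ 4 ℕ.* (e₂ ℕ.* e₂) ℕ.+ 4 ℕ.* (e₃ ℕ.* e₃)
        ℕ.≤ D ℕ.* D ℕ.+ 4 ℕ.* (D ℕ.* D) ℕ.+ 4 ℕ.* (D ℕ.* D) ℕ.+ 4 ℕ.* (D ℕ.* D)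
  bound = ℕP.+-mono-≤ (ℕP.+-mono-≤ (ℕP.+-mono-≤ (ℕP.*-mono-≤ le₀ le₀) (sq le₁)) (sq le₂)) (sq le₃)

-- The four squares are those of the doubled coordinates of `hw a b c d`, the quantities that the
-- rounding controls.
4*normForm : ∀ a b c d → + 4 ℤ.* (a ℤ.* a ℤ.+ b ℤ.* b ℤ.+ c ℤ.* c ℤ.+ d ℤ.* d ℤ.+ a ℤ.* (b ℤ.+ c ℤ.+ d)) ≡
  a ℤ.* a ℤ.+ (a ℤ.+ + 2 ℤ.* b) ℤ.* (a ℤ.+ + 2 ℤ.* b) ℤ.+ (a ℤ.+ + 2 ℤ.* c) ℤ.* (a ℤ.+ + 2 ℤ.* c) ℤ.+
    (a ℤ.+ + 2 ℤ.* d) ℤ.* (a ℤ.+ + 2 ℤ.* d)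
4*normForm = solve-∀

-- Round twice the real part to the nearest integer k and then twice each other
-- coordinate to the nearest integer of the parity of k: the error has norm at most
-- (1/16 + 3/4) D².
Hw-round : ∀ {p} → Hw p → (D : ℕ) .{{_ : ℕ.NonZero D}} → Σ Quat λ κ → Hw κ ×
  Σ ℕ λ e → N (p ⊕ neg (ℤq (+ D) · κ)) ≡ ι (+ e) × e ℕ.< D ℕ.* D
Hw-round {p} (a , b , c , d , p≡) D =
  let instance _ = ℕP.m*n≢0 2 D
      (k , e₀ , sq₀ , le₀) = round a D
      a' = a ℤ.- k ℤ.* + D
      (l₁ , e₁ , sq₁ , le₁) = round (a' ℤ.+ + 2 ℤ.* b) (2 ℕ.* D)
      (l₂ , e₂ , sq₂ , le₂) = round (a' ℤ.+ + 2 ℤ.* c) (2 ℕ.* D)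
      (l₃ , e₃ , sq₃ , le₃) = round (a' ℤ.+ + 2 ℤ.* d) (2 ℕ.* D)
  in finish k l₁ l₂ l₃ e₀ e₁ e₂ e₃ sq₀ le₀ sq₁ le₁ sq₂ le₂ sq₃ le₃
  where
  finish : ∀ k l₁ l₂ l₃ e₀ e₁ e₂ e₃ →
    (a ℤ.- k ℤ.* + D) ℤ.* (a ℤ.- k ℤ.* + D) ≡ + (e₀ ℕ.* e₀) → 2 ℕ.* e₀ ℕ.≤ D →
    (a ℤ.- k ℤ.* + D ℤ.+ + 2 ℤ.* b ℤ.- l₁ ℤ.* + (2 ℕ.* D)) ℤ.*
      (a ℤ.- k ℤ.* + D ℤ.+ + 2 ℤ.* b ℤ.- l₁ ℤ.* + (2 ℕ.* D)) ≡ + (e₁ ℕ.* e₁) → 2 ℕ.* e₁ ℕ.≤ 2 ℕ.* D →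
    (a ℤ.- k ℤ.* + D ℤ.+ + 2 ℤ.* c ℤ.- l₂ ℤ.* + (2 ℕ.* D)) ℤ.*
      (a ℤ.- k ℤ.* + D ℤ.+ + 2 ℤ.* c ℤ.- l₂ ℤ.* + (2 ℕ.* D)) ≡ + (e₂ ℕ.* e₂) → 2 ℕ.* e₂ ℕ.≤ 2 ℕ.* D →
    (a ℤ.- k ℤ.* + D ℤ.+ + 2 ℤ.* d ℤ.- l₃ ℤ.* + (2 ℕ.* D)) ℤ.*
      (a ℤ.- k ℤ.* + D ℤ.+ + 2 ℤ.* d ℤ.- l₃ ℤ.* + (2 ℕ.* D)) ≡ + (e₃ ℕ.* e₃) → 2 ℕ.* e₃ ℕ.≤ 2 ℕ.* D →
    Σ Quat λ κ → Hw κ × Σ ℕ λ e → N (p ⊕ neg (ℤq (+ D) · κ)) ≡ ι (+ e) × e ℕ.< D ℕ.* D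
  finish k l₁ l₂ l₃ e₀ e₁ e₂ e₃ sq₀ le₀ sq₁ le₁ sq₂ le₂ sq₃ le₃ =
    hw k l₁ l₂ l₃ , hκ , proj₁ nn , proj₂ nn , rounding-bound D {proj₁ nn} {e₀} {e₁} {e₂} {e₃} 4e≡ le₀
      (ℕP.*-cancelˡ-≤ 2 le₁) (ℕP.*-cancelˡ-≤ 2 le₂) (ℕP.*-cancelˡ-≤ 2 le₃)
    where
    hκ : Hw (hw k l₁ l₂ l₃)
    hκ = k , l₁ , l₂ , l₃ , refl
    A B C E : ℤ
    A = a ℤ.- k ℤ.* + D
    B = b ℤ.- l₁ ℤ.* + D
    C = c ℤ.- l₂ ℤ.* + D
    E = d ℤ.- l₃ ℤ.* + D
    r≡ : p ⊕ neg (ℤq (+ D) · hw k l₁ l₂ l₃) ≡ hw A B C E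
    r≡ = trans (cong (_⊕ neg (ℤq (+ D) · hw k l₁ l₂ l₃)) p≡) (trans
      (proveQ (ι a ∷ ι b ∷ ι c ∷ ι d ∷ ι k ∷ ι l₁ ∷ ι l₂ ∷ ι l₃ ∷ ι (+ D) ∷ [])
        (hwᵉ (Ι (# 0)) (Ι (# 1)) (Ι (# 2)) (Ι (# 3)) ⊕ᵉ negᵉ
          (scalᵉ (Ι (# 8)) ·ᵉ hwᵉ (Ι (# 4)) (Ι (# 5)) (Ι (# 6)) (Ι (# 7))))
        (hwᵉ (Ι (# 0) -ᵉ Ι (# 4) *ᵉ Ι (# 8)) (Ι (# 1) -ᵉ Ι (# 5) *ᵉ Ι (# 8)) (Ι (# 2) -ᵉ Ι (# 6) *ᵉ Ι (# 8))
          (Ι (# 3) -ᵉ Ι (# 7) *ᵉ Ι (# 8))) refl)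
      (sym (quat≡ (cong (½ *_) (push a k)) (cong₂ (λ s t → ½ * s + t) (push a k) (push b l₁))
        (cong₂ (λ s t → ½ * s + t) (push a k) (push c l₂))
          (cong₂ (λ s t → ½ * s + t) (push a k) (push d l₃)))))
      where
      push : ∀ a k → ι (a ℤ.- k ℤ.* + D) ≡ ι a - ι k * ι (+ D)
      push a k = trans (ι-+ a (ℤ.- (k ℤ.* + D)))
        (cong (λ t → ι a + t) (trans (ι-neg (k ℤ.* + D)) (cong -_ (ι-* k (+ D)))))
    nn : Σ ℕ λ n → N (p ⊕ neg (ℤq (+ D) · hw k l₁ l₂ l₃)) ≡ ι (+ n)
    nn = natNorm {p ⊕ neg (ℤq (+ D) · hw k l₁ l₂ l₃)} (A , B , C , E , r≡)
    form : + proj₁ nn ≡ normForm A B C E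
    form = ι-injective (trans (sym (proj₂ nn)) (trans (cong N r≡) (N-hw A B C E)))
    sq : ∀ b l e →
      (A ℤ.+ + 2 ℤ.* b ℤ.- l ℤ.* + (2 ℕ.* D)) ℤ.* (A ℤ.+ + 2 ℤ.* b ℤ.- l ℤ.* + (2 ℕ.* D)) ≡ + (e ℕ.* e) →
      (A ℤ.+ + 2 ℤ.* (b ℤ.- l ℤ.* + D)) ℤ.* (A ℤ.+ + 2 ℤ.* (b ℤ.- l ℤ.* + D)) ≡ + (e ℕ.* e)
    sq b l e h = trans
      (cong (λ t → t ℤ.* t)
      (trans (lem A b l (+ D)) (cong (λ t → A ℤ.+ + 2 ℤ.* b ℤ.- l ℤ.* t) (sym (ℤP.pos-* 2 D))))) h
      where
      lem : ∀ A b l D → A ℤ.+ + 2 ℤ.* (b ℤ.- l ℤ.* D) ≡ A ℤ.+ + 2 ℤ.* b ℤ.- l ℤ.* (+ 2 ℤ.* D)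
      lem = solve-∀
    4e≡ : 4 ℕ.* proj₁ nn ≡ e₀ ℕ.* e₀ ℕ.+ e₁ ℕ.* e₁ ℕ.+ e₂ ℕ.* e₂ ℕ.+ e₃ ℕ.* e₃
    4e≡ = ℤP.+-injective (begin
      + (4 ℕ.* proj₁ nn) ≡⟨ ℤP.pos-* 4 (proj₁ nn) ⟩
      + 4 ℤ.* + proj₁ nn ≡⟨ cong (+ 4 ℤ.*_) form ⟩
      + 4 ℤ.* normForm A B C E ≡⟨ 4*normForm A B C E ⟩
      A ℤ.* A ℤ.+ (A ℤ.+ + 2 ℤ.* B) ℤ.* (A ℤ.+ + 2 ℤ.* B) ℤ.+ (A ℤ.+ + 2 ℤ.* C) ℤ.* (A ℤ.+ + 2 ℤ.* C) ℤ.+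
        (A ℤ.+ + 2 ℤ.* E) ℤ.* (A ℤ.+ + 2 ℤ.* E)
        ≡⟨ cong₂ ℤ._+_ (cong₂ ℤ._+_ (cong₂ ℤ._+_ sq₀ (sq b l₁ e₁ sq₁)) (sq c l₂ e₂ sq₂)) (sq d l₃ e₃ sq₃) ⟩
      + (e₀ ℕ.* e₀) ℤ.+ + (e₁ ℕ.* e₁) ℤ.+ + (e₂ ℕ.* e₂) ℤ.+ + (e₃ ℕ.* e₃) ≡⟨⟩
      + (e₀ ℕ.* e₀ ℕ.+ e₁ ℕ.* e₁ ℕ.+ e₂ ℕ.* e₂ ℕ.+ e₃ ℕ.* e₃) ∎)

-- Instead of dividing by β, the product αβ̄ is divided by the integer D = N(β). Since (α - κβ)β̄ =
-- αβ̄ - Dκ, the remainder satisfies E·D < D².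
euclidean : ∀ {α β D} → Hw α → Hw β → N β ≡ ι (+ D) → .{{_ : ℕ.NonZero D}} →
  Σ Quat λ κ → Hw κ × Σ ℕ λ E → N (α ⊕ neg (κ · β)) ≡ ι (+ E) × E ℕ.< D
euclidean {α} {β} {D} hα hβ Nβ≡ =
  let (κ , hκ , e , Ne≡ , e<) = Hw-round {α · conj β} (Hw-· hα (Hw-conj hβ)) D
      (E , NE≡) = natNorm {α ⊕ neg (κ · β)} (Hw-⊕ {α} {neg (κ · β)} hα (Hw-neg {κ · β} (Hw-· hκ hβ)))
  in κ , hκ , E , NE≡ , ℕP.*-cancelʳ-< D E D (subst (ℕ._< D ℕ.* D) (sym (E*D≡ κ e Ne≡ E NE≡)) e<)
  where
  split : ∀ κ → (α ⊕ neg (κ · β)) · conj β ≡ α · conj β ⊕ neg (ℤq (+ D) · κ)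
  split κ = begin
    (α ⊕ neg (κ · β)) · conj β
      ≡⟨ proveQ (env α β κ) ((v₁ ⊕ᵉ negᵉ (v₃ ·ᵉ v₂)) ·ᵉ conjᵉ v₂)
         (v₁ ·ᵉ conjᵉ v₂ ⊕ᵉ negᵉ (scalᵉ (Nᵉ v₂) ·ᵉ v₃)) refl ⟩
    α · conj β ⊕ neg (scal (N β) · κ)         ≡⟨ cong (λ t → α · conj β ⊕ neg (scal t · κ)) Nβ≡ ⟩
    α · conj β ⊕ neg (ℤq (+ D) · κ)           ∎
  E*D≡ : ∀ κ e → N (α · conj β ⊕ neg (ℤq (+ D) · κ)) ≡ ι (+ e) → ∀ E → N (α ⊕ neg (κ · β)) ≡ ι (+ E) →
    E ℕ.* D ≡ e
  E*D≡ κ e Ne≡ E NE≡ = ℤP.+-injective (ι-injective (begin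
    ι (+ (E ℕ.* D))                           ≡⟨ cong ι (ℤP.pos-* E D) ⟩
    ι (+ E ℤ.* + D)                           ≡⟨ ι-* (+ E) (+ D) ⟩
    ι (+ E) * ι (+ D)                         ≡⟨ cong₂ _*_ NE≡ (trans (N-conj β) Nβ≡) ⟨
    N (α ⊕ neg (κ · β)) * N (conj β)          ≡⟨ N-· (α ⊕ neg (κ · β)) (conj β) ⟨
    N ((α ⊕ neg (κ · β)) · conj β)            ≡⟨ cong N (split κ) ⟩
    N (α · conj β ⊕ neg (ℤq (+ D) · κ))       ≡⟨ Ne≡ ⟩
    ι (+ e)                                   ∎))

-- The data for both inclusions of Hg = Hα + Hβ: `u`, `v` for one, the cofactors `s`, `t` for the
-- other.
record Bezout (α β : Quat) : Set where
  constructor bezout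
  field
    {g u v s t} : Quat
    hg : Hw g
    hu : Hw u
    hv : Hw v
    hs : Hw s
    ht : Hw t
    g≡ : g ≡ u · α ⊕ v · β
    α≡ : α ≡ s · g
    β≡ : β ≡ t · g

bezout-step : ∀ {α β} κ → Hw κ → Bezout β (α ⊕ neg (κ · β)) → Bezout α β
bezout-step {α} {β} κ hκ (bezout {g} {u} {v} {s} {t} hg hu hv hs ht g≡ β≡ r≡) = record
  { g = g ; u = v ; v = u ⊕ neg (v · κ) ; s = t ⊕ κ · s ; t = s
  ; hg = hg ; hu = hv ; hv = Hw-⊕ {u} {neg (v · κ)} hu (Hw-neg {v · κ} (Hw-· hv hκ))
  ; hs = Hw-⊕ {t} {κ · s} ht (Hw-· hκ hs) ; ht = hs
  ; g≡ = trans g≡ (begin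
      u · β ⊕ v · (α ⊕ neg (κ · β))           ≡⟨ cong (u · β ⊕_) (·-distribˡ v α (neg (κ · β))) ⟩
      u · β ⊕ (v · α ⊕ v · neg (κ · β))
        ≡⟨ proveQ (env (u · β) (v · α) (v · neg (κ · β))) (v₁ ⊕ᵉ (v₂ ⊕ᵉ v₃)) (v₂ ⊕ᵉ (v₁ ⊕ᵉ v₃)) refl ⟩
      v · α ⊕ (u · β ⊕ v · neg (κ · β))
        ≡⟨ cong (λ t → v · α ⊕ (u · β ⊕ t))
           (proveQ (env v κ β) (v₁ ·ᵉ (negᵉ (v₂ ·ᵉ v₃))) (negᵉ (v₁ ·ᵉ v₂) ·ᵉ v₃) refl) ⟩
      v · α ⊕ (u · β ⊕ neg (v · κ) · β)       ≡⟨ cong (v · α ⊕_) (·-distribʳ β u (neg (v · κ))) ⟨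
      v · α ⊕ (u ⊕ neg (v · κ)) · β           ∎)
  ; α≡ = begin
      α                                       ≡⟨ proveQ (env α (κ · β) 0q) v₁ (v₁ ⊕ᵉ negᵉ v₂ ⊕ᵉ v₂) refl ⟩
      α ⊕ neg (κ · β) ⊕ κ · β                 ≡⟨ cong₂ (λ x y → x ⊕ κ · y) r≡ β≡ ⟩
      t · g ⊕ κ · (s · g)                     ≡⟨ cong (t · g ⊕_) (·-assoc κ s g) ⟨
      t · g ⊕ κ · s · g                       ≡⟨ ·-distribʳ g t (κ · s) ⟨
      (t ⊕ κ · s) · g                         ∎
  ; β≡ = β≡
  }

bezout-exists : ∀ {α β} → Hw α → Hw β → Bezout α β
bezout-exists {α} {β} hα hβ = let (D , Nβ≡) = natNorm hβ in go D (<-wellFounded D) hα hβ Nβ≡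
  where
  h0 : Hw 0q
  h0 = + 0 , + 0 , + 0 , + 0 , refl
  h1 : Hw 1q
  h1 = Hw-scal (+ 1)
  go : ∀ D → Acc ℕ._<_ D → ∀ {α β} → Hw α → Hw β → N β ≡ ι (+ D) → Bezout α β
  go zero _ {α} {β} hα hβ Nβ≡ = record
    { g = α ; u = 1q ; v = 0q ; s = 1q ; t = 0q
    ; hg = hα ; hu = h1 ; hv = h0 ; hs = h1 ; ht = h0
    ; g≡ = proveQ (env α β 0q) v₁ (scalᵉ (Κ 1ℚ) ·ᵉ v₁ ⊕ᵉ scalᵉ (Κ 0ℚ) ·ᵉ v₂) refl
    ; α≡ = sym (·-identityˡ α)
    ; β≡ = trans (N≡0⇒≡0 β Nβ≡) (proveQ (env α β 0q) (scalᵉ (Κ 0ℚ)) (scalᵉ (Κ 0ℚ) ·ᵉ v₁) refl)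
    }
  go D@(suc _) (acc rs) {α} {β} hα hβ Nβ≡ =
    let (κ , hκ , E , NE≡ , E<D) = euclidean {α} {β} {D} hα hβ Nβ≡
    in bezout-step κ hκ
      (go E (rs E<D) {β} {α ⊕ neg (κ · β)} hβ (Hw-⊕ {α} {neg (κ · β)} hα (Hw-neg {κ · β} (Hw-· hκ hβ))) NE≡)

-- A Bézout generator g is a common right divisor, so N(g) ≤ N(δ) by maximality. But g is also a
-- left combination of multiples of δ, say g = wδ, whence N(w)N(δ) ≤ N(δ). As g is nonzero, N(w) =
-- 1, and δ = w̄g inherits the combination.
gcd-bezout : ∀ {δ α β} → N α ≢ 0ℚ → IsGcdᵣ δ α β → Σ Quat λ u → Σ Quat λ v → Hw u × Hw v × δ ≡ u · α ⊕ v · β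
gcd-bezout {δ} {α} {β} α≢0 ((Hδ , (a , Ha , α≡) , (b , Hb , β≡)) , greatest) =
  go (bezout-exists {α} {β} (subst Hw (sym α≡) (Hw-· ha hδ)) (subst Hw (sym β≡) (Hw-· hb hδ)))
  where
  hδ = Hurwitz⇒Hw {δ} Hδ
  ha = Hurwitz⇒Hw {a} Ha
  hb = Hurwitz⇒Hw {b} Hb
  go : Bezout α β → Σ Quat λ u → Σ Quat λ v → Hw u × Hw v × δ ≡ u · α ⊕ v · β
  go (bezout {g} {u} {v} {s} {t} hg hu hv hs ht g≡ α≡' β≡') =
    conj w · u , conj w · v , Hw-· (Hw-conj hw') hu , Hw-· (Hw-conj hw') hv , (begin
      δ                                         ≡⟨ ·-identityˡ δ ⟨
      1q · δ                                    ≡⟨ cong (λ t → scal t · δ) Nw≡1 ⟨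
      scal (N w) · δ                            ≡⟨ cong (_· δ) (conj[p]·p≡N w) ⟨
      conj w · w · δ                            ≡⟨ ·-assoc (conj w) w δ ⟩
      conj w · (w · δ)                          ≡⟨ cong (conj w ·_) (trans (sym g≡wδ) g≡) ⟩
      conj w · (u · α ⊕ v · β)                  ≡⟨ ·-distribˡ (conj w) (u · α) (v · β) ⟩
      conj w · (u · α) ⊕ conj w · (v · β)       ≡⟨ cong₂ _⊕_ (·-assoc (conj w) u α) (·-assoc (conj w) v β) ⟨
      conj w · u · α ⊕ conj w · v · β           ∎)
    where
    w : Quat
    w = u · a ⊕ v · b
    hw' : Hw w
    hw' = Hw-⊕ {u · a} {v · b} (Hw-· hu ha) (Hw-· hv hb)
    g≡wδ : g ≡ w · δ
    g≡wδ = begin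
      g                             ≡⟨ g≡ ⟩
      u · α ⊕ v · β                 ≡⟨ cong₂ (λ x y → u · x ⊕ v · y) α≡ β≡ ⟩
      u · (a · δ) ⊕ v · (b · δ)     ≡⟨ cong₂ _⊕_ (·-assoc u a δ) (·-assoc v b δ) ⟨
      u · a · δ ⊕ v · b · δ         ≡⟨ ·-distribʳ δ (u · a) (v · b) ⟨
      w · δ                         ∎
    g≢0 : N g ≢ 0ℚ
    g≢0 e = α≢0 (trans (cong N α≡') (trans (N-· s g) (trans (cong (N s *_) e) (ℚP.*-zeroʳ (N s)))))
    Ng≤Nδ : N g ℚ.≤ N δ
    Ng≤Nδ = greatest g (Hw⇒Hurwitz hg , (s , Hw⇒Hurwitz hs , α≡') , (t , Hw⇒Hurwitz ht , β≡'))
    Ng≡ : N g ≡ N w * N δ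
    Ng≡ = trans (cong N g≡wδ) (N-· w δ)
    Nw≡1 : N w ≡ 1ℚ
    Nw≡1 = let (n , Nw≡) = natNorm {w} hw' ; (d , Nδ≡) = natNorm hδ in unit n Nw≡ d Nδ≡
      where
      unit : ∀ n → N w ≡ ι (+ n) → ∀ d → N δ ≡ ι (+ d) → N w ≡ 1ℚ
      unit zero Nw≡ d Nδ≡ = ⊥-elim (g≢0 (trans Ng≡ (trans (cong (_* N δ) Nw≡) (ℚP.*-zeroˡ (N δ)))))
      unit 1 Nw≡ d Nδ≡ = Nw≡
      unit (suc (suc n)) Nw≡ zero Nδ≡ = ⊥-elim
        (g≢0 (trans Ng≡ (trans (cong (N w *_) Nδ≡) (ℚP.*-zeroʳ (N w)))))
      unit n'@(suc (suc n)) Nw≡ d@(suc d') Nδ≡ = ⊥-elim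
        (ℕP.<⇒≱ (ℕP.m<m*n d n' (ℕ.s≤s (ℕ.s≤s ℕ.z≤n))) (subst (ℕ._≤ d) (ℕP.*-comm n' d)
        (ℤP.drop‿+≤+
          (ι-cancel-≤ (subst₂ ℚ._≤_
          (trans Ng≡ (trans (cong₂ _*_ Nw≡ Nδ≡)
          (trans (sym (ι-* (+ n') (+ d))) (cong ι (sym (ℤP.pos-* n' d)))))) Nδ≡ Ng≤Nδ)))))

-- Integrality and parity

p*den≡num : ∀ p → p * ι (+ ℚ.↧ₙ p) ≡ ι (ℚ.↥ p)
p*den≡num p@(mkℚ n d c) = trans (cong (p *_) (ι≡mkℚ (+ suc d)))
  (ℚP.fromℚᵘ-cong {ℚᵘ.mkℚᵘ (n ℤ.* + suc d) (d ℕ.* 1)} {ℚᵘ.mkℚᵘ n 0}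
    (ℚᵘ.*≡* (trans (ℤP.*-identityʳ (n ℤ.* + suc d)) (cong (λ t → n ℤ.* + suc t) (sym (ℕP.*-identityʳ d))))))

num-den-coprime : ∀ p → Cop.Coprime ℤ.∣ ℚ.↥ p ∣ (ℚ.↧ₙ p)
num-den-coprime (mkℚ n d c) = Cop.recompute c

den≡1⇒ι : ∀ p → ℚ.↧ₙ p ≡ 1 → p ≡ ι (ℚ.↥ p)
den≡1⇒ι p e = begin
  p                   ≡⟨ ℚP.*-identityʳ p ⟨
  p * 1ℚ              ≡⟨ cong (λ d → p * ι (+ d)) e ⟨
  p * ι (+ ℚ.↧ₙ p)    ≡⟨ p*den≡num p ⟩
  ι (ℚ.↥ p)           ∎

normℤ : ℤ → ℤ → ℤ → ℤ
normℤ x y z = x ℤ.* x ℤ.+ y ℤ.* y ℤ.+ z ℤ.* z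

sq≡∣∣ : ∀ i → i ℤ.* i ≡ + (ℤ.∣ i ∣ ℕ.* ℤ.∣ i ∣)
sq≡∣∣ (+ n) = sym (ℤP.pos-* n n)
sq≡∣∣ -[1+ n ] = refl

normℤ≡ : ∀ x y z → normℤ x y z ≡ + (ℤ.∣ x ∣ ℕ.* ℤ.∣ x ∣ ℕ.+ ℤ.∣ y ∣ ℕ.* ℤ.∣ y ∣ ℕ.+ ℤ.∣ z ∣ ℕ.* ℤ.∣ z ∣)
normℤ≡ x y z = cong₂ ℤ._+_ (cong₂ ℤ._+_ (sq≡∣∣ x) (sq≡∣∣ y)) (sq≡∣∣ z)

normℕ≡ : ∀ x y z → normℕ x y z ≡ ℤ.∣ x ∣ ℕ.* ℤ.∣ x ∣ ℕ.+ ℤ.∣ y ∣ ℕ.* ℤ.∣ y ∣ ℕ.+ ℤ.∣ z ∣ ℕ.* ℤ.∣ z ∣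
normℕ≡ x y z = cong ℤ.∣_∣ (normℤ≡ x y z)

+normℕ≡normℤ : ∀ x y z → + normℕ x y z ≡ normℤ x y z
+normℕ≡normℤ x y z = trans (cong +_ (normℕ≡ x y z)) (sym (normℤ≡ x y z))

N-pureQ : ∀ x y z → N (pureQ x y z) ≡ ι (+ normℕ x y z)
N-pureQ x y z = sym (begin
  ι (+ normℕ x y z)                           ≡⟨ cong ι (+normℕ≡normℤ x y z) ⟩
  ι (normℤ x y z)
    ≡⟨ trans (ι-+ (x ℤ.* x ℤ.+ y ℤ.* y) (z ℤ.* z)) (cong (_+ ι (z ℤ.* z)) (ι-+ (x ℤ.* x) (y ℤ.* y))) ⟩
  ι (x ℤ.* x) + ι (y ℤ.* y) + ι (z ℤ.* z)     ≡⟨ cong₂ _+_ (cong₂ _+_ (ι-* x x) (ι-* y y)) (ι-* z z) ⟩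
  ι x * ι x + ι y * ι y + ι z * ι z
    ≡⟨ solve 3 (λ x y z → x *ᵉ x +ᵉ y *ᵉ y +ᵉ z *ᵉ z ≐ Nᵉ (qe (Κ 0ℚ) x y z)) refl (ι x) (ι y) (ι z) ⟩
  N (pureQ x y z)                             ∎)

squarefree≢0 : ∀ {m} → SquareFree m → m ≢ 0
squarefree≢0 sf refl with () ← sf 2 (ℕD._∣0 4)

N-pureQ-nonzero : ∀ {x y z} → SquareFree (normℕ x y z) → N (pureQ x y z) ≢ 0ℚ
N-pureQ-nonzero {x} {y} {z} sf e = squarefree≢0 sf
  (ℤP.+-injective (ι-injective {+ normℕ x y z} {+ 0} (trans (sym (N-pureQ x y z)) e)))

-- The denominator of `u` divides each of x, y and z, so its square divides the squarefree number m.
multiplier-integral : ∀ {x y z} → SquareFree (normℕ x y z) → ∀ u {X Y Z} →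
  u * ι x ≡ ι X → u * ι y ≡ ι Y → u * ι z ≡ ι Z → Σ ℤ λ k → u ≡ ι k
multiplier-integral {x} {y} {z} sf u {X} {Y} {Z} ex ey ez = ℚ.↥ u , den≡1⇒ι u (sf d d²∣m)
  where
  n = ℚ.↥ u
  d = ℚ.↧ₙ u
  d∣ : ∀ {x X} → u * ι x ≡ ι X → + d ℤS.∣ x
  d∣ {x} {X} e = ℤS.∣ᵤ⇒∣ {+ d} {x}
    (Cop.coprime-divisor {d} {ℤ.∣ n ∣} (Cop.sym (num-den-coprime u)) (ℕD.divides ℤ.∣ X ∣ (begin
    ℤ.∣ n ∣ ℕ.* ℤ.∣ x ∣   ≡⟨ ℤP.abs-* n x ⟨
    ℤ.∣ n ℤ.* x ∣         ≡⟨ cong ℤ.∣_∣ (ι-injective {n ℤ.* x} {X ℤ.* + d} nx≡) ⟩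
    ℤ.∣ X ℤ.* + d ∣       ≡⟨ ℤP.abs-* X (+ d) ⟩
    ℤ.∣ X ∣ ℕ.* d         ∎)))
    where
    nx≡ : ι (n ℤ.* x) ≡ ι (X ℤ.* + d)
    nx≡ = begin
      ι (n ℤ.* x)           ≡⟨ ι-* n x ⟩
      ι n * ι x             ≡⟨ cong (_* ι x) (p*den≡num u) ⟨
      u * ι (+ d) * ι x     ≡⟨ solve 3 (λ u d x → u *ᵉ d *ᵉ x ≐ u *ᵉ x *ᵉ d) refl u (ι (+ d)) (ι x) ⟩
      u * ι x * ι (+ d)     ≡⟨ cong (_* ι (+ d)) e ⟩
      ι X * ι (+ d)         ≡⟨ ι-* X (+ d) ⟨
      ι (X ℤ.* + d)         ∎
  d²∣m : d ℕ.* d ℕD.∣ normℕ x y z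
  d²∣m = go (d∣ {x} {X} ex) (d∣ {y} {Y} ey) (d∣ {z} {Z} ez)
    where
    lem : ∀ p q r d →
      p ℤ.* d ℤ.* (p ℤ.* d) ℤ.+ q ℤ.* d ℤ.* (q ℤ.* d) ℤ.+ r ℤ.* d ℤ.* (r ℤ.* d) ≡
      (p ℤ.* p ℤ.+ q ℤ.* q ℤ.+ r ℤ.* r) ℤ.* (d ℤ.* d)
    lem = solve-∀
    go : + d ℤS.∣ x → + d ℤS.∣ y → + d ℤS.∣ z → d ℕ.* d ℕD.∣ normℕ x y z
    go (ℤS.divides p x≡) (ℤS.divides q y≡) (ℤS.divides r z≡) =
      ℤS.∣⇒∣ᵤ {+ (d ℕ.* d)} {normℤ x y z} (ℤS.divides (p ℤ.* p ℤ.+ q ℤ.* q ℤ.+ r ℤ.* r) (begin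
        normℤ x y z
          ≡⟨ cong₂ ℤ._+_ (cong₂ ℤ._+_ (cong₂ ℤ._*_ x≡ x≡) (cong₂ ℤ._*_ y≡ y≡)) (cong₂ ℤ._*_ z≡ z≡) ⟩
        normℤ (p ℤ.* + d) (q ℤ.* + d) (r ℤ.* + d) ≡⟨ lem p q r (+ d) ⟩
        (p ℤ.* p ℤ.+ q ℤ.* q ℤ.+ r ℤ.* r) ℤ.* (+ d ℤ.* + d)
          ≡⟨ cong ((p ℤ.* p ℤ.+ q ℤ.* q ℤ.+ r ℤ.* r) ℤ.*_) (ℤP.pos-* d d) ⟨
        (p ℤ.* p ℤ.+ q ℤ.* q ℤ.+ r ℤ.* r) ℤ.* + (d ℕ.* d) ∎))

Even Odd : ℤ → Set
Even n = Σ ℤ λ k → n ≡ + 2 ℤ.* k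
Odd n = Σ ℤ λ k → n ≡ + 2 ℤ.* k ℤ.+ + 1

even⊎odd : ∀ n → Even n ⊎ Odd n
even⊎odd n = go (n ℤDM.%ℕ 2) (ℤDM.n%ℕd<d n 2) (ℤDM.a≡a%ℕn+[a/ℕn]*n n 2)
  where
  q = n ℤDM./ℕ 2
  lem₀ : ∀ q → + 0 ℤ.+ q ℤ.* + 2 ≡ + 2 ℤ.* q
  lem₀ = solve-∀
  lem₁ : ∀ q → + 1 ℤ.+ q ℤ.* + 2 ≡ + 2 ℤ.* q ℤ.+ + 1
  lem₁ = solve-∀
  go : ∀ r → r ℕ.< 2 → n ≡ + r ℤ.+ q ℤ.* + 2 → Even n ⊎ Odd n
  go 0 _ e = inj₁ (q , trans e (lem₀ q))
  go 1 _ e = inj₂ (q , trans e (lem₁ q))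
  go (suc (suc _)) (ℕ.s≤s (ℕ.s≤s ())) _

even³⇒4∣norm : ∀ {x y z} → Even x → Even y → Even z → 4 ℕD.∣ normℕ x y z
even³⇒4∣norm {x} {y} {z} (p , x≡) (q , y≡) (r , z≡) = ℤS.∣⇒∣ᵤ {+ 4} {normℤ x y z}
  (ℤS.divides (p ℤ.* p ℤ.+ q ℤ.* q ℤ.+ r ℤ.* r)
    (trans (cong₂ ℤ._+_ (cong₂ ℤ._+_ (cong₂ ℤ._*_ x≡ x≡) (cong₂ ℤ._*_ y≡ y≡)) (cong₂ ℤ._*_ z≡ z≡))
    (lem p q r)))
  where
  lem : ∀ p q r →
    + 2 ℤ.* p ℤ.* (+ 2 ℤ.* p) ℤ.+ + 2 ℤ.* q ℤ.* (+ 2 ℤ.* q) ℤ.+ + 2 ℤ.* r ℤ.* (+ 2 ℤ.* r) ≡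
    (p ℤ.* p ℤ.+ q ℤ.* q ℤ.+ r ℤ.* r) ℤ.* + 4
  lem = solve-∀

-- `W` arises from integers, so its sign is not visible; a negative value would make the right-hand
-- side negative.
4W+3%4≡3 : ∀ m W → + m ≡ + 3 ℤ.+ W ℤ.* + 4 → m ℕDM.% 4 ≡ 3
4W+3%4≡3 m (+ w) e = trans
  (cong (ℕDM._% 4) (ℤP.+-injective (trans e (cong (λ t → + 3 ℤ.+ t) (sym (ℤP.pos-* w 4))))))
  (ℕDM.[m+kn]%n≡m%n 3 w 4)
4W+3%4≡3 m -[1+ w ] ()

odd³⇒norm%4≡3 : ∀ {x y z} → Odd x → Odd y → Odd z → normℕ x y z ℕDM.% 4 ≡ 3
odd³⇒norm%4≡3 {x} {y} {z} (p , x≡) (q , y≡) (r , z≡) = 4W+3%4≡3 (normℕ x y z)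
  (p ℤ.* p ℤ.+ p ℤ.+ (q ℤ.* q ℤ.+ q) ℤ.+ (r ℤ.* r ℤ.+ r))
  (trans (+normℕ≡normℤ x y z)
    (trans (cong₂ ℤ._+_ (cong₂ ℤ._+_ (cong₂ ℤ._*_ x≡ x≡) (cong₂ ℤ._*_ y≡ y≡)) (cong₂ ℤ._*_ z≡ z≡))
    (lem p q r)))
  where
  lem : ∀ p q r →
    (+ 2 ℤ.* p ℤ.+ + 1) ℤ.* (+ 2 ℤ.* p ℤ.+ + 1) ℤ.+ (+ 2 ℤ.* q ℤ.+ + 1) ℤ.* (+ 2 ℤ.* q ℤ.+ + 1) ℤ.+
    (+ 2 ℤ.* r ℤ.+ + 1) ℤ.* (+ 2 ℤ.* r ℤ.+ + 1)
    ≡ + 3 ℤ.+ (p ℤ.* p ℤ.+ p ℤ.+ (q ℤ.* q ℤ.+ q) ℤ.+ (r ℤ.* r ℤ.+ r)) ℤ.* + 4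
  lem = solve-∀

-- The three equations say that (a + kμ)/2 is the Hurwitz quaternion `hw a b c d`. What remains is
-- to find the parities of a and k that place it in ℤ + ℤω.
module _ {x y z k a b c d : ℤ} (sf : SquareFree (normℕ x y z))
  (ex : k ℤ.* x ≡ a ℤ.+ + 2 ℤ.* b) (ey : k ℤ.* y ≡ a ℤ.+ + 2 ℤ.* c) (ez : k ℤ.* z ≡ a ℤ.+ + 2 ℤ.* d) where

  -- Some coordinate of μ is odd, for otherwise 4 would divide m. At an odd coordinate the equation
  -- reads k ≡ a modulo 2.
  parity-3 : normℕ x y z ℕDM.% 4 ≡ 3 → Σ ℤ λ j → a ≡ k ℤ.+ + 2 ℤ.* j
  parity-3 m≡3 = go (even⊎odd x) (even⊎odd y) (even⊎odd z)
    where
    odd : ∀ {x b} → k ℤ.* x ≡ a ℤ.+ + 2 ℤ.* b → Odd x → Σ ℤ λ j → a ≡ k ℤ.+ + 2 ℤ.* j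
    odd {x} {b} e (p , x≡) = k ℤ.* p ℤ.- b , trans (lem₁ a b)
      (trans (cong (ℤ._- + 2 ℤ.* b) (trans (sym e) (cong (k ℤ.*_) x≡))) (lem₂ k p b))
      where
      lem₁ : ∀ a b → a ≡ a ℤ.+ + 2 ℤ.* b ℤ.- + 2 ℤ.* b
      lem₁ = solve-∀
      lem₂ : ∀ k p b → k ℤ.* (+ 2 ℤ.* p ℤ.+ + 1) ℤ.- + 2 ℤ.* b ≡ k ℤ.+ + 2 ℤ.* (k ℤ.* p ℤ.- b)
      lem₂ = solve-∀
    go : Even x ⊎ Odd x → Even y ⊎ Odd y → Even z ⊎ Odd z → Σ ℤ λ j → a ≡ k ℤ.+ + 2 ℤ.* j
    go (inj₂ ox) _ _ = odd {x} {b} ex ox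
    go (inj₁ _) (inj₂ oy) _ = odd {y} {c} ey oy
    go (inj₁ _) (inj₁ _) (inj₂ oz) = odd {z} {d} ez oz
    go (inj₁ p) (inj₁ q) (inj₁ r) with () ← trans (sym m≡3)
      (ℕD.n∣m⇒m%n≡0 (normℕ x y z) 4 (even³⇒4∣norm p q r))

  -- For odd k, the coordinates x, y, z would all have the parity of a. If they are even, 4 divides
  -- m, contrary to squarefreeness; if odd, m ≡ 3 modulo 4. So k is even, and then a = kx - 2b is
  -- even too.
  parity-other : normℕ x y z ℕDM.% 4 ≢ 3 → Even k × Even a
  parity-other m≢3 = go (even⊎odd k) (even⊎odd a)
    where
    lem₁ : ∀ a b → a ≡ a ℤ.+ + 2 ℤ.* b ℤ.- + 2 ℤ.* b
    lem₁ = solve-∀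
    lem₂ : ∀ p x b → + 2 ℤ.* p ℤ.* x ℤ.- + 2 ℤ.* b ≡ + 2 ℤ.* (p ℤ.* x ℤ.- b)
    lem₂ = solve-∀
    lem₃ : ∀ p x → x ≡ (+ 2 ℤ.* p ℤ.+ + 1) ℤ.* x ℤ.- + 2 ℤ.* (p ℤ.* x)
    lem₃ = solve-∀
    lem₄ : ∀ s b t → + 2 ℤ.* s ℤ.+ + 2 ℤ.* b ℤ.- + 2 ℤ.* t ≡ + 2 ℤ.* (s ℤ.+ b ℤ.- t)
    lem₄ = solve-∀
    lem₅ : ∀ s b t → + 2 ℤ.* s ℤ.+ + 1 ℤ.+ + 2 ℤ.* b ℤ.- + 2 ℤ.* t ≡ + 2 ℤ.* (s ℤ.+ b ℤ.- t) ℤ.+ + 1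
    lem₅ = solve-∀
    x≡ : ∀ {x b} p → k ≡ + 2 ℤ.* p ℤ.+ + 1 → k ℤ.* x ≡ a ℤ.+ + 2 ℤ.* b →
      x ≡ a ℤ.+ + 2 ℤ.* b ℤ.- + 2 ℤ.* (p ℤ.* x)
    x≡ {x} p k≡ e = trans (lem₃ p x) (cong (ℤ._- + 2 ℤ.* (p ℤ.* x)) (trans (cong (ℤ._* x) (sym k≡)) e))
    even : ∀ {x b} p → k ≡ + 2 ℤ.* p ℤ.+ + 1 → k ℤ.* x ≡ a ℤ.+ + 2 ℤ.* b → Even a → Even x
    even {x} {b} p k≡ e (s , a≡) = s ℤ.+ b ℤ.- p ℤ.* x , trans (x≡ {x} {b} p k≡ e)
      (trans (cong (λ a → a ℤ.+ + 2 ℤ.* b ℤ.- + 2 ℤ.* (p ℤ.* x)) a≡) (lem₄ s b (p ℤ.* x)))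
    odd : ∀ {x b} p → k ≡ + 2 ℤ.* p ℤ.+ + 1 → k ℤ.* x ≡ a ℤ.+ + 2 ℤ.* b → Odd a → Odd x
    odd {x} {b} p k≡ e (s , a≡) = s ℤ.+ b ℤ.- p ℤ.* x , trans (x≡ {x} {b} p k≡ e)
      (trans (cong (λ a → a ℤ.+ + 2 ℤ.* b ℤ.- + 2 ℤ.* (p ℤ.* x)) a≡) (lem₅ s b (p ℤ.* x)))
    go : Even k ⊎ Odd k → Even a ⊎ Odd a → Even k × Even a
    go (inj₁ (p , k≡)) _ = (p , k≡) ,
      (p ℤ.* x ℤ.- b , trans (lem₁ a b)
      (trans (cong (ℤ._- + 2 ℤ.* b) (trans (sym ex) (cong (ℤ._* x) k≡))) (lem₂ p x b)))
    go (inj₂ (p , k≡)) (inj₁ ea) with () ← sf 2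
      (even³⇒4∣norm (even {x} {b} p k≡ ex ea) (even {y} {c} p k≡ ey ea) (even {z} {d} p k≡ ez ea))
    go (inj₂ (p , k≡)) (inj₂ oa) = ⊥-elim
      (m≢3 (odd³⇒norm%4≡3 (odd {x} {b} p k≡ ex oa) (odd {y} {c} p k≡ ey oa) (odd {z} {d} p k≡ ez oa)))

-- The quadratic field ℚ(μ) and its maximal order

-- For pure μ ≠ 0 the commutant of μ is the field ℚ(μ) = ℚ + ℚμ (commutant-span).
Commutes : Quat → Quat → Set
Commutes μ q = q · μ ≡ μ · q

module _ {x y z : ℚ} where
  private
    μ : Quat
    μ = quat 0ℚ x y z
    dot : Quat → ℚ
    dot q = im-i q * x + im-j q * y + im-k q * z
    μᵉ : QExpr 12
    μᵉ = qe (Κ 0ℚ) (Ι (# 5)) (Ι (# 6)) (Ι (# 7))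

  -- Let v be the imaginary part of q. The commutator of q with μ sees only the component of v
  -- orthogonal to μ, and a further factor μ recovers it: N(μ)v = (v·μ)μ - ½(qμ - μq)μ. The last
  -- term vanishes here, so v is parallel to μ.
  commutant-span : N μ ≢ 0ℚ → ∀ q → Commutes μ q → Σ ℚ λ t → q ≡ scal (re q) ⊕ scal t · μ
  commutant-span μ≢0 q comm = recip (N μ) * dot q , scal-cancelˡ μ≢0 (begin
    scal (N μ) · q
      ≡⟨ proveQ (env q μ 0q) (scalᵉ (Nᵉ μᵉ) ·ᵉ v₁)
           (scalᵉ (Nᵉ μᵉ) ·ᵉ scalᵉ (eᵣ v₁) ⊕ᵉ scalᵉ (eᵢ v₁ *ᵉ eᵢ μᵉ +ᵉ eⱼ v₁ *ᵉ eⱼ μᵉ +ᵉ eₖ v₁ *ᵉ eₖ μᵉ) ·ᵉ μᵉ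
             ⊕ᵉ scalᵉ (Κ (- ½)) ·ᵉ ((v₁ ·ᵉ μᵉ ⊕ᵉ negᵉ (μᵉ ·ᵉ v₁)) ·ᵉ μᵉ)) refl ⟩
    scal (N μ) · scal (re q) ⊕ scal (dot q) · μ ⊕ scal (- ½) · ((q · μ ⊕ neg (μ · q)) · μ)
      ≡⟨ cong (λ w → scal (N μ) · scal (re q) ⊕ scal (dot q) · μ ⊕ scal (- ½) ·
         ((w ⊕ neg (μ · q)) · μ)) comm ⟩
    scal (N μ) · scal (re q) ⊕ scal (dot q) · μ ⊕ scal (- ½) · ((μ · q ⊕ neg (μ · q)) · μ)
      ≡⟨ proveQ (env (scal (N μ) · scal (re q) ⊕ scal (dot q) · μ) μ (μ · q))
           (v₁ ⊕ᵉ scalᵉ (Κ (- ½)) ·ᵉ ((v₃ ⊕ᵉ negᵉ v₃) ·ᵉ v₂)) v₁ refl ⟩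
    scal (N μ) · scal (re q) ⊕ scal (dot q) · μ
      ≡⟨ cong (λ w → scal (N μ) · scal (re q) ⊕ scal w · μ) dot≡ ⟩
    scal (N μ) · scal (re q) ⊕ scal (N μ * (recip (N μ) * dot q)) · μ
      ≡⟨ cong (λ w → scal (N μ) · scal (re q) ⊕ w · μ) (scal-* (N μ) (recip (N μ) * dot q)) ⟩
    scal (N μ) · scal (re q) ⊕ scal (N μ) · scal (recip (N μ) * dot q) · μ
      ≡⟨ cong (scal (N μ) · scal (re q) ⊕_) (·-assoc (scal (N μ)) (scal (recip (N μ) * dot q)) μ) ⟩
    scal (N μ) · scal (re q) ⊕ scal (N μ) · (scal (recip (N μ) * dot q) · μ)
      ≡⟨ ·-distribˡ (scal (N μ)) (scal (re q)) (scal (recip (N μ) * dot q) · μ) ⟨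
    scal (N μ) · (scal (re q) ⊕ scal (recip (N μ) * dot q) · μ) ∎)
    where
    dot≡ : dot q ≡ N μ * (recip (N μ) * dot q)
    dot≡ = begin
      dot q                           ≡⟨ ℚP.*-identityˡ (dot q) ⟨
      1ℚ * dot q                      ≡⟨ cong (_* dot q) (*-recip μ≢0) ⟨
      recip (N μ) * N μ * dot q
        ≡⟨ solve 3 (λ a b c → a *ᵉ b *ᵉ c ≐ b *ᵉ (a *ᵉ c)) refl (recip (N μ)) (N μ) (dot q) ⟩
      N μ * (recip (N μ) * dot q)     ∎

  -- This is what allows a multiplier of an ideal to change sides, from the left of an element ξρ to
  -- the right of ρ.
  commutant-comm : N μ ≢ 0ℚ → ∀ {p q} → Commutes μ p → Commutes μ q → p · q ≡ q · p
  commutant-comm μ≢0 {p} {q} cp cq =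
    let (t , q≡) = commutant-span μ≢0 q cq in go t q≡
    where
    go : ∀ t → q ≡ scal (re q) ⊕ scal t · μ → p · q ≡ q · p
    go t q≡ = begin
      p · q                                         ≡⟨ cong (p ·_) q≡ ⟩
      p · (scal (re q) ⊕ scal t · μ)
        ≡⟨ proveQ (env p μ (quat (re q) t 0ℚ 0ℚ)) (v₁ ·ᵉ (scalᵉ (eᵣ v₃) ⊕ᵉ scalᵉ (eᵢ v₃) ·ᵉ μᵉ))
           (scalᵉ (eᵣ v₃) ·ᵉ v₁ ⊕ᵉ scalᵉ (eᵢ v₃) ·ᵉ (v₁ ·ᵉ μᵉ)) refl ⟩
      scal (re q) · p ⊕ scal t · (p · μ)            ≡⟨ cong (λ w → scal (re q) · p ⊕ scal t · w) cp ⟩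
      scal (re q) · p ⊕ scal t · (μ · p)
        ≡⟨ proveQ (env p μ (quat (re q) t 0ℚ 0ℚ)) (scalᵉ (eᵣ v₃) ·ᵉ v₁ ⊕ᵉ scalᵉ (eᵢ v₃) ·ᵉ (μᵉ ·ᵉ v₁))
           ((scalᵉ (eᵣ v₃) ⊕ᵉ scalᵉ (eᵢ v₃) ·ᵉ μᵉ) ·ᵉ v₁) refl ⟩
      (scal (re q) ⊕ scal t · μ) · p                ≡⟨ cong (_· p) q≡ ⟨
      q · p                                         ∎

  conj-by-reflection : N μ ≢ 0ℚ → ∀ τ → τ · μ ≡ neg (μ · τ) → ∀ {q} → Commutes μ q → τ · q ≡ conj q · τ
  conj-by-reflection μ≢0 τ anti {q} cq =
    let (t , q≡) = commutant-span μ≢0 q cq in go t q≡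
    where
    go : ∀ t → q ≡ scal (re q) ⊕ scal t · μ → τ · q ≡ conj q · τ
    go t q≡ = begin
      τ · q                                         ≡⟨ cong (τ ·_) q≡ ⟩
      τ · (scal (re q) ⊕ scal t · μ)
        ≡⟨ proveQ (env τ μ (quat (re q) t 0ℚ 0ℚ)) (v₁ ·ᵉ (scalᵉ (eᵣ v₃) ⊕ᵉ scalᵉ (eᵢ v₃) ·ᵉ μᵉ))
           (scalᵉ (eᵣ v₃) ·ᵉ v₁ ⊕ᵉ scalᵉ (eᵢ v₃) ·ᵉ (v₁ ·ᵉ μᵉ)) refl ⟩
      scal (re q) · τ ⊕ scal t · (τ · μ)            ≡⟨ cong (λ w → scal (re q) · τ ⊕ scal t · w) anti ⟩
      scal (re q) · τ ⊕ scal t · neg (μ · τ)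
        ≡⟨ proveQ (env τ μ (quat (re q) t 0ℚ 0ℚ)) (scalᵉ (eᵣ v₃) ·ᵉ v₁ ⊕ᵉ scalᵉ (eᵢ v₃) ·ᵉ (negᵉ (μᵉ ·ᵉ v₁)))
           (conjᵉ (scalᵉ (eᵣ v₃) ⊕ᵉ scalᵉ (eᵢ v₃) ·ᵉ μᵉ) ·ᵉ v₁) refl ⟩
      conj (scal (re q) ⊕ scal t · μ) · τ           ≡⟨ cong (λ w → conj w · τ) q≡ ⟨
      conj q · τ                                    ∎

  Commutes-conj : ∀ {q} → Commutes μ q → Commutes μ (conj q)
  Commutes-conj {q} cq = begin
    conj q · μ              ≡⟨ proveQ (env q μ 0q) (conjᵉ v₁ ·ᵉ μᵉ) (negᵉ (conjᵉ (μᵉ ·ᵉ v₁))) refl ⟩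
    neg (conj (μ · q))      ≡⟨ cong (λ w → neg (conj w)) cq ⟨
    neg (conj (q · μ))      ≡⟨ proveQ (env q μ 0q) (negᵉ (conjᵉ (v₁ ·ᵉ μᵉ))) (μᵉ ·ᵉ conjᵉ v₁) refl ⟩
    μ · conj q              ∎

Commutes-· : ∀ {μ p q} → Commutes μ p → Commutes μ q → Commutes μ (p · q)
Commutes-· {μ} {p} {q} cp cq = begin
  p · q · μ     ≡⟨ ·-assoc p q μ ⟩
  p · (q · μ)   ≡⟨ cong (p ·_) cq ⟩
  p · (μ · q)   ≡⟨ ·-assoc p μ q ⟨
  p · μ · q     ≡⟨ cong (_· q) cp ⟩
  μ · p · q     ≡⟨ ·-assoc μ p q ⟩
  μ · (p · q)   ∎

Commutes-⊕ : ∀ {μ p q} → Commutes μ p → Commutes μ q → Commutes μ (p ⊕ q)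
Commutes-⊕ {μ} {p} {q} cp cq = trans (·-distribʳ μ p q) (trans (cong₂ _⊕_ cp cq) (sym (·-distribˡ μ p q)))

Commutes-unscale : ∀ {μ s q} → s ≢ 0ℚ → Commutes μ (scal s · q) → Commutes μ q
Commutes-unscale {μ} {s} {q} s≢0 c = scal-cancelˡ s≢0 (begin
  scal s · (q · μ)   ≡⟨ ·-assoc (scal s) q μ ⟨
  scal s · q · μ     ≡⟨ c ⟩
  μ · (scal s · q)   ≡⟨ ·-assoc μ (scal s) q ⟨
  μ · scal s · q     ≡⟨ cong (_· q) (scal-central s μ) ⟨
  scal s · μ · q     ≡⟨ ·-assoc (scal s) μ q ⟩
  scal s · (μ · q)   ∎)

-- Turns the case distinction inside `ω` into equations, so that it can be used without matching on
-- the residue again.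
ω-cases : ∀ x y z →
  (normℕ x y z ℕDM.% 4 ≡ 3 × ω x y z ≡ scal ½ · (scal 1ℚ ⊕ pureQ x y z)) ⊎
  (normℕ x y z ℕDM.% 4 ≢ 3 × ω x y z ≡ pureQ x y z)
ω-cases x y z with normℕ x y z ℕDM.% 4
... | 0 = inj₂ ((λ ()) , refl)
... | 1 = inj₂ ((λ ()) , refl)
... | 2 = inj₂ ((λ ()) , refl)
... | 3 = inj₁ (refl , refl)
... | suc (suc (suc (suc _))) = inj₂ ((λ ()) , refl)

ω-commutes : ∀ x y z → Commutes (pureQ x y z) (ω x y z)
ω-commutes x y z = go (ω-cases x y z)
  where
  go : _ → Commutes (pureQ x y z) (ω x y z)
  go (inj₁ (_ , e)) = trans (cong (_· pureQ x y z) e) (trans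
    (proveQ (env (pureQ x y z) 0q 0q) (scalᵉ (Κ ½) ·ᵉ (scalᵉ (Κ 1ℚ) ⊕ᵉ v₁) ·ᵉ v₁)
      (v₁ ·ᵉ (scalᵉ (Κ ½) ·ᵉ (scalᵉ (Κ 1ℚ) ⊕ᵉ v₁))) refl)
    (cong (pureQ x y z ·_) (sym e)))
  go (inj₂ (_ , e)) = trans (cong (_· pureQ x y z) e) (cong (pureQ x y z ·_) (sym e))

InO⇒Commutes : ∀ {x y z q} → InO x y z q → Commutes (pureQ x y z) q
InO⇒Commutes {x} {y} {z} (s , t , q≡) = subst (Commutes (pureQ x y z)) (sym q≡)
  (Commutes-⊕ {pureQ x y z} {ℤq s} {ℤq t · ω x y z} (scal-central (ι s) (pureQ x y z))
    (Commutes-· {pureQ x y z} {ℤq t} {ω x y z} (scal-central (ι t) (pureQ x y z)) (ω-commutes x y z)))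

-- Write q = s + tμ. Doubling the coordinates of q makes 2t·x, 2t·y and 2t·z integers, so k = 2t is
-- an integer by squarefreeness, and the parity lemmas put q = (a + kμ)/2 into ℤ + ℤω.
commutant-integral : ∀ {x y z} → SquareFree (normℕ x y z) → ∀ {q} → Hw q → Commutes (pureQ x y z) q →
  InO x y z q
commutant-integral {x} {y} {z} sf {q} (a , b , c , d , q≡) comm =
  let (t , q≡') = commutant-span {ι x} {ι y} {ι z} μ≢0 q comm in go t q≡'
  where
  μ : Quat
  μ = pureQ x y z
  μ≢0 : N μ ≢ 0ℚ
  μ≢0 = N-pureQ-nonzero {x} {y} {z} sf
  push : ∀ b → ι (a ℤ.+ + 2 ℤ.* b) ≡ ι a + ι (+ 2) * ι b
  push b = trans (ι-+ a (+ 2 ℤ.* b)) (cong (λ w → ι a + w) (ι-* (+ 2) b))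
  go : ∀ t → q ≡ scal (re q) ⊕ scal t · μ → InO x y z q
  go t q≡' = finish
    (multiplier-integral {x} {y} {z} sf u {a ℤ.+ + 2 ℤ.* b} {a ℤ.+ + 2 ℤ.* c} {a ℤ.+ + 2 ℤ.* d} ex ey ez)
    where
    u : ℚ
    u = t + t
    both : scal (re q) ⊕ scal t · μ ≡ hw a b c d
    both = trans (sym q≡') q≡
    spanᵉ : QExpr 12
    spanᵉ = scalᵉ (eᵣ v₁) ⊕ᵉ scalᵉ (eᵢ v₁) ·ᵉ qe (Κ 0ℚ) (eᵢ v₂) (eⱼ v₂) (eₖ v₂)
    ρ : Vec ℚ 12
    ρ = env (quat (re q) t 0ℚ 0ℚ) μ 0q
    double : ∀ {v} b → v ≡ ½ * ι a + ι b → v + v ≡ ι (a ℤ.+ + 2 ℤ.* b)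
    double b e = trans (cong₂ _+_ e e)
      (trans (solve 2 (λ a b → Κ ½ *ᵉ a +ᵉ b +ᵉ (Κ ½ *ᵉ a +ᵉ b) ≐ a +ᵉ Κ (ι (+ 2)) *ᵉ b) refl (ι a) (ι b))
      (sym (push b)))
    ex : u * ι x ≡ ι (a ℤ.+ + 2 ℤ.* b)
    ex = trans (S.Ops.prove ρ ((eᵢ v₁ +ᵉ eᵢ v₁) *ᵉ eᵢ v₂) (eᵢ spanᵉ +ᵉ eᵢ spanᵉ) refl)
      (double b (cong im-i both))
    ey : u * ι y ≡ ι (a ℤ.+ + 2 ℤ.* c)
    ey = trans (S.Ops.prove ρ ((eᵢ v₁ +ᵉ eᵢ v₁) *ᵉ eⱼ v₂) (eⱼ spanᵉ +ᵉ eⱼ spanᵉ) refl)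
      (double c (cong im-j both))
    ez : u * ι z ≡ ι (a ℤ.+ + 2 ℤ.* d)
    ez = trans (S.Ops.prove ρ ((eᵢ v₁ +ᵉ eᵢ v₁) *ᵉ eₖ v₂) (eₖ spanᵉ +ᵉ eₖ spanᵉ) refl)
      (double d (cong im-k both))
    finish : (Σ ℤ λ k → u ≡ ι k) → InO x y z q
    finish (k , u≡) = cases (ω-cases x y z)
      where
      int : ∀ {x b} → u * ι x ≡ ι (a ℤ.+ + 2 ℤ.* b) → k ℤ.* x ≡ a ℤ.+ + 2 ℤ.* b
      int {x} {b} e = ι-injective {k ℤ.* x} {a ℤ.+ + 2 ℤ.* b}
        (trans (ι-* k x) (trans (cong (_* ι x) (sym u≡)) e))
      t≡ : t ≡ ½ * ι k
      t≡ = trans (solve 1 (λ t → t ≐ Κ ½ *ᵉ (t +ᵉ t)) refl t) (cong (½ *_) u≡)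
      q≡½ : q ≡ scal (½ * ι a) ⊕ scal (½ * ι k) · μ
      q≡½ = trans q≡' (cong₂ (λ s t → scal s ⊕ scal t · μ) (cong re q≡) t≡)
      cases : _ → InO x y z q
      cases (inj₁ (m≡3 , ω≡)) =
        let (j , a≡) = parity-3 {x} {y} {z} {k} {a} {b} {c} {d} sf (int {x} {b} ex)
              (int {y} {c} ey) (int {z} {d} ez) m≡3 in
        -- With a = k + 2j one has (a + kμ)/2 = j + k(1 + μ)/2.
        j , k , (begin
          q                                             ≡⟨ q≡½ ⟩
          scal (½ * ι a) ⊕ scal (½ * ι k) · μ
            ≡⟨ cong (λ A → scal (½ * A) ⊕ scal (½ * ι k) · μ)
               (trans (cong ι a≡) (trans (ι-+ k (+ 2 ℤ.* j)) (cong (λ w → ι k + w) (ι-* (+ 2) j)))) ⟩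
          scal (½ * (ι k + ι (+ 2) * ι j)) ⊕ scal (½ * ι k) · μ
            ≡⟨ proveQ (env μ (quat (ι k) (ι j) 0ℚ 0ℚ) 0q)
               (scalᵉ (Κ ½ *ᵉ (eᵣ v₂ +ᵉ Κ (ι (+ 2)) *ᵉ eᵢ v₂)) ⊕ᵉ scalᵉ (Κ ½ *ᵉ eᵣ v₂) ·ᵉ v₁)
                 (scalᵉ (eᵢ v₂) ⊕ᵉ scalᵉ (eᵣ v₂) ·ᵉ (scalᵉ (Κ ½) ·ᵉ (scalᵉ (Κ 1ℚ) ⊕ᵉ v₁))) refl ⟩
          ℤq j ⊕ ℤq k · (scal ½ · (scal 1ℚ ⊕ μ))        ≡⟨ cong (λ w → ℤq j ⊕ ℤq k · w) ω≡ ⟨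
          ℤq j ⊕ ℤq k · ω x y z                         ∎)
      cases (inj₂ (m≢3 , ω≡)) =
        let ((K , k≡) , (A , a≡)) = parity-other {x} {y} {z} {k} {a} {b} {c} {d} sf
              (int {x} {b} ex) (int {y} {c} ey) (int {z} {d} ez) m≢3 in
        A , K , (begin
          q                                             ≡⟨ q≡½ ⟩
          scal (½ * ι a) ⊕ scal (½ * ι k) · μ
            ≡⟨ cong₂ (λ A K → scal (½ * A) ⊕ scal (½ * K) · μ) (trans (cong ι a≡) (ι-* (+ 2) A))
               (trans (cong ι k≡) (ι-* (+ 2) K)) ⟩
          scal (½ * (ι (+ 2) * ι A)) ⊕ scal (½ * (ι (+ 2) * ι K)) · μ
            ≡⟨ proveQ (env μ (quat (ι A) (ι K) 0ℚ 0ℚ) 0q)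
               (scalᵉ (Κ ½ *ᵉ (Κ (ι (+ 2)) *ᵉ eᵣ v₂)) ⊕ᵉ scalᵉ (Κ ½ *ᵉ (Κ (ι (+ 2)) *ᵉ eᵢ v₂)) ·ᵉ v₁)
                 (scalᵉ (eᵣ v₂) ⊕ᵉ scalᵉ (eᵢ v₂) ·ᵉ v₁) refl ⟩
          ℤq A ⊕ ℤq K · μ                               ≡⟨ cong (λ w → ℤq A ⊕ ℤq K · w) ω≡ ⟨
          ℤq A ⊕ ℤq K · ω x y z                         ∎)

-- Coordinates agreeing up to sign

-- Coprimality forces d to divide 3. For d = 1 the square n² divides m, so n = 1; for d = 3 the
-- equation becomes n² = 3m, and 3 would divide n as well as d.
3n²≡md² : ∀ {m} n d → SquareFree m → Cop.Coprime n d → 3 ℕ.* (n ℕ.* n) ≡ m ℕ.* (d ℕ.* d) → m ≡ 3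
3n²≡md² {m} n d sf cop e = go d cop e d∣3
  where
  lem : ∀ n → n ℕ.* (n ℕ.* 3) ≡ 3 ℕ.* (n ℕ.* n)
  lem = ℕR.solve-∀
  lem₃ : ∀ m → m ℕ.* (3 ℕ.* 3) ≡ 3 ℕ.* (m ℕ.* 3)
  lem₃ = ℕR.solve-∀
  d∣3 : d ℕD.∣ 3
  d∣3 = Cop.coprime-divisor {d} {n} (Cop.sym cop) (Cop.coprime-divisor {d} {n} (Cop.sym cop)
          (ℕD.divides (m ℕ.* d) (trans (lem n) (trans e (sym (ℕP.*-assoc m d d))))))
  go : ∀ d → Cop.Coprime n d → 3 ℕ.* (n ℕ.* n) ≡ m ℕ.* (d ℕ.* d) → d ℕD.∣ 3 → m ≡ 3
  go 0 _ _ 0∣3 with () ← ℕD.0∣⇒≡0 0∣3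
  go 1 _ e _ = trans m≡ (cong (λ n → 3 ℕ.* (n ℕ.* n)) (sf n (ℕD.divides 3 m≡)))
    where
    m≡ : m ≡ 3 ℕ.* (n ℕ.* n)
    m≡ = sym (trans e (ℕP.*-identityʳ m))
  go 2 _ _ 2∣3 = ⊥-elim (from-no (2 ℕD.∣? 3) 2∣3)
  go 3 cop e _ with () ← cop
    (Cop.coprime-divisor {3} {n} (Cop.sym cop)
    (ℕD.divides m (ℕP.*-cancelˡ-≡ (n ℕ.* n) (m ℕ.* 3) 3 (trans e (lem₃ m)))) , ℕD.∣-refl)
  go (suc (suc (suc (suc d)))) _ _ d∣3 with ℕ.s≤s (ℕ.s≤s (ℕ.s≤s ())) ← ℕD.∣⇒≤ d∣3

-- The coordinates of μ′ are known only as rationals, so r is written as a fraction n/d in lowest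
-- terms.
squarefree≡3r² : ∀ {m} → SquareFree m → ∀ r → r * r + r * r + r * r ≡ ι (+ m) → m ≡ 3
squarefree≡3r² {m} sf r e = 3n²≡md² ℤ.∣ n ∣ d sf (num-den-coprime r) (ℤP.+-injective (ι-injective
  {+ (3 ℕ.* (ℤ.∣ n ∣ ℕ.* ℤ.∣ n ∣))} {+ (m ℕ.* (d ℕ.* d))} (begin
    ι (+ (3 ℕ.* (ℤ.∣ n ∣ ℕ.* ℤ.∣ n ∣)))       ≡⟨ cong ι (ℤP.pos-* 3 (ℤ.∣ n ∣ ℕ.* ℤ.∣ n ∣)) ⟩
    ι (+ 3 ℤ.* + (ℤ.∣ n ∣ ℕ.* ℤ.∣ n ∣))       ≡⟨ ι-* (+ 3) (+ (ℤ.∣ n ∣ ℕ.* ℤ.∣ n ∣)) ⟩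
    ι (+ 3) * ι (+ (ℤ.∣ n ∣ ℕ.* ℤ.∣ n ∣))     ≡⟨ cong (λ w → ι (+ 3) * ι w) (sq≡∣∣ n) ⟨
    ι (+ 3) * ι (n ℤ.* n)                     ≡⟨ cong (ι (+ 3) *_) (ι-* n n) ⟩
    ι (+ 3) * (ι n * ι n)                     ≡⟨ cong (λ w → ι (+ 3) * (w * w)) (p*den≡num r) ⟨
    ι (+ 3) * (r * ι (+ d) * (r * ι (+ d)))
      ≡⟨ solve 2 (λ r d → Κ (ι (+ 3)) *ᵉ (r *ᵉ d *ᵉ (r *ᵉ d)) ≐ (r *ᵉ r +ᵉ r *ᵉ r +ᵉ r *ᵉ r) *ᵉ
         (d *ᵉ d)) refl r (ι (+ d)) ⟩
    (r * r + r * r + r * r) * (ι (+ d) * ι (+ d))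
      ≡⟨ cong₂ _*_ e (sym (trans (cong ι (ℤP.pos-* d d)) (ι-* (+ d) (+ d)))) ⟩
    ι (+ m) * ι (+ (d ℕ.* d))                 ≡⟨ ι-* (+ m) (+ (d ℕ.* d)) ⟨
    ι (+ m ℤ.* + (d ℕ.* d))                   ≡⟨ cong ι (ℤP.pos-* m (d ℕ.* d)) ⟨
    ι (+ (m ℕ.* (d ℕ.* d)))                   ∎)))
  where
  n = ℚ.↥ r
  d = ℚ.↧ₙ r

sq≤3⇒≤1 : ∀ {n} → n ℕ.* n ℕ.≤ 3 → n ℕ.≤ 1
sq≤3⇒≤1 {0} _ = ℕ.z≤n
sq≤3⇒≤1 {1} _ = ℕP.≤-refl
sq≤3⇒≤1 {suc (suc n)} le = ⊥-elim
  (ℕP.<⇒≱ {3} {4} ℕP.≤-refl (ℕP.≤-trans (ℕP.*-mono-≤ {2} {suc (suc n)} {2} {suc (suc n)} 2≤ 2≤) le))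
  where
  2≤ : 2 ℕ.≤ suc (suc n)
  2≤ = ℕ.s≤s (ℕ.s≤s ℕ.z≤n)

sum-of-three-bounds : ∀ {X Y Z n} → X ℕ.* X ℕ.+ Y ℕ.* Y ℕ.+ Z ℕ.* Z ≡ n → n ℕ.≤ 3 →
  X ℕ.≤ 1 × Y ℕ.≤ 1 × Z ℕ.≤ 1
sum-of-three-bounds {X} {Y} {Z} {n} e n≤3 =
    sq≤3⇒≤1 (ℕP.≤-trans (ℕP.m≤m+n (X ℕ.* X) (Y ℕ.* Y)) le)
  , sq≤3⇒≤1 (ℕP.≤-trans (ℕP.m≤n+m (Y ℕ.* Y) (X ℕ.* X)) le)
  , sq≤3⇒≤1 (ℕP.≤-trans (ℕP.m≤n+m (Z ℕ.* Z) (X ℕ.* X ℕ.+ Y ℕ.* Y)) sum≤3)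
  where
  sum≤3 : X ℕ.* X ℕ.+ Y ℕ.* Y ℕ.+ Z ℕ.* Z ℕ.≤ 3
  sum≤3 = subst (ℕ._≤ 3) (sym e) n≤3
  le : X ℕ.* X ℕ.+ Y ℕ.* Y ℕ.≤ 3
  le = ℕP.≤-trans (ℕP.m≤m+n (X ℕ.* X ℕ.+ Y ℕ.* Y) (Z ℕ.* Z)) sum≤3

norm3⇒¬exactlyTwo : ∀ {X Y Z : ℕ} → X ℕ.* X ℕ.+ Y ℕ.* Y ℕ.+ Z ℕ.* Z ≡ 3 → ExactlyTwoEqual X Y Z → ⊥
norm3⇒¬exactlyTwo {X} {Y} {Z} e two = let
  (bx , by , bz) = sum-of-three-bounds {X} {Y} {Z} e ℕP.≤-refl in go bx by bz e two
  where
  go : ∀ {X Y Z} → X ℕ.≤ 1 → Y ℕ.≤ 1 → Z ℕ.≤ 1 → X ℕ.* X ℕ.+ Y ℕ.* Y ℕ.+ Z ℕ.* Z ≡ 3 → ExactlyTwoEqual X Y Z →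
    ⊥
  go ℕ.z≤n ℕ.z≤n ℕ.z≤n ()
  go ℕ.z≤n ℕ.z≤n (ℕ.s≤s ℕ.z≤n) ()
  go ℕ.z≤n (ℕ.s≤s ℕ.z≤n) ℕ.z≤n ()
  go ℕ.z≤n (ℕ.s≤s ℕ.z≤n) (ℕ.s≤s ℕ.z≤n) ()
  go (ℕ.s≤s ℕ.z≤n) ℕ.z≤n ℕ.z≤n ()
  go (ℕ.s≤s ℕ.z≤n) ℕ.z≤n (ℕ.s≤s ℕ.z≤n) ()
  go (ℕ.s≤s ℕ.z≤n) (ℕ.s≤s ℕ.z≤n) ℕ.z≤n ()
  go (ℕ.s≤s ℕ.z≤n) (ℕ.s≤s ℕ.z≤n) (ℕ.s≤s ℕ.z≤n) _ (inj₁ (_ , ne)) = ne refl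
  go (ℕ.s≤s ℕ.z≤n) (ℕ.s≤s ℕ.z≤n) (ℕ.s≤s ℕ.z≤n) _ (inj₂ (inj₁ (_ , ne))) = ne refl
  go (ℕ.s≤s ℕ.z≤n) (ℕ.s≤s ℕ.z≤n) (ℕ.s≤s ℕ.z≤n) _ (inj₂ (inj₂ (_ , ne))) = ne refl

TwoEqual : {A : Set} → A → A → A → Set
TwoEqual x y z = x ≡ y ⊎ y ≡ z ⊎ x ≡ z

exactlyTwo⇒two : ∀ {A : Set} {x y z : A} → ExactlyTwoEqual x y z → TwoEqual x y z
exactlyTwo⇒two (inj₁ (e , _)) = inj₁ e
exactlyTwo⇒two (inj₂ (inj₁ (e , _))) = inj₂ (inj₁ e)
exactlyTwo⇒two (inj₂ (inj₂ (e , _))) = inj₂ (inj₂ e)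

two⇒exactlyTwo : ∀ {A : Set} {x y z : A} → (x ≡ y → y ≡ z → ⊥) → TwoEqual x y z → ExactlyTwoEqual x y z
two⇒exactlyTwo ne (inj₁ x≡y) = inj₁ (x≡y , ne x≡y)
two⇒exactlyTwo ne (inj₂ (inj₁ y≡z)) = inj₂ (inj₁ (y≡z , λ z≡x → ne (sym (trans y≡z z≡x)) y≡z))
two⇒exactlyTwo ne (inj₂ (inj₂ x≡z)) = inj₂ (inj₂ (x≡z , λ x≡y → ne x≡y (trans (sym x≡y) x≡z)))

∣p∣²≡p² : ∀ p → ℚ.∣ p ∣ * ℚ.∣ p ∣ ≡ p * p
∣p∣²≡p² p = go (ℚP.∣p∣≡p∨∣p∣≡-p p)
  where
  go : _ → ℚ.∣ p ∣ * ℚ.∣ p ∣ ≡ p * p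
  go (inj₁ e) = cong₂ _*_ e e
  go (inj₂ e) = trans (cong₂ _*_ e e) (solve 1 (λ p → (S.⊝ p) *ᵉ (S.⊝ p) ≐ p *ᵉ p) refl p)

∣p∣≡∣q∣⇒p≡±q : ∀ p q → ℚ.∣ p ∣ ≡ ℚ.∣ q ∣ → p ≡ q ⊎ p ≡ - q
∣p∣≡∣q∣⇒p≡±q p q e = go (ℚP.∣p∣≡p∨∣p∣≡-p p) (ℚP.∣p∣≡p∨∣p∣≡-p q)
  where
  negneg : ∀ p → - - p ≡ p
  negneg p = solve 1 (λ p → S.⊝ (S.⊝ p) ≐ p) refl p
  go : _ → _ → p ≡ q ⊎ p ≡ - q
  go (inj₁ ep) (inj₁ eq) = inj₁ (trans (sym ep) (trans e eq))
  go (inj₁ ep) (inj₂ eq) = inj₂ (trans (sym ep) (trans e eq))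
  go (inj₂ ep) (inj₁ eq) = inj₂ (trans (sym (negneg p)) (cong -_ (trans (sym ep) (trans e eq))))
  go (inj₂ ep) (inj₂ eq) = inj₁
    (trans (sym (negneg p)) (trans (cong -_ (trans (sym ep) (trans e eq))) (negneg q)))

∣ι∣ : ∀ n → ℚ.∣ ι n ∣ ≡ ι (+ ℤ.∣ n ∣)
∣ι∣ n = trans (cong ℚ.∣_∣ (ι≡mkℚ n)) (sym (ι≡mkℚ (+ ℤ.∣ n ∣)))

-- Purity and norm 2 give τ² = -2 and thus an explicit inverse; membership in the ideal of 1+i makes
-- conjugation by τ preserve H; `anti` expresses orthogonality to the pure quaternion `p`.
record Reflects (τ p : Quat) : Set where
  field
    τ-pure : re τ ≡ 0ℚ
    τ-norm : N τ ≡ ι (+ 2)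
    τ-inP  : InP τ
    anti   : τ · p ≡ neg (p · τ)

-- If two coordinates are equal, the difference of the corresponding units is orthogonal to the
-- quaternion; if they are opposite, the sum is. The quadruples are the coordinates of τ(1+i)⁻¹.
reflector : ∀ {x y z} → TwoEqual ℚ.∣ x ∣ ℚ.∣ y ∣ ℚ.∣ z ∣ → Σ Quat λ τ → Reflects τ (quat 0ℚ x y z)
reflector {x} {y} {z} (inj₁ e) = go (∣p∣≡∣q∣⇒p≡±q x y e)
  where
  go : x ≡ y ⊎ x ≡ - y → _
  go (inj₁ refl) = quat 0ℚ 1ℚ (- 1ℚ) 0ℚ , record { τ-pure = refl ; τ-norm = refl
    ; τ-inP = _ , (+ 1 , + 0 , ℤ.- + 1 , ℤ.- + 1 , refl) , refl
    ; anti = proveQ (x ∷ z ∷ []) (τᵉ ·ᵉ μᵉ) (negᵉ (μᵉ ·ᵉ τᵉ)) refl }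
    where
    τᵉ μᵉ : QExpr 2
    τᵉ = qe (Κ 0ℚ) (Κ 1ℚ) (Κ (- 1ℚ)) (Κ 0ℚ)
    μᵉ = qe (Κ 0ℚ) (Ι (# 0)) (Ι (# 0)) (Ι (# 1))
  go (inj₂ refl) = quat 0ℚ 1ℚ 1ℚ 0ℚ , record { τ-pure = refl ; τ-norm = refl
    ; τ-inP = _ , (+ 1 , + 0 , + 0 , + 0 , refl) , refl
    ; anti = proveQ (y ∷ z ∷ []) (τᵉ ·ᵉ μᵉ) (negᵉ (μᵉ ·ᵉ τᵉ)) refl }
    where
    τᵉ μᵉ : QExpr 2
    τᵉ = qe (Κ 0ℚ) (Κ 1ℚ) (Κ 1ℚ) (Κ 0ℚ)
    μᵉ = qe (Κ 0ℚ) (S.⊝ Ι (# 0)) (Ι (# 0)) (Ι (# 1))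
reflector {x} {y} {z} (inj₂ (inj₁ e)) = go (∣p∣≡∣q∣⇒p≡±q y z e)
  where
  go : y ≡ z ⊎ y ≡ - z → _
  go (inj₁ refl) = quat 0ℚ 0ℚ 1ℚ (- 1ℚ) , record { τ-pure = refl ; τ-norm = refl
    ; τ-inP = _ , (+ 0 , + 0 , + 1 , + 0 , refl) , refl
    ; anti = proveQ (x ∷ y ∷ []) (τᵉ ·ᵉ μᵉ) (negᵉ (μᵉ ·ᵉ τᵉ)) refl }
    where
    τᵉ μᵉ : QExpr 2
    τᵉ = qe (Κ 0ℚ) (Κ 0ℚ) (Κ 1ℚ) (Κ (- 1ℚ))
    μᵉ = qe (Κ 0ℚ) (Ι (# 0)) (Ι (# 1)) (Ι (# 1))
  go (inj₂ refl) = quat 0ℚ 0ℚ 1ℚ 1ℚ , record { τ-pure = refl ; τ-norm = refl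
    ; τ-inP = _ , (+ 0 , + 0 , + 0 , + 1 , refl) , refl
    ; anti = proveQ (x ∷ z ∷ []) (τᵉ ·ᵉ μᵉ) (negᵉ (μᵉ ·ᵉ τᵉ)) refl }
    where
    τᵉ μᵉ : QExpr 2
    τᵉ = qe (Κ 0ℚ) (Κ 0ℚ) (Κ 1ℚ) (Κ 1ℚ)
    μᵉ = qe (Κ 0ℚ) (Ι (# 0)) (S.⊝ Ι (# 1)) (Ι (# 1))
reflector {x} {y} {z} (inj₂ (inj₂ e)) = go (∣p∣≡∣q∣⇒p≡±q x z e)
  where
  go : x ≡ z ⊎ x ≡ - z → _
  go (inj₁ refl) = quat 0ℚ 1ℚ 0ℚ (- 1ℚ) , record { τ-pure = refl ; τ-norm = refl
    ; τ-inP = _ , (+ 1 , + 0 , + 0 , ℤ.- + 1 , refl) , refl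
    ; anti = proveQ (x ∷ y ∷ []) (τᵉ ·ᵉ μᵉ) (negᵉ (μᵉ ·ᵉ τᵉ)) refl }
    where
    τᵉ μᵉ : QExpr 2
    τᵉ = qe (Κ 0ℚ) (Κ 1ℚ) (Κ 0ℚ) (Κ (- 1ℚ))
    μᵉ = qe (Κ 0ℚ) (Ι (# 0)) (Ι (# 1)) (Ι (# 0))
  go (inj₂ refl) = quat 0ℚ 1ℚ 0ℚ 1ℚ , record { τ-pure = refl ; τ-norm = refl
    ; τ-inP = _ , (+ 1 , + 0 , ℤ.- + 1 , + 0 , refl) , refl
    ; anti = proveQ (z ∷ y ∷ []) (τᵉ ·ᵉ μᵉ) (negᵉ (μᵉ ·ᵉ τᵉ)) refl }
    where
    τᵉ μᵉ : QExpr 2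
    τᵉ = qe (Κ 0ℚ) (Κ 1ℚ) (Κ 0ℚ) (Κ 1ℚ)
    μᵉ = qe (Κ 0ℚ) (S.⊝ Ι (# 0)) (Ι (# 1)) (Ι (# 0))

-- A pure Hurwitz quaternion of norm 2 is ±e ± e' with e, e' among i, j, k.
antireflector⇒twoEqual : ∀ {x y z η} → N (quat 0ℚ x y z) ≢ 0ℚ → Hw η → N η ≡ ι (+ 2) →
  η · quat 0ℚ x y z ≡ neg (quat 0ℚ x y z · η) → TwoEqual ℚ.∣ x ∣ ℚ.∣ y ∣ ℚ.∣ z ∣
antireflector⇒twoEqual {x} {y} {z} {η} p≢0 (a , b , c , d , η≡) Nη≡ anti = conclude
  where
  p W : Quat
  p = quat 0ℚ x y z
  W = η · p ⊕ p · η
  pᵉ Wᵉ : QExpr 12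
  pᵉ = qe (Κ 0ℚ) (eᵢ v₂) (eⱼ v₂) (eₖ v₂)
  Wᵉ = v₁ ·ᵉ pᵉ ⊕ᵉ pᵉ ·ᵉ v₁
  W≡0 : W ≡ 0q
  W≡0 = trans (cong (_⊕ p · η) anti) (proveQ (env (p · η) 0q 0q) (negᵉ v₁ ⊕ᵉ v₁) (scalᵉ (Κ 0ℚ)) refl)
  -- The imaginary part of `W` is 2 re(η) times p; half its scalar product with p is re(η)N(p).
  re*N≡0 : re η * N p ≡ 0ℚ
  re*N≡0 = trans
    (S.Ops.prove (env η p 0q) (eᵣ v₁ *ᵉ Nᵉ pᵉ)
      (Κ ½ *ᵉ (eᵢ v₂ *ᵉ eᵢ Wᵉ +ᵉ eⱼ v₂ *ᵉ eⱼ Wᵉ +ᵉ eₖ v₂ *ᵉ eₖ Wᵉ)) refl)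
    (trans (cong (λ W → ½ * (x * im-i W + y * im-j W + z * im-k W)) W≡0)
      (solve 3 (λ x y z → Κ ½ *ᵉ (x *ᵉ Κ 0ℚ +ᵉ y *ᵉ Κ 0ℚ +ᵉ z *ᵉ Κ 0ℚ) ≐ Κ 0ℚ) refl x y z))
  re≡0 : re η ≡ 0ℚ
  re≡0 = go (re η ≟ 0ℚ)
    where
    go : _ → re η ≡ 0ℚ
    go (yes e) = e
    go (no ne) = ⊥-elim (*-nonzero ne p≢0 re*N≡0)
  a≡0 : a ≡ + 0
  a≡0 = ι-injective {a} {+ 0} (begin
    ι a                       ≡⟨ solve 1 (λ a → a ≐ Κ ½ *ᵉ a +ᵉ Κ ½ *ᵉ a) refl (ι a) ⟩
    ½ * ι a + ½ * ι a         ≡⟨ cong₂ _+_ ½a≡0 ½a≡0 ⟩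
    0ℚ                        ∎)
    where
    ½a≡0 : ½ * ι a ≡ 0ℚ
    ½a≡0 = trans (sym (cong re η≡)) re≡0
  imag : ∀ {v} b → v ≡ ½ * ι a + ι b → v ≡ ι b
  imag b e = trans e (trans (cong (λ a → ½ * ι a + ι b) a≡0) (ℚP.+-identityˡ (ι b)))
  -- For the imaginary parts of η and p, the scalar product is -½ times the real part of `W`.
  dot≡0 : ι b * x + ι c * y + ι d * z ≡ 0ℚ
  dot≡0 = begin
    ι b * x + ι c * y + ι d * z
      ≡⟨ cong₂ _+_ (cong₂ (λ u v → u * x + v * y) (imag b (cong im-i η≡)) (imag c (cong im-j η≡)))
         (cong (_* z) (imag d (cong im-k η≡))) ⟨
    im-i η * x + im-j η * y + im-k η * z
      ≡⟨ S.Ops.prove (env η p 0q) (eᵢ v₁ *ᵉ eᵢ v₂ +ᵉ eⱼ v₁ *ᵉ eⱼ v₂ +ᵉ eₖ v₁ *ᵉ eₖ v₂)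
         (Κ (- ½) *ᵉ eᵣ Wᵉ) refl ⟩
    (- ½) * re W                                ≡⟨ cong (λ W → (- ½) * re W) W≡0 ⟩
    0ℚ                                          ∎
  form : normForm (+ 0) b c d ≡ + 2
  form = ι-injective {normForm (+ 0) b c d} {+ 2}
    (trans (cong (λ a → ι (normForm a b c d)) (sym a≡0))
    (trans (sym (N-hw a b c d)) (trans (sym (cong N η≡)) Nη≡)))
  sum≡2 : ℤ.∣ b ∣ ℕ.* ℤ.∣ b ∣ ℕ.+ ℤ.∣ c ∣ ℕ.* ℤ.∣ c ∣ ℕ.+ ℤ.∣ d ∣ ℕ.* ℤ.∣ d ∣ ≡ 2
  sum≡2 = ℤP.+-injective (trans (sym (normℤ≡ b c d)) (trans (lem b c d) form))
    where
    lem : ∀ b c d →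
      b ℤ.* b ℤ.+ c ℤ.* c ℤ.+ d ℤ.* d ≡ + 0 ℤ.* + 0 ℤ.+ b ℤ.* b ℤ.+ c ℤ.* c ℤ.+ d ℤ.* d ℤ.+ + 0 ℤ.*
      (b ℤ.+ c ℤ.+ d)
    lem = solve-∀
  unit : ∀ {u x y v w z} → ℤ.∣ u ∣ ≡ 1 → ℤ.∣ v ∣ ≡ 1 → ℤ.∣ w ∣ ≡ 0 → ι u * x + ι v * y + ι w * z ≡ 0ℚ →
    ℚ.∣ x ∣ ≡ ℚ.∣ y ∣
  unit {u} {x} {y} {v} {w} {z} u≡ v≡ w≡ e = begin
    ℚ.∣ x ∣                 ≡⟨ ∣ux∣ {u} u≡ x ⟨
    ℚ.∣ ι u * x ∣           ≡⟨ cong ℚ.∣_∣ ux≡ ⟩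
    ℚ.∣ - (ι v * y) ∣       ≡⟨ ℚP.∣-p∣≡∣p∣ (ι v * y) ⟩
    ℚ.∣ ι v * y ∣           ≡⟨ ∣ux∣ {v} v≡ y ⟩
    ℚ.∣ y ∣                 ∎
    where
    ∣ux∣ : ∀ {u} → ℤ.∣ u ∣ ≡ 1 → ∀ x → ℚ.∣ ι u * x ∣ ≡ ℚ.∣ x ∣
    ∣ux∣ {u} u≡ x = trans (ℚP.∣p*q∣≡∣p∣*∣q∣ (ι u) x)
      (trans (cong (_* ℚ.∣ x ∣) (trans (∣ι∣ u) (cong (λ n → ι (+ n)) u≡))) (ℚP.*-identityˡ ℚ.∣ x ∣))
    ux≡ : ι u * x ≡ - (ι v * y)
    ux≡ = begin
      ι u * x
        ≡⟨ solve 3 (λ p q r → p ≐ p +ᵉ q +ᵉ Κ 0ℚ *ᵉ r -ᵉ q) refl (ι u * x) (ι v * y) z ⟩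
      ι u * x + ι v * y + 0ℚ * z - ι v * y
        ≡⟨ cong (λ w → ι u * x + ι v * y + ι w * z - ι v * y) (ℤP.∣i∣≡0⇒i≡0 {w} w≡) ⟨
      ι u * x + ι v * y + ι w * z - ι v * y                 ≡⟨ cong (_- ι v * y) e ⟩
      0ℚ - ι v * y                                          ≡⟨ ℚP.+-identityˡ (- (ι v * y)) ⟩
      - (ι v * y)                                           ∎
  cases : ∀ {B C D} → B ℕ.≤ 1 → C ℕ.≤ 1 → D ℕ.≤ 1 → B ℕ.* B ℕ.+ C ℕ.* C ℕ.+ D ℕ.* D ≡ 2 →
    (B ≡ 1 × C ≡ 1 × D ≡ 0) ⊎ (C ≡ 1 × D ≡ 1 × B ≡ 0) ⊎ (B ≡ 1 × D ≡ 1 × C ≡ 0)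
  cases ℕ.z≤n ℕ.z≤n ℕ.z≤n ()
  cases ℕ.z≤n ℕ.z≤n (ℕ.s≤s ℕ.z≤n) ()
  cases ℕ.z≤n (ℕ.s≤s ℕ.z≤n) ℕ.z≤n ()
  cases ℕ.z≤n (ℕ.s≤s ℕ.z≤n) (ℕ.s≤s ℕ.z≤n) _ = inj₂ (inj₁ (refl , refl , refl))
  cases (ℕ.s≤s ℕ.z≤n) ℕ.z≤n ℕ.z≤n ()
  cases (ℕ.s≤s ℕ.z≤n) ℕ.z≤n (ℕ.s≤s ℕ.z≤n) _ = inj₂ (inj₂ (refl , refl , refl))
  cases (ℕ.s≤s ℕ.z≤n) (ℕ.s≤s ℕ.z≤n) ℕ.z≤n _ = inj₁ (refl , refl , refl)
  cases (ℕ.s≤s ℕ.z≤n) (ℕ.s≤s ℕ.z≤n) (ℕ.s≤s ℕ.z≤n) ()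
  rotate : ∀ p q r → q + r + p ≡ p + q + r
  rotate p q r = solve 3 (λ p q r → q +ᵉ r +ᵉ p ≐ p +ᵉ q +ᵉ r) refl p q r
  swap : ∀ p q r → p + r + q ≡ p + q + r
  swap p q r = solve 3 (λ p q r → p +ᵉ r +ᵉ q ≐ p +ᵉ q +ᵉ r) refl p q r
  conclude : TwoEqual ℚ.∣ x ∣ ℚ.∣ y ∣ ℚ.∣ z ∣
  conclude =
    let (bb , bc , bd) = sum-of-three-bounds {ℤ.∣ b ∣} {ℤ.∣ c ∣} {ℤ.∣ d ∣} sum≡2 (ℕ.s≤s (ℕ.s≤s ℕ.z≤n))
    in go (cases bb bc bd sum≡2)
    where
    go : _ → TwoEqual ℚ.∣ x ∣ ℚ.∣ y ∣ ℚ.∣ z ∣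
    go (inj₁ (b≡ , c≡ , d≡)) = inj₁ (unit {b} {x} {y} {c} {d} {z} b≡ c≡ d≡ dot≡0)
    go (inj₂ (inj₁ (c≡ , d≡ , b≡))) = inj₂
      (inj₁ (unit {c} {y} {z} {d} {b} {x} c≡ d≡ b≡ (trans (rotate (ι b * x) (ι c * y) (ι d * z)) dot≡0)))
    go (inj₂ (inj₂ (b≡ , d≡ , c≡))) = inj₂
      (inj₂ (unit {b} {x} {z} {d} {c} {y} b≡ d≡ c≡ (trans (swap (ι b * x) (ι c * y) (ι d * z)) dot≡0)))

-- Ambiguous classes

pure² : ∀ {τ} → re τ ≡ 0ℚ → τ · τ ≡ scal (- N τ)
pure² {quat _ b c d} refl = proveQ (b ∷ c ∷ d ∷ []) (τᵉ ·ᵉ τᵉ) (scalᵉ (S.⊝ (Nᵉ τᵉ))) refl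
  where
  τᵉ : QExpr 3
  τᵉ = qe (Κ 0ℚ) (Ι (# 0)) (Ι (# 1)) (Ι (# 2))

InP⇒Hw : ∀ {p} → InP p → Hw p
InP⇒Hw (ξ , hξ , p≡) = subst Hw (sym p≡) (Hw-· {ξ} {θ} hξ (+ 2 , + 0 , ℤ.- + 1 , ℤ.- + 1 , refl))

module Reflection {x y z : ℚ} (μ≢0 : N (quat 0ℚ x y z) ≢ 0ℚ) {τ : Quat}
  (τ-refl : Reflects τ (quat 0ℚ x y z)) where
  open Reflects τ-refl

  -- Conjugation q ↦ τ⁻¹qτ, because τ² = −2.
  T : Quat → Quat
  T q = scal (- ½) · (τ · q · τ)

  τ² : τ · τ ≡ scal (- ι (+ 2))
  τ² = trans (pure² {τ} τ-pure) (cong (λ n → scal (- n)) τ-norm)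

  T-· : ∀ p q → T (p · q) ≡ T p · T q
  T-· p q = sym (begin
    T p · T q
      ≡⟨ cong (λ w → T p · (scal (- ½) · w)) (·-assoc τ q τ) ⟩
    scal (- ½) · (τ · p · τ) · (scal (- ½) · (τ · (q · τ)))
      ≡⟨ proveQ (env (τ · p) (q · τ) τ) (scalᵉ (Κ (- ½)) ·ᵉ (v₁ ·ᵉ v₃) ·ᵉ (scalᵉ (Κ (- ½)) ·ᵉ (v₃ ·ᵉ v₂)))
         (scalᵉ (Κ (½ * ½)) ·ᵉ (v₁ ·ᵉ (v₃ ·ᵉ v₃) ·ᵉ v₂)) refl ⟩
    scal (½ * ½) · (τ · p · (τ · τ) · (q · τ))
      ≡⟨ cong (λ w → scal (½ * ½) · (τ · p · w · (q · τ))) τ² ⟩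
    scal (½ * ½) · (τ · p · scal (- ι (+ 2)) · (q · τ))
      ≡⟨ proveQ (env (τ · p) (q · τ) 0q) (scalᵉ (Κ (½ * ½)) ·ᵉ (v₁ ·ᵉ scalᵉ (Κ (- ι (+ 2))) ·ᵉ v₂))
         (scalᵉ (Κ (- ½)) ·ᵉ (v₁ ·ᵉ v₂)) refl ⟩
    scal (- ½) · (τ · p · (q · τ))
      ≡⟨ cong (scal (- ½) ·_) (trans (sym (·-assoc (τ · p) q τ)) (cong (_· τ) (·-assoc τ p q))) ⟩
    T (p · q) ∎)

  T-involutive : ∀ q → T (T q) ≡ q
  T-involutive q = begin
    T (T q)
      ≡⟨ proveQ (env (τ · q) τ 0q) (scalᵉ (Κ (- ½)) ·ᵉ (v₂ ·ᵉ (scalᵉ (Κ (- ½)) ·ᵉ (v₁ ·ᵉ v₂)) ·ᵉ v₂))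
         (scalᵉ (Κ (½ * ½)) ·ᵉ (v₂ ·ᵉ v₁ ·ᵉ (v₂ ·ᵉ v₂))) refl ⟩
    scal (½ * ½) · (τ · (τ · q) · (τ · τ))
      ≡⟨ cong₂ (λ v w → scal (½ * ½) · (v · w)) (trans (sym (·-assoc τ τ q)) (cong (_· q) τ²)) τ² ⟩
    scal (½ * ½) · (scal (- ι (+ 2)) · q · scal (- ι (+ 2)))
      ≡⟨ proveQ (env q 0q 0q)
         (scalᵉ (Κ (½ * ½)) ·ᵉ (scalᵉ (Κ (- ι (+ 2))) ·ᵉ v₁ ·ᵉ scalᵉ (Κ (- ι (+ 2))))) v₁ refl ⟩
    q ∎

  N-T : ∀ q → N (T q) ≡ N q
  N-T q = begin
    N (T q)                                         ≡⟨ N-· (scal (- ½)) (τ · q · τ) ⟩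
    N (scal (- ½)) * N (τ · q · τ)
      ≡⟨ cong (N (scal (- ½)) *_) (trans (N-· (τ · q) τ) (cong (_* N τ) (N-· τ q))) ⟩
    N (scal (- ½)) * (N τ * N q * N τ)              ≡⟨ cong (λ n → N (scal (- ½)) * (n * N q * n)) τ-norm ⟩
    N (scal (- ½)) * (ι (+ 2) * N q * ι (+ 2))
      ≡⟨ solve 1 (λ n → Κ (N (scal (- ½))) *ᵉ (Κ (ι (+ 2)) *ᵉ n *ᵉ Κ (ι (+ 2))) ≐ n) refl (N q) ⟩
    N q                                             ∎

  -- The ideal of 1+i is two-sided, so both τq and τ belong to it and the product τqτ is divisible
  -- by 2.
  Hw-T : ∀ {q} → Hw q → Hw (T q)
  Hw-T {q} hq = subst Hw
    (proveQ (env (τ · q · τ) 0q 0q) (negᵉ (scalᵉ (Κ ½) ·ᵉ v₁)) (scalᵉ (Κ (- ½)) ·ᵉ v₁) refl)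
    (Hw-neg {scal ½ · (τ · q · τ)} (InP-half {τ · q} {τ} (InP-·ʳ {τ} {q} τ-inP hq) τ-inP))

  T≡conj : ∀ {q} → Commutes (quat 0ℚ x y z) q → T q ≡ conj q
  T≡conj {q} cq = begin
    scal (- ½) · (τ · q · τ)
      ≡⟨ cong (λ w → scal (- ½) · (w · τ)) (conj-by-reflection μ≢0 τ anti {q} cq) ⟩
    scal (- ½) · (conj q · τ · τ)
      ≡⟨ cong (scal (- ½) ·_) (trans (·-assoc (conj q) τ τ) (cong (conj q ·_) τ²)) ⟩
    scal (- ½) · (conj q · scal (- ι (+ 2)))
      ≡⟨ proveQ (env (conj q) 0q 0q) (scalᵉ (Κ (- ½)) ·ᵉ (v₁ ·ᵉ scalᵉ (Κ (- ι (+ 2))))) v₁ refl ⟩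
    conj q                                      ∎

  T-conj : ∀ {q} → Commutes (quat 0ℚ x y z) q → T (conj q) ≡ q
  T-conj {q} cq = trans (T≡conj {conj q} (Commutes-conj {x} {y} {z} {q} cq)) (conj-involutive q)

module Core {x₀ y₀ z₀ : ℤ} (sf : SquareFree (normℕ x₀ y₀ z₀)) where

  μ : Quat
  μ = pureQ x₀ y₀ z₀

  μ≢0 : N μ ≢ 0ℚ
  μ≢0 = N-pureQ-nonzero {x₀} {y₀} {z₀} sf

  -- The pure quaternion with coordinates `x₁`, `y₁`, `z₁` plays the role of μ′. It enters through
  -- μ′ρ = ρμ, which keeps the inverse of ρ out of the computations.
  module _ {τ : Quat} (τ-refl : Reflects τ μ) {ρ : Quat} (hρ : Hw ρ) (ρ≢0 : N ρ ≢ 0ℚ)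
    {x₁ y₁ z₁ : ℚ} (conjugate : quat 0ℚ x₁ y₁ z₁ · ρ ≡ ρ · μ) where
    open Reflection μ≢0 τ-refl
    open Reflects τ-refl

    private
      p : Quat
      p = quat 0ℚ x₁ y₁ z₁

      R : Quat → Set
      R = Rμ x₀ y₀ z₀ ρ

    InR : ∀ {ξ r} → Hw ξ → r ≡ ξ · ρ → Commutes μ r → R r
    InR {ξ} {r} hξ r≡ cr = ξ , Hw⇒Hurwitz hξ , r≡ , commutant-integral {x₀} {y₀} {z₀} sf {r}
      (subst Hw (sym r≡) (Hw-· {ξ} {ρ} hξ hρ)) cr

    comm : ∀ {p q} → Commutes μ p → Commutes μ q → p · q ≡ q · p
    comm {p} {q} = commutant-comm {ι x₀} {ι y₀} {ι z₀} μ≢0 {p} {q}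

    Np≡Nμ : N p ≡ N μ
    Np≡Nμ = begin
      N p                           ≡⟨ cancel (N p) ⟨
      recip (N ρ) * (N p * N ρ)
        ≡⟨ cong (recip (N ρ) *_) (trans (sym (N-· p ρ)) (trans (cong N conjugate) (N-· ρ μ))) ⟩
      recip (N ρ) * (N ρ * N μ)     ≡⟨ cong (recip (N ρ) *_) (ℚP.*-comm (N ρ) (N μ)) ⟩
      recip (N ρ) * (N μ * N ρ)     ≡⟨ cancel (N μ) ⟩
      N μ                           ∎
      where
      cancel : ∀ s → recip (N ρ) * (s * N ρ) ≡ s
      cancel s = trans (solve 3 (λ r s n → r *ᵉ (s *ᵉ n) ≐ r *ᵉ n *ᵉ s) refl (recip (N ρ)) s (N ρ))
        (trans (cong (_* s) (*-recip ρ≢0)) (ℚP.*-identityˡ s))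

    conj-eq : conj ρ · p ≡ μ · conj ρ
    conj-eq = begin
      conj ρ · p            ≡⟨ proveQ (env ρ p 0q) (conjᵉ v₁ ·ᵉ pᵉ) (negᵉ (conjᵉ (pᵉ ·ᵉ v₁))) refl ⟩
      neg (conj (p · ρ))    ≡⟨ cong (λ w → neg (conj w)) conjugate ⟩
      neg (conj (ρ · μ))    ≡⟨ proveQ (env ρ μ 0q) (negᵉ (conjᵉ (v₁ ·ᵉ pᵉ))) (pᵉ ·ᵉ conjᵉ v₁) refl ⟩
      μ · conj ρ            ∎
      where
      pᵉ : QExpr 12
      pᵉ = qe (Κ 0ℚ) (eᵢ v₂) (eⱼ v₂) (eₖ v₂)

    module Backward {η : Quat} (η-refl : Reflects η p) where
      module Η = Reflects η-refl

      -- α/β = ρ⁻¹ηρτ⁻¹, which commutes with μ because η and τ both act as −1.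
      α ε : Quat
      α = conj ρ · (η · (ρ · τ))
      ε = scal (- ½) · (η · τ)

      nρ : ℕ
      nρ = proj₁ (natNorm hρ)

      Nρ≡ : N ρ ≡ ι (+ nρ)
      Nρ≡ = proj₂ (natNorm hρ)

      -- The common denominator of ρ⁻¹ηρτ⁻¹: here ρ⁻¹ = ρ̄/N(ρ) and τ⁻¹ = -τ/2, so α is to be
      -- divided by -2N(ρ).
      k : ℤ
      k = ℤ.- + 2 ℤ.* + nρ

      β : Quat
      β = ℤq k

      ιk≡ : ι k ≡ (- ι (+ 2)) * N ρ
      ιk≡ = trans (ι-* (ℤ.- + 2) (+ nρ)) (cong ((- ι (+ 2)) *_) (sym Nρ≡))

      k≢0 : ι k ≢ 0ℚ
      k≢0 e = *-nonzero { - ι (+ 2)} {N ρ} (λ ()) ρ≢0 (trans (sym ιk≡) e)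

      -- `ε` is ητ⁻¹. Both η and τ lie in the ideal of 1+i, so the factor ½ does no harm; with norm
      -- 1, ε is a unit.
      hε : Hw ε
      hε = subst Hw (proveQ (env (η · τ) 0q 0q) (negᵉ (scalᵉ (Κ ½) ·ᵉ v₁)) (scalᵉ (Κ (- ½)) ·ᵉ v₁) refl)
        (Hw-neg {scal ½ · (η · τ)} (InP-half {η} {τ} Η.τ-inP τ-inP))

      Nε≡1 : N ε ≡ 1ℚ
      Nε≡1 = trans (N-· (scal (- ½)) (η · τ))
        (cong (N (scal (- ½)) *_) (trans (N-· η τ) (cong₂ _*_ Η.τ-norm τ-norm)))

      hα : Hw α
      hα = Hw-· {conj ρ} {η · (ρ · τ)} (Hw-conj hρ)
        (Hw-· {η} {ρ · τ} (InP⇒Hw {η} Η.τ-inP) (Hw-· {ρ} {τ} hρ (InP⇒Hw {τ} τ-inP)))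

      cα : Commutes μ α
      cα = begin
        conj ρ · (η · (ρ · τ)) · μ
          ≡⟨ trans (·-assoc (conj ρ) (η · (ρ · τ)) μ) (cong (conj ρ ·_) (·-assoc η (ρ · τ) μ)) ⟩
        conj ρ · (η · (ρ · τ · μ))
          ≡⟨ cong (λ w → conj ρ · (η · w)) (trans (·-assoc ρ τ μ) (cong (ρ ·_) anti)) ⟩
        conj ρ · (η · (ρ · neg (μ · τ)))
          ≡⟨ cong (λ w → conj ρ · (η · w))
             (proveQ (env ρ μ τ) (v₁ ·ᵉ (negᵉ (v₂ ·ᵉ v₃))) (negᵉ (v₁ ·ᵉ v₂ ·ᵉ v₃)) refl) ⟩
        conj ρ · (η · neg (ρ · μ · τ))          ≡⟨ cong (λ w → conj ρ · (η · neg (w · τ))) conjugate ⟨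
        conj ρ · (η · neg (p · ρ · τ))          ≡⟨ cong (λ w → conj ρ · (η · neg w)) (·-assoc p ρ τ) ⟩
        conj ρ · (η · neg (p · (ρ · τ)))
          ≡⟨ cong (conj ρ ·_)
             (proveQ (env η p (ρ · τ)) (v₁ ·ᵉ (negᵉ (v₂ ·ᵉ v₃))) (negᵉ (v₁ ·ᵉ v₂) ·ᵉ v₃) refl) ⟩
        conj ρ · (neg (η · p) · (ρ · τ))        ≡⟨ cong (λ w → conj ρ · (neg w · (ρ · τ))) Η.anti ⟩
        conj ρ · (neg (neg (p · η)) · (ρ · τ))
          ≡⟨ cong (conj ρ ·_)
             (proveQ (env p η (ρ · τ)) (negᵉ (negᵉ (v₁ ·ᵉ v₂)) ·ᵉ v₃) (v₁ ·ᵉ (v₂ ·ᵉ v₃)) refl) ⟩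
        conj ρ · (p · (η · (ρ · τ)))            ≡⟨ ·-assoc (conj ρ) p (η · (ρ · τ)) ⟨
        conj ρ · p · (η · (ρ · τ))              ≡⟨ cong (_· (η · (ρ · τ))) conj-eq ⟩
        μ · conj ρ · (η · (ρ · τ))              ≡⟨ ·-assoc μ (conj ρ) (η · (ρ · τ)) ⟩
        μ · α                                   ∎

      two≢0 : ι (+ 2) ≢ 0ℚ
      two≢0 ()

      Nα≢0 : N α ≢ 0ℚ
      Nα≢0 e = *-nonzero (λ c≡0 → ρ≢0 (trans (sym (N-conj ρ)) c≡0))
        (*-nonzero (λ η≡0 → two≢0 (trans (sym Η.τ-norm) η≡0))
          (*-nonzero ρ≢0 (λ τ≡0 → two≢0 (trans (sym τ-norm) τ≡0))))
        (trans (sym (trans (N-· (conj ρ) (η · (ρ · τ)))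
          (cong (N (conj ρ) *_) (trans (N-· η (ρ · τ)) (cong (N η *_) (N-· ρ τ)))))) e)

      cβ : Commutes μ β
      cβ = scal-central (ι k) μ

      -- Both sides equal N(ρ)ηρτ: on the right, τ² = -2 and β = -2N(ρ) cancel the two factors -½.
      -- Since ε is a unit, ρα and T(ρ)β generate the same left ideal of H.
      ρα≡εTρβ : ρ · α ≡ ε · (T ρ · β)
      ρα≡εTρβ = begin
        ρ · (conj ρ · (η · (ρ · τ)))                ≡⟨ ·-assoc ρ (conj ρ) (η · (ρ · τ)) ⟨
        ρ · conj ρ · (η · (ρ · τ))                  ≡⟨ cong (_· (η · (ρ · τ))) (p·conj[p]≡N ρ) ⟩
        scal (N ρ) · (η · (ρ · τ))                  ≡⟨ proveQ (env η (ρ · τ) (scal (N ρ)))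
          (scalᵉ (eᵣ v₃) ·ᵉ (v₁ ·ᵉ v₂))
                                                         (scalᵉ (Κ (½ * ½)) ·ᵉ
                                                           (v₁ ·ᵉ scalᵉ (Κ (- ι (+ 2))) ·ᵉ v₂) ·ᵉ scalᵉ
                                                           (Κ (- ι (+ 2)) *ᵉ eᵣ v₃)) refl ⟩
        scal (½ * ½) · (η · scal (- ι (+ 2)) · (ρ · τ)) · scal ((- ι (+ 2)) * N ρ)
          ≡⟨ cong₂ (λ v w → scal (½ * ½) · (η · v · (ρ · τ)) · scal w) τ² ιk≡ ⟨
        scal (½ * ½) · (η · (τ · τ) · (ρ · τ)) · β
          ≡⟨ cong (_· β)
             (proveQ (env η τ (ρ · τ)) (scalᵉ (Κ (½ * ½)) ·ᵉ (v₁ ·ᵉ (v₂ ·ᵉ v₂) ·ᵉ v₃))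
             (scalᵉ (Κ (- ½)) ·ᵉ (v₁ ·ᵉ v₂) ·ᵉ (scalᵉ (Κ (- ½)) ·ᵉ (v₂ ·ᵉ v₃))) refl) ⟩
        ε · (scal (- ½) · (τ · (ρ · τ))) · β        ≡⟨ cong (λ w → ε · (scal (- ½) · w) · β) (·-assoc τ ρ τ) ⟨
        ε · T ρ · β                                 ≡⟨ ·-assoc ε (T ρ) β ⟩
        ε · (T ρ · β)                               ∎

      Tρβ≡ε̄ρα : T ρ · β ≡ conj ε · (ρ · α)
      Tρβ≡ε̄ρα = sym (begin
        conj ε · (ρ · α)            ≡⟨ cong (conj ε ·_) ρα≡εTρβ ⟩
        conj ε · (ε · (T ρ · β))    ≡⟨ ·-assoc (conj ε) ε (T ρ · β) ⟨
        conj ε · ε · (T ρ · β)      ≡⟨ cong (_· (T ρ · β)) (trans (conj[p]·p≡N ε) (cong scal Nε≡1)) ⟩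
        1q · (T ρ · β)              ≡⟨ ·-identityˡ (T ρ · β) ⟩
        T ρ · β                     ∎)

      -- For r = ξρ, commutativity gives αr = rα = ξρα = ξεT(ρ)β, which dictates y. Its conjugate is
      -- T(y), a left multiple of T(T(ρ)) = ρ.
      to : ∀ q → scaleSet α R q → scaleSet β (conjSet R) q
      to q (r , (ξ , Hξ , r≡ , r∈O) , q≡) = y , Ry , trans q≡ αr≡βy
        where
        hξ : Hw ξ
        hξ = Hurwitz⇒Hw {ξ} Hξ
        y : Quat
        y = ξ · ε · T ρ
        cr : Commutes μ r
        cr = InO⇒Commutes {x₀} {y₀} {z₀} {r} r∈O
        αr≡βy : α · r ≡ β · y
        αr≡βy = begin
          α · r                     ≡⟨ comm {α} {r} cα cr ⟩
          r · α                     ≡⟨ cong (_· α) r≡ ⟩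
          ξ · ρ · α                 ≡⟨ ·-assoc ξ ρ α ⟩
          ξ · (ρ · α)               ≡⟨ cong (ξ ·_) ρα≡εTρβ ⟩
          ξ · (ε · (T ρ · β))       ≡⟨ ·-assoc ξ ε (T ρ · β) ⟨
          ξ · ε · (T ρ · β)         ≡⟨ ·-assoc (ξ · ε) (T ρ) β ⟨
          y · β                     ≡⟨ scal-central (ι k) y ⟨
          β · y                     ∎
        cy : Commutes μ y
        cy = Commutes-unscale {μ} {ι k} {y} k≢0 (subst (Commutes μ) αr≡βy (Commutes-· {μ} {α} {r} cα cr))
        Ry : R (conj y)
        Ry = InR {T (ξ · ε)} {conj y} (Hw-T {ξ · ε} (Hw-· {ξ} {ε} hξ hε)) (begin
          conj y                    ≡⟨ T≡conj {y} cy ⟨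
          T (ξ · ε · T ρ)           ≡⟨ T-· (ξ · ε) (T ρ) ⟩
          T (ξ · ε) · T (T ρ)       ≡⟨ cong (T (ξ · ε) ·_) (T-involutive ρ) ⟩
          T (ξ · ε) · ρ             ∎) (Commutes-conj {ι x₀} {ι y₀} {ι z₀} {y} cy)

      from : ∀ q → scaleSet β (conjSet R) q → scaleSet α R q
      from q (y , (ξ , Hξ , ȳ≡ , ȳ∈O) , q≡) = r , Rr , trans q≡ (trans (sym rα≡βy) (comm {r} {α} cr cα))
        where
        hξ : Hw ξ
        hξ = Hurwitz⇒Hw {ξ} Hξ
        r : Quat
        r = T ξ · conj ε · ρ
        cȳ : Commutes μ (conj y)
        cȳ = InO⇒Commutes {x₀} {y₀} {z₀} {conj y} ȳ∈O
        cy : Commutes μ y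
        cy = subst (Commutes μ) (conj-involutive y) (Commutes-conj {ι x₀} {ι y₀} {ι z₀} {conj y} cȳ)
        y≡ : y ≡ T ξ · T ρ
        y≡ = begin
          y               ≡⟨ T-conj {y} cy ⟨
          T (conj y)      ≡⟨ cong T ȳ≡ ⟩
          T (ξ · ρ)       ≡⟨ T-· ξ ρ ⟩
          T ξ · T ρ       ∎
        rα≡βy : r · α ≡ β · y
        rα≡βy = begin
          T ξ · conj ε · ρ · α        ≡⟨ ·-assoc (T ξ · conj ε) ρ α ⟩
          T ξ · conj ε · (ρ · α)      ≡⟨ ·-assoc (T ξ) (conj ε) (ρ · α) ⟩
          T ξ · (conj ε · (ρ · α))    ≡⟨ cong (T ξ ·_) Tρβ≡ε̄ρα ⟨
          T ξ · (T ρ · β)             ≡⟨ ·-assoc (T ξ) (T ρ) β ⟨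
          T ξ · T ρ · β               ≡⟨ cong (_· β) y≡ ⟨
          y · β                       ≡⟨ scal-central (ι k) y ⟨
          β · y                       ∎
        -- From rα = βy one gets N(α)r = βyᾱ, a product of elements that commute with μ.
        cr : Commutes μ r
        cr = Commutes-unscale {μ} {N α} {r} Nα≢0 (subst (Commutes μ) (begin
          β · y · conj α        ≡⟨ cong (_· conj α) rα≡βy ⟨
          r · α · conj α        ≡⟨ ·-assoc r α (conj α) ⟩
          r · (α · conj α)      ≡⟨ cong (r ·_) (p·conj[p]≡N α) ⟩
          r · scal (N α)        ≡⟨ scal-central (N α) r ⟨
          scal (N α) · r        ∎)
          (Commutes-· {μ} {β · y} {conj α} (Commutes-· {μ} {β} {y} cβ cy)
            (Commutes-conj {ι x₀} {ι y₀} {ι z₀} {α} cα)))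
        Rr : R r
        Rr = InR {T ξ · conj ε} {r} (Hw-· {T ξ} {conj ε} (Hw-T {ξ} hξ) (Hw-conj {ε} hε)) refl cr

      ambiguous : Ambiguous x₀ y₀ z₀ R
      ambiguous = α , β , commutant-integral {x₀} {y₀} {z₀} sf {α} hα cα , commutant-integral {x₀} {y₀} {z₀} sf {β} (Hw-scal k) cβ
        , (λ e → Nα≢0 (cong N e)) , (λ e → k≢0 (cong re e)) , λ q → mk⇔ (to q) (from q)

    -- With R = Hρ ∩ 𝒪 generating Hρ as a left ideal, αR ⊆ βR̄ gives Hρα ⊆ H(Tρ)β.
    module Forward {u v r₁ r₂ : Quat} (hu : Hw u) (hv : Hw v) (Rr₁ : R r₁) (Rr₂ : R r₂)
      (ρ≡ : ρ ≡ u · r₁ ⊕ v · r₂) where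

      -- The inclusion is tested only at `r₁` and `r₂`, because ρ is a left combination of them. A
      -- single inclusion makes ε Hurwitz; that it is a unit needs the opposite one.
      transport : ∀ {α β} → Commutes μ α → Commutes μ β →
        (∀ r → R r → scaleSet β (conjSet R) (α · r)) → Σ Quat λ ε → Hw ε × ρ · α ≡ ε · (T ρ · β)
      transport {α} {β} cα cβ sub =
        let (ζ₁ , hζ₁ , e₁) = each r₁ Rr₁
            (ζ₂ , hζ₂ , e₂) = each r₂ Rr₂
        in u · ζ₁ ⊕ v · ζ₂ , Hw-⊕ {u · ζ₁} {v · ζ₂} (Hw-· {u} {ζ₁} hu hζ₁)
          (Hw-· {v} {ζ₂} hv hζ₂) , combine ζ₁ ζ₂ e₁ e₂
        where
        each : ∀ r → R r → Σ Quat λ ζ → Hw ζ × r · α ≡ ζ · (T ρ · β)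
        each r Rr@(_ , _ , _ , r∈O) = go (sub r Rr)
          where
          go : scaleSet β (conjSet R) (α · r) → Σ Quat λ ζ → Hw ζ × r · α ≡ ζ · (T ρ · β)
          go (y , (ξ , Hξ , ȳ≡ , ȳ∈O) , αr≡) = T ξ , Hw-T {ξ} (Hurwitz⇒Hw {ξ} Hξ) , (begin
            r · α               ≡⟨ comm {r} {α} (InO⇒Commutes {x₀} {y₀} {z₀} {r} r∈O) cα ⟩
            α · r               ≡⟨ αr≡ ⟩
            β · y               ≡⟨ comm {β} {y} cβ cy ⟩
            y · β               ≡⟨ cong (_· β) (T-conj {y} cy) ⟨
            T (conj y) · β      ≡⟨ cong (λ w → T w · β) ȳ≡ ⟩
            T (ξ · ρ) · β       ≡⟨ cong (_· β) (T-· ξ ρ) ⟩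
            T ξ · T ρ · β       ≡⟨ ·-assoc (T ξ) (T ρ) β ⟩
            T ξ · (T ρ · β)     ∎)
            where
            cy : Commutes μ y
            cy = subst (Commutes μ) (conj-involutive y)
              (Commutes-conj {ι x₀} {ι y₀} {ι z₀} {conj y} (InO⇒Commutes {x₀} {y₀} {z₀} {conj y} ȳ∈O))
        combine : ∀ ζ₁ ζ₂ → r₁ · α ≡ ζ₁ · (T ρ · β) → r₂ · α ≡ ζ₂ · (T ρ · β) →
          ρ · α ≡ (u · ζ₁ ⊕ v · ζ₂) · (T ρ · β)
        combine ζ₁ ζ₂ e₁ e₂ = begin
          ρ · α                                               ≡⟨ cong (_· α) ρ≡ ⟩
          (u · r₁ ⊕ v · r₂) · α                               ≡⟨ ·-distribʳ α (u · r₁) (v · r₂) ⟩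
          u · r₁ · α ⊕ v · r₂ · α                             ≡⟨ cong₂ _⊕_ (·-assoc u r₁ α) (·-assoc v r₂ α) ⟩
          u · (r₁ · α) ⊕ v · (r₂ · α)                         ≡⟨ cong₂ (λ s t → u · s ⊕ v · t) e₁ e₂ ⟩
          u · (ζ₁ · (T ρ · β)) ⊕ v · (ζ₂ · (T ρ · β))
            ≡⟨ cong₂ _⊕_ (·-assoc u ζ₁ (T ρ · β)) (·-assoc v ζ₂ (T ρ · β)) ⟨
          u · ζ₁ · (T ρ · β) ⊕ v · ζ₂ · (T ρ · β)             ≡⟨ ·-distribʳ (T ρ · β) (u · ζ₁) (v · ζ₂) ⟨
          (u · ζ₁ ⊕ v · ζ₂) · (T ρ · β)                       ∎

      transport-norm : ∀ {α β ε} → ρ · α ≡ ε · (T ρ · β) → N α ≡ N ε * N β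
      transport-norm {α} {β} {ε} e = begin
        N α                                   ≡⟨ ℚP.*-identityˡ (N α) ⟨
        1ℚ * N α                              ≡⟨ cong (_* N α) (*-recip ρ≢0) ⟨
        recip (N ρ) * N ρ * N α               ≡⟨ ℚP.*-assoc (recip (N ρ)) (N ρ) (N α) ⟩
        recip (N ρ) * (N ρ * N α)             ≡⟨ cong (recip (N ρ) *_) (N-· ρ α) ⟨
        recip (N ρ) * N (ρ · α)               ≡⟨ cong (λ w → recip (N ρ) * N w) e ⟩
        recip (N ρ) * N (ε · (T ρ · β))
          ≡⟨ cong (recip (N ρ) *_)
             (trans (N-· ε (T ρ · β)) (cong (N ε *_) (trans (N-· (T ρ) β) (cong (_* N β) (N-T ρ))))) ⟩
        recip (N ρ) * (N ε * (N ρ * N β))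
          ≡⟨ solve 4 (λ r e n b → r *ᵉ (e *ᵉ (n *ᵉ b)) ≐ r *ᵉ n *ᵉ (e *ᵉ b)) refl (recip (N ρ)) (N ε) (N ρ)
             (N β) ⟩
        recip (N ρ) * N ρ * (N ε * N β)       ≡⟨ cong (_* (N ε * N β)) (*-recip ρ≢0) ⟩
        1ℚ * (N ε * N β)                      ≡⟨ ℚP.*-identityˡ (N ε * N β) ⟩
        N ε * N β                             ∎

      -- Put X = ρτβ, so that ρα = -½ηX. Right multiplication of ρα by μ equals left multiplication
      -- by p, while for X the same exchange costs a sign because τ intervenes. Hence pηX = ηXμ =
      -- -ηpX, and X cancels.
      twist-anticommutes : ∀ {α β ε} → Commutes μ α → Commutes μ β → N β ≢ 0ℚ →
        ρ · α ≡ ε · (T ρ · β) → ε · τ · p ≡ neg (p · (ε · τ))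
      twist-anticommutes {α} {β} {ε} cα cβ β≢0 e = begin
        η · p                   ≡⟨ proveQ (env (η · p) 0q 0q) v₁ (negᵉ (negᵉ v₁)) refl ⟩
        neg (neg (η · p))       ≡⟨ cong neg pη≡ ⟨
        neg (p · η)             ∎
        where
        η X : Quat
        η = ε · τ
        X = ρ · (τ · β)
        X≢0 : N X ≢ 0ℚ
        X≢0 X≡0 = *-nonzero ρ≢0 (*-nonzero (λ τ≡0 → two≢0 (trans (sym τ-norm) τ≡0)) β≢0)
          (trans (sym (trans (N-· ρ (τ · β)) (cong (N ρ *_) (N-· τ β)))) X≡0)
          where
          two≢0 : ι (+ 2) ≢ 0ℚ
          two≢0 ()
        ρα≡ : ρ · α ≡ scal (- ½) · (η · X)
        ρα≡ = begin
          ρ · α                                         ≡⟨ e ⟩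
          ε · (scal (- ½) · (τ · ρ · τ) · β)
            ≡⟨ cong (ε ·_)
               (trans (·-assoc (scal (- ½)) (τ · ρ · τ) β)
               (cong (scal (- ½) ·_) (trans (·-assoc (τ · ρ) τ β) (·-assoc τ ρ (τ · β))))) ⟩
          ε · (scal (- ½) · (τ · X))
            ≡⟨ proveQ (env ε τ X) (v₁ ·ᵉ (scalᵉ (Κ (- ½)) ·ᵉ (v₂ ·ᵉ v₃)))
               (scalᵉ (Κ (- ½)) ·ᵉ (v₁ ·ᵉ v₂ ·ᵉ v₃)) refl ⟩
          scal (- ½) · (η · X)                          ∎
        Xμ≡ : X · μ ≡ neg (p · X)
        Xμ≡ = begin
          ρ · (τ · β) · μ
            ≡⟨ trans (·-assoc ρ (τ · β) μ)
               (cong (ρ ·_) (trans (·-assoc τ β μ) (trans (cong (τ ·_) cβ) (sym (·-assoc τ μ β))))) ⟩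
          ρ · (τ · μ · β)               ≡⟨ cong (λ w → ρ · (w · β)) anti ⟩
          ρ · (neg (μ · τ) · β)
            ≡⟨ cong (ρ ·_) (proveQ (env μ τ β) (negᵉ (v₁ ·ᵉ v₂) ·ᵉ v₃) (negᵉ (v₁ ·ᵉ (v₂ ·ᵉ v₃))) refl) ⟩
          ρ · neg (μ · (τ · β))
            ≡⟨ proveQ (env ρ μ (τ · β)) (v₁ ·ᵉ (negᵉ (v₂ ·ᵉ v₃))) (negᵉ (v₁ ·ᵉ v₂ ·ᵉ v₃)) refl ⟩
          neg (ρ · μ · (τ · β))         ≡⟨ cong (λ w → neg (w · (τ · β))) conjugate ⟨
          neg (p · ρ · (τ · β))         ≡⟨ cong neg (·-assoc p ρ (τ · β)) ⟩
          neg (p · X)                   ∎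
        scaled : scal (- ½) · (p · (η · X)) ≡ scal (- ½) · (η · X · μ)
        scaled = begin
          scal (- ½) · (p · (η · X))
            ≡⟨ proveQ (env p (η · X) 0q) (scalᵉ (Κ (- ½)) ·ᵉ (v₁ ·ᵉ v₂))
               (v₁ ·ᵉ (scalᵉ (Κ (- ½)) ·ᵉ v₂)) refl ⟩
          p · (scal (- ½) · (η · X))    ≡⟨ cong (p ·_) ρα≡ ⟨
          p · (ρ · α)                   ≡⟨ ·-assoc p ρ α ⟨
          p · ρ · α                     ≡⟨ cong (_· α) conjugate ⟩
          ρ · μ · α
            ≡⟨ trans (·-assoc ρ μ α) (trans (cong (ρ ·_) (sym cα)) (sym (·-assoc ρ α μ))) ⟩
          ρ · α · μ                     ≡⟨ cong (_· μ) ρα≡ ⟩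
          scal (- ½) · (η · X) · μ      ≡⟨ ·-assoc (scal (- ½)) (η · X) μ ⟩
          scal (- ½) · (η · X · μ)      ∎
        pη≡ : p · η ≡ neg (η · p)
        pη≡ = ·-cancelʳ {X} X≢0 (begin
          p · η · X                     ≡⟨ ·-assoc p η X ⟩
          p · (η · X)                   ≡⟨ scal-cancelˡ { - ½} (λ ()) scaled ⟩
          η · X · μ                     ≡⟨ trans (·-assoc η X μ) (cong (η ·_) Xμ≡) ⟩
          η · neg (p · X)
            ≡⟨ proveQ (env η p X) (v₁ ·ᵉ (negᵉ (v₂ ·ᵉ v₃))) (negᵉ (v₁ ·ᵉ v₂) ·ᵉ v₃) refl ⟩
          neg (η · p) · X               ∎)

      units : ∀ {ε ε'} → Hw ε → Hw ε' → N ε * N ε' ≡ 1ℚ → N ε ≡ 1ℚ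
      units {ε} {ε'} hε hε' e = let (m , Nε≡) = natNorm hε ; (n , Nε'≡) = natNorm hε' in
        trans Nε≡ (cong (λ k → ι (+ k)) (ℕP.m*n≡1⇒m≡1 m n (ℤP.+-injective (ι-injective {+ (m ℕ.* n)} {+ 1}
          (trans (cong ι (ℤP.pos-* m n)) (trans (ι-* (+ m) (+ n)) (trans (sym (cong₂ _*_ Nε≡ Nε'≡)) e)))))))

      -- Conjugating βR̄ ⊆ αR gives β̄R ⊆ ᾱR̄, which has the shape required by `transport`, with β̄
      -- and ᾱ in place of α and β. The two norm relations N(α) = N(ε)N(β) and N(β) = N(ε′)N(α) then
      -- make ε a unit.
      twoEqual : Ambiguous x₀ y₀ z₀ R → TwoEqual ℚ.∣ x₁ ∣ ℚ.∣ y₁ ∣ ℚ.∣ z₁ ∣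
      twoEqual (α , β , α∈O , β∈O , α≢0 , β≢0 , iff) =
        let (ε , hε , e) = transport {α} {β} cα cβ (λ r Rr → Equivalence.to (iff (α · r)) (r , Rr , refl))
            (ε' , hε' , e') = transport {conj β} {conj α} (Commutes-conj {ι x₀} {ι y₀} {ι z₀} {β} cβ)
              (Commutes-conj {ι x₀} {ι y₀} {ι z₀} {α} cα) conj-sub
        in finish ε hε e ε' hε' e'
        where
        cα : Commutes μ α
        cα = InO⇒Commutes {x₀} {y₀} {z₀} {α} α∈O
        cβ : Commutes μ β
        cβ = InO⇒Commutes {x₀} {y₀} {z₀} {β} β∈O
        conj-sub : ∀ r → R r → scaleSet (conj α) (conjSet R) (conj β · r)
        conj-sub r Rr@(_ , _ , _ , r∈O) = go
          (Equivalence.from (iff (β · conj r)) (conj r , subst R (sym (conj-involutive r)) Rr , refl))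
          where
          go : scaleSet α R (β · conj r) → scaleSet (conj α) (conjSet R) (conj β · r)
          go (y , Ry@(_ , _ , _ , y∈O) , e) = conj y , subst R (sym (conj-involutive y)) Ry , (begin
            conj β · r
              ≡⟨ comm {conj β} {r} (Commutes-conj {ι x₀} {ι y₀} {ι z₀} {β} cβ)
                 (InO⇒Commutes {x₀} {y₀} {z₀} {r} r∈O) ⟩
            r · conj β                ≡⟨ cong (_· conj β) (conj-involutive r) ⟨
            conj (conj r) · conj β    ≡⟨ conj-· β (conj r) ⟨
            conj (β · conj r)         ≡⟨ cong conj e ⟩
            conj (α · y)              ≡⟨ conj-· α y ⟩
            conj y · conj α
              ≡⟨ comm {conj y} {conj α}
                 (Commutes-conj {ι x₀} {ι y₀} {ι z₀} {y} (InO⇒Commutes {x₀} {y₀} {z₀} {y} y∈O))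
                 (Commutes-conj {ι x₀} {ι y₀} {ι z₀} {α} cα) ⟩
            conj α · conj y           ∎)
        finish : ∀ ε → Hw ε → ρ · α ≡ ε · (T ρ · β) → ∀ ε' → Hw ε' → ρ · conj β ≡ ε' · (T ρ · conj α) →
          TwoEqual ℚ.∣ x₁ ∣ ℚ.∣ y₁ ∣ ℚ.∣ z₁ ∣
        finish ε hε e ε' hε' e' = antireflector⇒twoEqual {x₁} {y₁} {z₁} {ε · τ}
          (λ p≡0 → μ≢0 (trans (sym Np≡Nμ) p≡0))
          (Hw-· {ε} {τ} hε (InP⇒Hw {τ} τ-inP))
          (trans (N-· ε τ) (trans (cong₂ _*_ (units {ε} {ε'} hε hε' unit) τ-norm) (ℚP.*-identityˡ (ι (+ 2)))))
          (twist-anticommutes {α} {β} {ε} cα cβ (N-nonzero {β} β≢0) e)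
          where
          Nα≢0 : N α ≢ 0ℚ
          Nα≢0 = N-nonzero {α} α≢0
          Nβ≡ : N β ≡ N ε' * N α
          Nβ≡ = trans (sym (N-conj β))
            (trans (transport-norm {conj β} {conj α} {ε'} e') (cong (N ε' *_) (N-conj α)))
          unit : N ε * N ε' ≡ 1ℚ
          unit = begin
            N ε * N ε'                          ≡⟨ ℚP.*-identityʳ (N ε * N ε') ⟨
            N ε * N ε' * 1ℚ                     ≡⟨ cong (N ε * N ε' *_) (*-recip Nα≢0) ⟨
            N ε * N ε' * (recip (N α) * N α)
              ≡⟨ solve 4 (λ e f r a → e *ᵉ f *ᵉ (r *ᵉ a) ≐ r *ᵉ (e *ᵉ (f *ᵉ a))) refl (N ε) (N ε')
                 (recip (N α)) (N α) ⟩
            recip (N α) * (N ε * (N ε' * N α))  ≡⟨ cong (λ b → recip (N α) * (N ε * b)) Nβ≡ ⟨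
            recip (N α) * (N ε * N β)           ≡⟨ cong (recip (N α) *_) (transport-norm {α} {β} {ε} e) ⟨
            recip (N α) * N α                   ≡⟨ *-recip Nα≢0 ⟩
            1ℚ                                  ∎

-- The coordinates of μ′ and the equivalence

ι-pos : ∀ {n} → n > 0 → ι (+ n) ≢ 0ℚ
ι-pos {suc n} _ e with () ← ι-injective {+ suc n} {+ 0} e

¬threeEqual : ∀ {x₀ y₀ z₀ x y z} → SquareFree (normℕ x₀ y₀ z₀) →
  ExactlyTwoEqual ℤ.∣ x₀ ∣ ℤ.∣ y₀ ∣ ℤ.∣ z₀ ∣ → N (quat 0ℚ x y z) ≡ N (pureQ x₀ y₀ z₀) →
  ∣ x ∣ ≡ ∣ y ∣ → ∣ y ∣ ≡ ∣ z ∣ → ⊥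
¬threeEqual {x₀} {y₀} {z₀} {x} {y} {z} sf two N≡ x≡y y≡z =
  norm3⇒¬exactlyTwo (trans (sym (normℕ≡ x₀ y₀ z₀)) (squarefree≡3r² sf ∣ x ∣ (begin
    ∣ x ∣ * ∣ x ∣ + ∣ x ∣ * ∣ x ∣ + ∣ x ∣ * ∣ x ∣
      ≡⟨ cong₂ (λ s t → ∣ x ∣ * ∣ x ∣ + s * s + t * t) x≡y (trans x≡y y≡z) ⟩
    ∣ x ∣ * ∣ x ∣ + ∣ y ∣ * ∣ y ∣ + ∣ z ∣ * ∣ z ∣
      ≡⟨ cong₂ _+_ (cong₂ _+_ (∣p∣²≡p² x) (∣p∣²≡p² y)) (∣p∣²≡p² z) ⟩
    x * x + y * y + z * z
      ≡⟨ solve 3 (λ x y z → x *ᵉ x +ᵉ y *ᵉ y +ᵉ z *ᵉ z ≐ Nᵉ (qe (Κ 0ℚ) x y z)) refl x y z ⟩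
    N (quat 0ℚ x y z)                               ≡⟨ N≡ ⟩
    N (pureQ x₀ y₀ z₀)                              ≡⟨ N-pureQ x₀ y₀ z₀ ⟩
    ι (+ normℕ x₀ y₀ z₀)                            ∎))) two

ι-twoEqual : ∀ {x y z} → TwoEqual ℤ.∣ x ∣ ℤ.∣ y ∣ ℤ.∣ z ∣ → TwoEqual (∣ ι x ∣) (∣ ι y ∣) (∣ ι z ∣)
ι-twoEqual {x} {y} {z} = go
  where
  lift : ∀ x y → ℤ.∣ x ∣ ≡ ℤ.∣ y ∣ → ∣ ι x ∣ ≡ ∣ ι y ∣
  lift x y e = trans (∣ι∣ x) (trans (cong (λ n → ι (+ n)) e) (sym (∣ι∣ y)))
  go : TwoEqual ℤ.∣ x ∣ ℤ.∣ y ∣ ℤ.∣ z ∣ → TwoEqual (∣ ι x ∣) (∣ ι y ∣) (∣ ι z ∣)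
  go (inj₁ e) = inj₁ (lift x y e)
  go (inj₂ (inj₁ e)) = inj₂ (inj₁ (lift y z e))
  go (inj₂ (inj₂ e)) = inj₂ (inj₂ (lift x z e))

-- The real part of a product is invariant under cyclic permutation of the factors.
conjugate-pure : ∀ {ρ μ} → N ρ ≢ 0ℚ → re μ ≡ 0ℚ → re (ρ · μ · inv ρ) ≡ 0ℚ
conjugate-pure {ρ} {μ} ρ≢0 μ-pure = begin
  re (ρ · μ · inv ρ)      ≡⟨ re-·-comm (ρ · μ) (inv ρ) ⟩
  re (inv ρ · (ρ · μ))    ≡⟨ cong re (·-assoc (inv ρ) ρ μ) ⟨
  re (inv ρ · ρ · μ)      ≡⟨ cong (λ w → re (w · μ)) (inv-· {ρ} ρ≢0) ⟩
  re (1q · μ)             ≡⟨ cong re (·-identityˡ μ) ⟩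
  re μ                    ≡⟨ μ-pure ⟩
  0ℚ                      ∎

conjugate-· : ∀ {ρ μ} → N ρ ≢ 0ℚ → ρ · μ · inv ρ · ρ ≡ ρ · μ
conjugate-· {ρ} {μ} ρ≢0 = trans (·-assoc (ρ · μ) (inv ρ) ρ)
  (trans (cong (ρ · μ ·_) (inv-· {ρ} ρ≢0)) (·-identityʳ (ρ · μ)))

theorem7 : (x₀ y₀ z₀ : ℤ) →
    SquareFree (normℕ x₀ y₀ z₀) →
    ExactlyTwoEqual (Data.Integer.∣_∣ x₀) (Data.Integer.∣_∣ y₀) (Data.Integer.∣_∣ z₀) →
    (c a : ℕ) → c > 0 → a > 0 → (b : ℤ) →
    IsIdealOf x₀ y₀ z₀ (Lattice x₀ y₀ z₀ c a b) →
    (ρ : Quat) → IsRightPseudoGen x₀ y₀ z₀ c a b ρ →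
    let μ′ = ρ · pureQ x₀ y₀ z₀ · inv ρ in
    Ambiguous x₀ y₀ z₀ (Rμ x₀ y₀ z₀ ρ) ⇔
    ExactlyTwoEqual (∣ im-i μ′ ∣) (∣ im-j μ′ ∣) (∣ im-k μ′ ∣)
theorem7 x₀ y₀ z₀ sf two c a c>0 a>0 b _ ρ (δ , gcd@((Hδ , (s , Hs , A≡) , (t , Ht , B≡)) , _) , ρ≡) =
  main (reflector {ι x₀} {ι y₀} {ι z₀} (ι-twoEqual {x₀} {y₀} {z₀} (exactlyTwo⇒two two)))
    (gcd-bezout {δ} {A} {B} A≢0 gcd)
    (im-i μ′) (im-j μ′) (im-k μ′)
    (trans (cong (_· ρ) (sym μ′≡)) (conjugate-· {ρ} {μ} ρ≢0))
  where
  open Core {x₀} {y₀} {z₀} sf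
  A B μ′ : Quat
  A = ℤq (+ a)
  B = ℤq b ⊕ ω x₀ y₀ z₀
  μ′ = ρ · μ · inv ρ
  hρ : Hw ρ
  hρ = subst Hw (sym ρ≡) (Hw-scale (+ c) {δ} (Hurwitz⇒Hw {δ} Hδ))
  A≢0 : N A ≢ 0ℚ
  A≢0 e = *-nonzero (ι-pos a>0) (ι-pos a>0) (trans (sym (N-scal (ι (+ a)))) e)
  ρ≢0 : N ρ ≢ 0ℚ
  ρ≢0 e = *-nonzero (*-nonzero (ι-pos c>0) (ι-pos c>0)) δ≢0
    (trans (cong (_* N δ) (sym (N-scal (ι (+ c)))))
      (trans (sym (N-· (ℤq (+ c)) δ)) (trans (cong N (sym ρ≡)) e)))
    where
    δ≢0 : N δ ≢ 0ℚ
    δ≢0 e = A≢0 (trans (cong N A≡) (trans (N-· s δ) (trans (cong (N s *_) e) (ℚP.*-zeroʳ (N s)))))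
  μ′≡ : μ′ ≡ quat 0ℚ (im-i μ′) (im-j μ′) (im-k μ′)
  μ′≡ = quat≡ (conjugate-pure {ρ} {μ} ρ≢0 refl) refl refl refl
  pull : ∀ u D → u · (ℤq (+ c) · D) ≡ ℤq (+ c) · (u · D)
  pull u D = trans (sym (·-assoc u (ℤq (+ c)) D))
    (trans (cong (_· D) (sym (scal-central (ι (+ c)) u))) (·-assoc (ℤq (+ c)) u D))
  -- The coordinates of μ′ become variables here; all that is used of them is the relation with ρ
  -- and μ.
  main : (Σ Quat λ τ → Reflects τ μ) → (Σ Quat λ u → Σ Quat λ v → Hw u × Hw v × δ ≡ u · A ⊕ v · B) →
    ∀ x y z → quat 0ℚ x y z · ρ ≡ ρ · μ → Ambiguous x₀ y₀ z₀ (Rμ x₀ y₀ z₀ ρ) ⇔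
      ExactlyTwoEqual (∣ x ∣) (∣ y ∣) (∣ z ∣)
  main (τ , τ-refl) (u , v , hu , hv , δ≡) x y z conjugate = mk⇔
    (λ amb → two⇒exactlyTwo
      (¬threeEqual {x₀} {y₀} {z₀} {x} {y} {z} sf two (Np≡Nμ {τ} τ-refl {ρ} hρ ρ≢0 {x} {y} {z} conjugate))
      (Forward.twoEqual {τ} τ-refl {ρ} hρ ρ≢0 {x} {y} {z} conjugate
        {u} {v} {ℤq (+ c) · A} {ℤq (+ c) · B} hu hv
        (generator s A Hs A≡ (scal-central (ι (+ a)) μ))
        (generator t B Ht B≡
          (Commutes-⊕ {μ} {ℤq b} {ω x₀ y₀ z₀} (scal-central (ι b) μ) (ω-commutes x₀ y₀ z₀)))
        ρ≡combination amb))
    (λ ex → let (η , η-refl) = reflector {x} {y} {z} (exactlyTwo⇒two ex)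
            in Backward.ambiguous {τ} τ-refl {ρ} hρ ρ≢0 {x} {y} {z} conjugate {η} η-refl)
    where
    -- The scalar c is central, so ca and c(b + ω) are sρ and tρ. These two basis elements of the
    -- lattice serve as `r₁` and `r₂`, and the Bézout identity for δ, multiplied by c, expresses ρ
    -- through them.
    generator : ∀ s A → IsHurwitz s → A ≡ s · δ → Commutes μ A → Rμ x₀ y₀ z₀ ρ (ℤq (+ c) · A)
    generator s A Hs A≡ cA = InR {τ} τ-refl {ρ} hρ ρ≢0 {x} {y} {z} conjugate {s} {ℤq (+ c) · A}
      (Hurwitz⇒Hw {s} Hs)
      (trans (cong (ℤq (+ c) ·_) A≡) (trans (sym (pull s δ)) (cong (s ·_) (sym ρ≡))))
      (Commutes-· {μ} {ℤq (+ c)} {A} (scal-central (ι (+ c)) μ) cA)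
    ρ≡combination : ρ ≡ u · (ℤq (+ c) · A) ⊕ v · (ℤq (+ c) · B)
    ρ≡combination = begin
      ρ                                               ≡⟨ trans ρ≡ (cong (ℤq (+ c) ·_) δ≡) ⟩
      ℤq (+ c) · (u · A ⊕ v · B)                      ≡⟨ ·-distribˡ (ℤq (+ c)) (u · A) (v · B) ⟩
      ℤq (+ c) · (u · A) ⊕ ℤq (+ c) · (v · B)         ≡⟨ cong₂ _⊕_ (pull u A) (pull v B) ⟨
      u · (ℤq (+ c) · A) ⊕ v · (ℤq (+ c) · B)         ∎
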